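{- For all $n \geq 0$, $p_{\xi}(12n+4) \equiv p_{\xi}(3n+1) \pmod{8}$.
   Context: $(a;q)_n=(1-a)(1-aq)\cdots(1-aq^{n-1})$, $(a;q)_0=1$. The coefficients $p_\xi(n)$ are defined by $\sum_{n\ge0}p_\xi(n)q^n=\xi(q)=1+2\sum_{n\ge1}\frac{q^{6n^2-6n+1}}{(q;q^6)_n(q^5;q^6)_n}$. -}

module Defs where

open import Data.Nat using (ℕ; zero; suc; _+_; _*_; _∸_; _%_; _≡ᵇ_)
open import Data.Bool using (if_then_else_)

-- Formal power series in q with coefficients in ℕ, represented by their
-- coefficient sequences: a series f stands for Σ_m f m q^m.
Series : Set
Series = ℕ → ℕ

sumBelow : ℕ → (ℕ → ℕ) → ℕ
sumBelow zero    g = 0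
sumBelow (suc N) g = sumBelow N g + g N

one : Series
one m = if m ≡ᵇ 0 then 1 else 0

mono : ℕ → Series
mono e m = if m ≡ᵇ e then 1 else 0

_⊛_ : Series → Series → Series
(f ⊛ g) m = sumBelow (suc m) (λ i → f i * g (m ∸ i))

infixl 7 _⊛_

-- 1/(1 - q^(suc k)) = Σ_j q^(j (k+1))
geom : ℕ → Series
geom k m = if (m % suc k) ≡ᵇ 0 then 1 else 0

-- 1/((q;q^6)_n (q^5;q^6)_n) = Π_{i<n} 1/((1 - q^(6i+1)) (1 - q^(6i+5)))
invPoch : ℕ → Series
invPoch zero    = one
invPoch (suc n) = invPoch n ⊛ (geom (6 * n) ⊛ geom (6 * n + 4))

term : ℕ → Series
term n = mono (6 * n * n ∸ 6 * n + 1) ⊛ invPoch n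

-- p_ξ(m): coefficient of q^m in ξ(q) = 1 + 2 Σ_{n≥1} term n.
-- For n ≥ 1 the exponent 6n²-6n+1 ≥ n, so summands with n > m do not
-- contribute to the coefficient of q^m; the sum over 1 ≤ n ≤ m is exact.
pξ : ℕ → ℕ
pξ m = one m + 2 * sumBelow m (λ k → term (suc k) m)

{-# OPTIONS --safe #-}

-- Write Q = q^6 and ξ = 1 + 2 q X. It suffices to show A(4n+1) ≡ A(n) mod 4,
-- where A(m) is the coefficient of q^{3m} in X = Σ_n Q^{n(n+1)} Π_{r≤n} I_r and
-- I_r = 1/((1 - q^{6r+1})(1 - q^{6r+5})).
-- Partial fractions and Durfee rectangles turn X into an Appell-type sum,
--   X = 1/(Q;Q)_∞ Σ_r (-1)^r q^{9r(r+1)} (1 - q^{12r+6}) I_r,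
-- in which (1 - q^{12r+6}) I_r = 1/(1 - q^{6r+1}) + 1/(1 - q^{6r+5}) - 1 is
-- unchanged by extracting every third coefficient. Letting n → ∞ in the same
-- partial fractions gives
--   Σ_r (-1)^r q^{3r(r+1)} (1 - q^{12r+6}) I_r = (Q;Q)_∞^2 / (q, q^5; Q)_∞,
-- and with the Jacobi triple product J(q) = Σ_{a∈ℤ} q^{a(3a+2)} this becomes
--   A(q) = J(q) G(q^2),  G = Π_{3∤n} (1 + q^n)/(1 - q^n) ≡ 1 + 2 Σ_{3∤n} q^n/(1 - q^n) mod 4.
-- The odd part of J(q) is q J(q^4) and the even part of G(q) is G(q^4) mod 4, so
-- Σ A(2n+1) q^n = J(q^2) G(q), and then Σ A(4n+1) q^n ≡ J(q) G(q^2) = A(q).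
--
-- Infinite sums and products are handled in the rings (ℤ/4)[q]/(q^N), where N is
-- arbitrary and all sums and products are cut off at a bound M that is large
-- compared with N.
module Submission where

open import Algebra.Bundles using (CommutativeRing; RawRing)
open import Data.Nat as ℕ using (ℕ; zero; suc; z≤n; s≤s)
import Data.Nat.Properties as ℕₚ
open import Data.Product using (_×_; _,_)
open import Data.Sum using (_⊎_; inj₁; inj₂)
open import Function using (_∘_)
open import Relation.Binary.PropositionalEquality as ≡ using (_≡_; _≢_; module ≡-Reasoning)
import Data.Nat.Solver
open import Defs
open import Algebra.Structures using (IsCommutativeRing)
open import Data.Empty using (⊥-elim)
open import Data.Nat.DivMod using (m%n<n; m≡m%n+[m/n]*n; [m+n]%n≡m%n; [m+kn]%n≡m%n; m<n⇒m%n≡m; m<n⇒m/n≡0; m*n%n≡0; m*n/n≡m; +-distrib-/-∣ˡ; %-distribˡ-+; %-distribˡ-*; m%n*o≡m*o%[n*o]; m/n≤m)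
open import Data.Nat.Divisibility using (_∣_; divides; _∣?_; ∣n⇒∣m*n; m%n≡0⇒n∣m; n∣m⇒m%n≡0; ∣m+n∣m⇒∣n; ∣1⇒≡1)
open import Data.Nat.Coprimality using (Coprime; coprime-divisor)
open import Relation.Nullary using (¬_; yes; no)

-- Finite sums and products

-- `X` has no product formula of its own: its Appell sum carries the weight q^{9r(r+1)}, while the
-- limit of the partial fractions evaluates the sum with weight q^{3r(r+1)}. Restriction to the
-- exponents 3m closes this gap. The prefactor 1/(Q;Q)_∞ and the weights are series in q^3, so the
-- extraction divides their exponents by 3, and each remaining fraction 1/(1 - q^k) has k prime to 3
-- and is left fixed. The factor q in ξ = 1 + 2qX explains the exponents 3n + 1 and 12n + 4 = 3(4n +
-- 1) + 1, and the factor 2 explains why 4 replaces 8. The identities that lead to A(q) = J(q)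
-- G(q^2) hold over the integers. The modulus matters from (1 + q^n)/(1 - q^n) = 2/(1 - q^n) - 1 on:
-- it linearises the product G, and it makes signs irrelevant when G is dissected. Nilpotency of Q
-- replaces convergence: a functional equation is iterated until the power of Q in it is 0.

accumulate : ∀ {a} {A : Set a} → (A → A → A) → A → ℕ → (ℕ → A) → A
accumulate _∙_ ε zero f = ε
accumulate _∙_ ε (suc n) f = f 0 ∙ accumulate _∙_ ε n (f ∘ suc)

-- A ring solver with integer coefficients

module RingKit {c ℓ} (R : CommutativeRing c ℓ) where
  open CommutativeRing R hiding (zero)
  open import Algebra.Properties.Ring ring
  open import Algebra.Properties.AbelianGroup +-abelianGroup using (⁻¹-∙-comm)
  open import Algebra.Properties.CommutativeSemigroup +-commutativeSemigroup using (interchange)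
  open import Algebra.Properties.Semiring.Mult.TCOptimised semiring
    using (×-homo-+; ×1-homo-*) renaming (_×_ to _×′_)
  open import Algebra.Solver.Ring.AlmostCommutativeRing
    using (_-Raw-AlmostCommutative⟶_; fromCommutativeRing)
  open import Data.Maybe using (Maybe; just; nothing)
  open import Relation.Binary.Reasoning.Setoid setoid

  reduce : ℕ → ℕ → ℕ × ℕ
  reduce (suc a) (suc b) = reduce a b
  reduce zero b = zero , b
  reduce (suc a) zero = suc a , zero

  -- Integer coefficients as reduced formal differences of naturals: the solver
  -- compares values of normal forms, so equal integers must have equal codes.
  Coefficient : RawRing _ _
  Coefficient = record
    { Carrier = ℕ × ℕ
    ; _≈_ = _≡_
    ; _+_ = λ { (a , b) (c , d) → reduce (a ℕ.+ c) (b ℕ.+ d) }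
    ; _*_ = λ { (a , b) (c , d) → reduce (a ℕ.* c ℕ.+ b ℕ.* d) (a ℕ.* d ℕ.+ b ℕ.* c) }
    ; -_ = λ { (a , b) → b , a }
    ; 0# = 0 , 0
    ; 1# = 1 , 0
    }

  -- The separate clause for second component 0 makes the codes of 0 and 1 compute to the ring's own
  -- constants, so `0-homo` and `1-homo` are `refl` and solved equations contain no stray
  -- subtraction of 0.
  ⟦_⟧ᶜ : ℕ × ℕ → Carrier
  ⟦ a , zero ⟧ᶜ = a ×′ 1#
  ⟦ a , suc b ⟧ᶜ = a ×′ 1# - suc b ×′ 1#

  private
    difference : ∀ a b → ⟦ a , b ⟧ᶜ ≈ a ×′ 1# - b ×′ 1#
    difference a zero = sym (trans (+-congˡ -0#≈0#) (+-identityʳ _))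
    difference a (suc b) = refl

    +-difference : ∀ x y z w → (x - y) + (z - w) ≈ (x + z) - (y + w)
    +-difference x y z w = trans (interchange x (- y) z (- w)) (+-congˡ (⁻¹-∙-comm y w))

    neg-difference : ∀ x y → - (x - y) ≈ y - x
    neg-difference x y = begin
      - (x - y)       ≈⟨ ⁻¹-∙-comm x (- y) ⟨
      - x + - - y     ≈⟨ +-congˡ (-‿involutive y) ⟩
      - x + y         ≈⟨ +-comm (- x) y ⟩
      y - x           ∎

    *-difference : ∀ x y z w → (x - y) * (z - w) ≈ (x * z + y * w) - (x * w + y * z)
    *-difference x y z w = begin
      (x - y) * (z - w)                       ≈⟨ [y-z]x≈yx-zx (z - w) x y ⟩
      x * (z - w) - y * (z - w)               ≈⟨ +-cong (x[y-z]≈xy-xz x z w) (-‿cong (x[y-z]≈xy-xz y z w)) ⟩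
      (x * z - x * w) - (y * z - y * w)       ≈⟨ +-congˡ (neg-difference (y * z) (y * w)) ⟩
      (x * z - x * w) + (y * w - y * z)       ≈⟨ +-difference (x * z) (x * w) (y * w) (y * z) ⟩
      (x * z + y * w) - (x * w + y * z)       ∎

    ×′-suc : ∀ a → suc a ×′ 1# ≈ 1# + a ×′ 1#
    ×′-suc = ×-homo-+ 1# 1

    reduce-correct : ∀ a b → ⟦ reduce a b ⟧ᶜ ≈ a ×′ 1# - b ×′ 1#
    reduce-correct zero b = difference zero b
    reduce-correct (suc a) zero = difference (suc a) zero
    reduce-correct (suc a) (suc b) = begin
      ⟦ reduce a b ⟧ᶜ                          ≈⟨ reduce-correct a b ⟩
      a ×′ 1# - b ×′ 1#                        ≈⟨ +-identityˡ _ ⟨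
      0# + (a ×′ 1# - b ×′ 1#)                 ≈⟨ +-congʳ (-‿inverseʳ 1#) ⟨
      (1# - 1#) + (a ×′ 1# - b ×′ 1#)          ≈⟨ +-difference _ _ _ _ ⟩
      (1# + a ×′ 1#) - (1# + b ×′ 1#)          ≈⟨ +-cong (×′-suc a) (-‿cong (×′-suc b)) ⟨
      suc a ×′ 1# - suc b ×′ 1#                ∎

    morphism : Coefficient -Raw-AlmostCommutative⟶ fromCommutativeRing R
    morphism = record
      { ⟦_⟧ = ⟦_⟧ᶜ
      ; +-homo = λ { (a , b) (c , d) → begin
          ⟦ reduce (a ℕ.+ c) (b ℕ.+ d) ⟧ᶜ                     ≈⟨ reduce-correct (a ℕ.+ c) (b ℕ.+ d) ⟩
          (a ℕ.+ c) ×′ 1# - (b ℕ.+ d) ×′ 1#                   ≈⟨ +-cong (×-homo-+ 1# a c) (-‿cong (×-homo-+ 1# b d)) ⟩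
          (a ×′ 1# + c ×′ 1#) - (b ×′ 1# + d ×′ 1#)           ≈⟨ +-difference _ _ _ _ ⟨
          (a ×′ 1# - b ×′ 1#) + (c ×′ 1# - d ×′ 1#)           ≈⟨ +-cong (difference a b) (difference c d) ⟨
          ⟦ a , b ⟧ᶜ + ⟦ c , d ⟧ᶜ                             ∎ }
      ; *-homo = λ { (a , b) (c , d) → begin
          ⟦ reduce (a ℕ.* c ℕ.+ b ℕ.* d) (a ℕ.* d ℕ.+ b ℕ.* c) ⟧ᶜ
            ≈⟨ reduce-correct (a ℕ.* c ℕ.+ b ℕ.* d) (a ℕ.* d ℕ.+ b ℕ.* c) ⟩
          (a ℕ.* c ℕ.+ b ℕ.* d) ×′ 1# - (a ℕ.* d ℕ.+ b ℕ.* c) ×′ 1#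
            ≈⟨ +-cong (+*-homo a c b d) (-‿cong (+*-homo a d b c)) ⟩
          (a ×′ 1# * c ×′ 1# + b ×′ 1# * d ×′ 1#) - (a ×′ 1# * d ×′ 1# + b ×′ 1# * c ×′ 1#)
            ≈⟨ *-difference _ _ _ _ ⟨
          (a ×′ 1# - b ×′ 1#) * (c ×′ 1# - d ×′ 1#)           ≈⟨ *-cong (difference a b) (difference c d) ⟨
          ⟦ a , b ⟧ᶜ * ⟦ c , d ⟧ᶜ                             ∎ }
      ; -‿homo = λ { (a , b) → begin
          ⟦ b , a ⟧ᶜ                   ≈⟨ difference b a ⟩
          b ×′ 1# - a ×′ 1#            ≈⟨ neg-difference _ _ ⟨
          - (a ×′ 1# - b ×′ 1#)        ≈⟨ -‿cong (difference a b) ⟨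
          - ⟦ a , b ⟧ᶜ                 ∎ }
      ; 0-homo = refl
      ; 1-homo = refl
      }
      where
      +*-homo : ∀ a c b d → (a ℕ.* c ℕ.+ b ℕ.* d) ×′ 1# ≈ a ×′ 1# * c ×′ 1# + b ×′ 1# * d ×′ 1#
      +*-homo a c b d = trans (×-homo-+ 1# (a ℕ.* c) (b ℕ.* d)) (+-cong (×1-homo-* a c) (×1-homo-* b d))

    coefficient≟ : ∀ p q → Maybe (⟦ p ⟧ᶜ ≈ ⟦ q ⟧ᶜ)
    coefficient≟ (a , b) (c , d) with a ℕ.≟ c | b ℕ.≟ d
    ... | yes ≡.refl | yes ≡.refl = just refl
    ... | _ | _ = nothing

  open import Algebra.Solver.Ring Coefficient (fromCommutativeRing R) morphism coefficient≟ public
    using (solve; Polynomial; _:+_; _:*_; _:-_; :-_; _:=_; con)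

  :1 : ∀ {n} → Polynomial n
  :1 = con (1 , 0)
  :0 : ∀ {n} → Polynomial n
  :0 = con (0 , 0)

  unit-cancel : ∀ {u v x y} → u * v ≈ 1# → u * x ≈ u * y → x ≈ y
  unit-cancel {u} {v} {x} {y} uv ux≈uy = begin
    x             ≈⟨ *-identityˡ x ⟨
    1# * x        ≈⟨ *-congʳ (trans (*-comm v u) uv) ⟨
    (v * u) * x   ≈⟨ *-assoc v u x ⟩
    v * (u * x)   ≈⟨ *-congˡ ux≈uy ⟩
    v * (u * y)   ≈⟨ *-assoc v u y ⟨
    (v * u) * y   ≈⟨ *-congʳ (trans (*-comm v u) uv) ⟩
    1# * y        ≈⟨ *-identityˡ y ⟩
    y             ∎

  0*-≈0 : ∀ {x} y → x ≈ 0# → x * y ≈ 0#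
  0*-≈0 y p = trans (*-congʳ p) (zeroˡ y)

  *0-≈0 : ∀ x {y} → y ≈ 0# → x * y ≈ 0#
  *0-≈0 x p = trans (*-congˡ p) (zeroʳ x)

  -- Rearrangement of finite sums and products

  ∑ ∏ : ℕ → (ℕ → Carrier) → Carrier
  ∑ = accumulate _+_ 0#
  ∏ = accumulate _*_ 1#

  -- Σ_{r + k = n} f r k
  ∑∑ : ℕ → (ℕ → ℕ → Carrier) → Carrier
  ∑∑ zero f = f 0 0
  ∑∑ (suc n) f = f 0 (suc n) + ∑∑ n (f ∘ suc)

  ∑-cong : ∀ n {f g} → (∀ i → i ℕ.< n → f i ≈ g i) → ∑ n f ≈ ∑ n g
  ∑-cong zero p = refl
  ∑-cong (suc n) p = +-cong (p 0 (s≤s z≤n)) (∑-cong n λ i i<n → p (suc i) (s≤s i<n))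

  ∑-≈0 : ∀ n {f} → (∀ i → i ℕ.< n → f i ≈ 0#) → ∑ n f ≈ 0#
  ∑-≈0 zero p = refl
  ∑-≈0 (suc n) p = trans (+-cong (p 0 (s≤s z≤n)) (∑-≈0 n λ i i<n → p (suc i) (s≤s i<n))) (+-identityʳ 0#)

  ∑-+ : ∀ n f g → ∑ n (λ i → f i + g i) ≈ ∑ n f + ∑ n g
  ∑-+ zero f g = sym (+-identityʳ 0#)
  ∑-+ (suc n) f g = trans (+-congˡ (∑-+ n (f ∘ suc) (g ∘ suc))) (interchange _ _ _ _)

  ∑-*ˡ : ∀ n x f → ∑ n (λ i → x * f i) ≈ x * ∑ n f
  ∑-*ˡ zero x f = sym (zeroʳ x)
  ∑-*ˡ (suc n) x f = trans (+-congˡ (∑-*ˡ n x (f ∘ suc))) (sym (distribˡ x _ _))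

  ∑-snoc : ∀ n f → ∑ (suc n) f ≈ ∑ n f + f n
  ∑-snoc zero f = +-comm _ _
  ∑-snoc (suc n) f = trans (+-congˡ (∑-snoc n (f ∘ suc))) (sym (+-assoc _ _ _))

  ∏-snoc : ∀ n f → ∏ (suc n) f ≈ ∏ n f * f n
  ∏-snoc zero f = *-comm _ _
  ∏-snoc (suc n) f = trans (*-congˡ (∏-snoc n (f ∘ suc))) (sym (*-assoc _ _ _))

  ∑-extend : ∀ {m n} f → m ℕ.≤ n → (∀ i → m ℕ.≤ i → f i ≈ 0#) → ∑ m f ≈ ∑ n f
  ∑-extend {n = n} f z≤n p = sym (∑-≈0 n λ i _ → p i z≤n)
  ∑-extend f (s≤s m≤n) p = +-congˡ (∑-extend (f ∘ suc) m≤n λ i m≤i → p (suc i) (s≤s m≤i))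

  ∏-cong : ∀ n {f g} → (∀ i → i ℕ.< n → f i ≈ g i) → ∏ n f ≈ ∏ n g
  ∏-cong zero p = refl
  ∏-cong (suc n) p = *-cong (p 0 (s≤s z≤n)) (∏-cong n λ i i<n → p (suc i) (s≤s i<n))

  ∏-≈1 : ∀ n {f} → (∀ i → f i ≈ 1#) → ∏ n f ≈ 1#
  ∏-≈1 zero p = refl
  ∏-≈1 (suc n) p = trans (*-cong (p 0) (∏-≈1 n λ i → p (suc i))) (*-identityʳ 1#)

  ∏-extend : ∀ {m n} f → m ℕ.≤ n → (∀ i → m ℕ.≤ i → f i ≈ 1#) → ∏ m f ≈ ∏ n f
  ∏-extend {n = n} f z≤n p = sym (∏-≈1 n λ i → p i z≤n)
  ∏-extend f (s≤s m≤n) p = *-congˡ (∏-extend (f ∘ suc) m≤n λ i m≤i → p (suc i) (s≤s m≤i))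

  *-xyz≈xzy : ∀ a b c → a * (b * c) ≈ (a * c) * b
  *-xyz≈xzy = solve 3 (λ a b c → a :* (b :* c) := (a :* c) :* b) refl

  *-interchange : ∀ a b c d → (a * b) * (c * d) ≈ (a * c) * (b * d)
  *-interchange = solve 4 (λ a b c d → (a :* b) :* (c :* d) := (a :* c) :* (b :* d)) refl

  ∏-* : ∀ n f g → ∏ n (λ i → f i * g i) ≈ ∏ n f * ∏ n g
  ∏-* zero f g = sym (*-identityʳ 1#)
  ∏-* (suc n) f g = trans (*-congˡ (∏-* n (f ∘ suc) (g ∘ suc))) (*-interchange _ _ _ _)

  ∑∑-cong : ∀ n {f g} → (∀ r k → r ℕ.+ k ≡ n → f r k ≈ g r k) → ∑∑ n f ≈ ∑∑ n g
  ∑∑-cong zero p = p 0 0 ≡.refl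
  ∑∑-cong (suc n) p = +-cong (p 0 (suc n) ≡.refl) (∑∑-cong n λ r k eq → p (suc r) k (≡.cong suc eq))

  ∑∑-snoc : ∀ n f → ∑∑ (suc n) f ≈ ∑∑ n (λ r k → f r (suc k)) + f (suc n) 0
  ∑∑-snoc zero f = refl
  ∑∑-snoc (suc n) f = trans (+-congˡ (∑∑-snoc n (f ∘ suc))) (sym (+-assoc _ _ _))

  ∑∑-+ : ∀ n f g → ∑∑ n (λ r k → f r k + g r k) ≈ ∑∑ n f + ∑∑ n g
  ∑∑-+ zero f g = refl
  ∑∑-+ (suc n) f g = trans (+-congˡ (∑∑-+ n (f ∘ suc) (g ∘ suc))) (interchange _ _ _ _)

  ∑∑-*ˡ : ∀ n x f → ∑∑ n (λ r k → x * f r k) ≈ x * ∑∑ n f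
  ∑∑-*ˡ zero x f = refl
  ∑∑-*ˡ (suc n) x f = trans (+-congˡ (∑∑-*ˡ n x (f ∘ suc))) (sym (distribˡ x _ _))

  ∑∑-≈∑ : ∀ n {f} g → (∀ r k → r ℕ.+ k ≡ n → f r k ≈ g r) → ∑∑ n f ≈ ∑ (suc n) g
  ∑∑-≈∑ zero g p = trans (p 0 0 ≡.refl) (sym (+-identityʳ _))
  ∑∑-≈∑ (suc n) g p = +-cong (p 0 (suc n) ≡.refl) (∑∑-≈∑ n (g ∘ suc) λ r k eq → p (suc r) k (≡.cong suc eq))

  -- The antidiagonals j < m cover the triangle r + k < m, outside of which f vanishes. Removing row
  -- 0 leaves the same situation with m smaller by one.
  triangle≈rectangle : ∀ {m n} f → m ℕ.≤ n → (∀ r k → m ℕ.≤ r ℕ.+ k → f r k ≈ 0#) →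
    ∑ m (λ j → ∑∑ j f) ≈ ∑ m (λ r → ∑ n (f r))
  triangle≈rectangle {zero} f m≤n p = refl
  triangle≈rectangle {suc m} {n} f m≤n p = begin
    f 0 0 + ∑ m (λ j → f 0 (suc j) + ∑∑ j (f ∘ suc))                ≈⟨ +-congˡ (∑-+ m (f 0 ∘ suc) _) ⟩
    f 0 0 + (∑ m (f 0 ∘ suc) + ∑ m (λ j → ∑∑ j (f ∘ suc)))          ≈⟨ +-assoc _ _ _ ⟨
    ∑ (suc m) (f 0) + ∑ m (λ j → ∑∑ j (f ∘ suc))
      ≈⟨ +-cong (∑-extend (f 0) m≤n (p 0))
                (triangle≈rectangle (f ∘ suc) (ℕₚ.<⇒≤ m≤n) (λ r k le → p (suc r) k (s≤s le))) ⟩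
    ∑ n (f 0) + ∑ m (λ r → ∑ n (f (suc r)))                         ∎

  regroup : ∀ a b c d e → (a + b) + (c + (d + e)) ≈ ((a + c) + d) + (b + e)
  regroup = solve 5 (λ a b c d e → (a :+ b) :+ (c :+ (d :+ e)) := ((a :+ c) :+ d) :+ (b :+ e)) refl

  ∑-+-drop-last : ∀ n f g → g n ≈ 0# → ∑ (suc n) (λ i → f i + g i) ≈ ∑ (suc n) f + ∑ n g
  ∑-+-drop-last n f g p = begin
    ∑ (suc n) (λ i → f i + g i)     ≈⟨ ∑-+ (suc n) f g ⟩
    ∑ (suc n) f + ∑ (suc n) g       ≈⟨ +-congˡ (∑-snoc n g) ⟩
    ∑ (suc n) f + (∑ n g + g n)     ≈⟨ +-congˡ (+-congˡ p) ⟩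
    ∑ (suc n) f + (∑ n g + 0#)      ≈⟨ +-congˡ (+-identityʳ (∑ n g)) ⟩
    ∑ (suc n) f + ∑ n g             ∎

  -- Removing the first row and the first column shifts both indices by one, which keeps their
  -- difference; each removed entry is the start of its diagonal. Used to sort a product of two
  -- series by the difference of the indices.
  square≈diagonals : ∀ {m n} (g : ℕ → ℕ → Carrier) → m ℕ.≤ n → (∀ r k → m ℕ.≤ r ⊎ m ℕ.≤ k → g r k ≈ 0#) →
    ∑ m (λ r → ∑ m (g r)) ≈ ∑ n (λ a → ∑ n (λ l → g (l ℕ.+ a) l)) + ∑ n (λ a → ∑ n (λ l → g l (l ℕ.+ suc a)))
  square≈diagonals {zero} {n} g m≤n p =
    sym (trans (+-cong (∑-≈0 n λ a _ → ∑-≈0 n λ l _ → p (l ℕ.+ a) l (inj₁ z≤n))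
                       (∑-≈0 n λ a _ → ∑-≈0 n λ l _ → p l (l ℕ.+ suc a) (inj₁ z≤n))) (+-identityʳ 0#))
  square≈diagonals {suc m} {suc n} g (s≤s m≤n) p = begin
    ∑ (suc m) (g 0) + ∑ m (λ r → g (suc r) 0 + ∑ m (g′ r))
      ≈⟨ +-congˡ (∑-+ m column (λ r → ∑ m (g′ r))) ⟩
    (g 0 0 + ∑ m row) + (∑ m column + ∑ m (λ r → ∑ m (g′ r)))
      ≈⟨ +-cong (+-congˡ (∑-extend row (ℕₚ.m≤n⇒m≤1+n m≤n) λ i le → p 0 (suc i) (inj₂ (s≤s le))))
                (+-cong (∑-extend column m≤n λ i le → p (suc i) 0 (inj₁ (s≤s le)))
                        (square≈diagonals g′ m≤n p′)) ⟩
    (g 0 0 + ∑ (suc n) row) + (∑ n column + (∑ n upper + ∑ n lower))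
      ≈⟨ regroup (g 0 0) (∑ (suc n) row) (∑ n column) (∑ n upper) (∑ n lower) ⟩
    ((g 0 0 + ∑ n column) + ∑ n upper) + (∑ (suc n) row + ∑ n lower)
      ≈⟨ +-cong (∑-+-drop-last n (λ a → g a 0) upper (∑-≈0 n λ l _ →
                  p′ (l ℕ.+ n) l (inj₁ (ℕₚ.≤-trans m≤n (ℕₚ.m≤n+m n l)))))
                (∑-+-drop-last n row lower (∑-≈0 n λ l _ →
                  p′ l (l ℕ.+ suc n) (inj₂ (ℕₚ.≤-trans (ℕₚ.m≤n⇒m≤1+n m≤n) (ℕₚ.m≤n+m (suc n) l))))) ⟨
    ∑ (suc n) (λ a → g a 0 + upper a) + ∑ (suc n) (λ a → row a + lower a) ∎
    where
    g′ : ℕ → ℕ → Carrier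
    g′ r k = g (suc r) (suc k)
    p′ : ∀ r k → m ℕ.≤ r ⊎ m ℕ.≤ k → g′ r k ≈ 0#
    p′ r k (inj₁ le) = p (suc r) (suc k) (inj₁ (s≤s le))
    p′ r k (inj₂ le) = p (suc r) (suc k) (inj₂ (s≤s le))
    row column upper lower : ℕ → Carrier
    row k = g 0 (suc k)
    column r = g (suc r) 0
    upper a = ∑ n (λ l → g′ (l ℕ.+ a) l)
    lower a = ∑ n (λ l → g′ l (l ℕ.+ suc a))

-- q-series identities for nilpotent Q

-- n(n-1)/2
triangular : ℕ → ℕ
triangular zero = 0
triangular (suc n) = triangular n ℕ.+ n

n≤triangular[1+n] : ∀ n → n ℕ.≤ triangular (suc n)
n≤triangular[1+n] n = ℕₚ.m≤n+m n (triangular n)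

module _ where
  open Data.Nat.Solver.+-*-Solver

  -- The exponent of Q in the product of two Euler terms with indices l + a and l. The summand l
  -- comes from x^l y^l = Q^l.
  triangular-l+a : ∀ l a → (triangular (l ℕ.+ a) ℕ.+ triangular l) ℕ.+ l ≡ l ℕ.* (l ℕ.+ a) ℕ.+ triangular a
  triangular-l+a zero a = ≡.trans (ℕₚ.+-identityʳ _) (ℕₚ.+-identityʳ _)
  triangular-l+a (suc l) a = ≡.trans
    (solve 4 (λ t u l a → ((t :+ (l :+ a)) :+ (u :+ l)) :+ (con 1 :+ l)
                       := ((t :+ u) :+ l) :+ ((l :+ a) :+ (l :+ con 1))) ≡.refl
      (triangular (l ℕ.+ a)) (triangular l) l a)
    (≡.trans (≡.cong (ℕ._+ ((l ℕ.+ a) ℕ.+ (l ℕ.+ 1))) (triangular-l+a l a))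
      (solve 3 (λ t l a → (l :* (l :+ a) :+ t) :+ ((l :+ a) :+ (l :+ con 1))
                       := (con 1 :+ l) :* (con 1 :+ (l :+ a)) :+ t) ≡.refl (triangular a) l a))

  durfee-exponent : ∀ k a → k ℕ.* (k ℕ.+ suc a) ≡ k ℕ.* (k ℕ.+ a) ℕ.+ k
  durfee-exponent = solve 2 (λ k a → k :* (k :+ (con 1 :+ a)) := k :* (k :+ a) :+ k) ≡.refl

  durfee-exponent-suc : ∀ k a → suc k ℕ.* (suc k ℕ.+ a) ≡ suc a ℕ.+ k ℕ.* (k ℕ.+ suc (suc a))
  durfee-exponent-suc = solve 2 (λ k a → (con 1 :+ k) :* ((con 1 :+ k) :+ a)
    := (con 1 :+ a) :+ k :* (k :+ (con 2 :+ a))) ≡.refl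

  -- The second summand on the right is the Durfee exponent k(k + a) at a = 2r + 1, and the first is
  -- free of k. This is what lets the sum over k be carried out separately for each r.
  pronic-+ : ∀ r k → (r ℕ.+ k) ℕ.* suc (r ℕ.+ k) ≡ r ℕ.* suc r ℕ.+ k ℕ.* (k ℕ.+ suc (r ℕ.+ r))
  pronic-+ = solve 2 (λ r k → (r :+ k) :* (con 1 :+ (r :+ k))
    := r :* (con 1 :+ r) :+ k :* (k :+ (con 1 :+ (r :+ r)))) ≡.refl

module QSeries {c ℓ} (R : CommutativeRing c ℓ) (Q : CommutativeRing.Carrier R) (M : ℕ) where
  open CommutativeRing R hiding (zero; ring)
  open RingKit R
  open import Algebra.Properties.Ring (CommutativeRing.ring R)
  open import Algebra.Properties.CommutativeSemiring.Exp commutativeSemiring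
  open import Relation.Binary.Reasoning.Setoid setoid

  Q^ : ℕ → Carrier
  Q^ n = Q ^ n

  -- Since Q^n = 0 for n ≥ M, the element e M below plays the role of 1/(Q;Q)_∞.
  module Identities (Q^M≈0 : Q ^ M ≈ 0#) (h : ℕ → Carrier)
    (h-inverse : ∀ k → (1# - Q ^ suc k) * h k ≈ 1#) where

    Q^-+ : ∀ m n → Q^ (m ℕ.+ n) ≈ Q^ m * Q^ n
    Q^-+ = ^-homo-* Q

    Q^-≈0 : ∀ {n} → M ℕ.≤ n → Q^ n ≈ 0#
    Q^-≈0 {n} M≤n = begin
      Q^ n                    ≡⟨ ≡.cong Q^ (ℕₚ.m+[n∸m]≡n M≤n) ⟨
      Q^ (M ℕ.+ (n ℕ.∸ M))    ≈⟨ Q^-+ M (n ℕ.∸ M) ⟩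
      Q^ M * Q^ (n ℕ.∸ M)     ≈⟨ 0*-≈0 _ Q^M≈0 ⟩
      0#                      ∎

    e : ℕ → Carrier
    e n = ∏ n h

    e-inverse : ∀ n → e n * ∏ n (λ k → 1# - Q^ (suc k)) ≈ 1#
    e-inverse n = begin
      ∏ n h * ∏ n (λ k → 1# - Q^ (suc k))   ≈⟨ ∏-* n h (λ k → 1# - Q^ (suc k)) ⟨
      ∏ n (λ k → h k * (1# - Q^ (suc k)))   ≈⟨ ∏-≈1 n (λ k → trans (*-comm _ _) (h-inverse k)) ⟩
      1#                                    ∎

    e-pred : ∀ n → e n ≈ e (suc n) * (1# - Q^ (suc n))
    e-pred n = begin
      e n                                    ≈⟨ *-identityʳ (e n) ⟨
      e n * 1#                               ≈⟨ *-congˡ (h-inverse n) ⟨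
      e n * ((1# - Q^ (suc n)) * h n)        ≈⟨ *-xyz≈xzy (e n) (1# - Q^ (suc n)) (h n) ⟩
      (e n * h n) * (1# - Q^ (suc n))        ≈⟨ *-congʳ (∏-snoc n h) ⟨
      e (suc n) * (1# - Q^ (suc n))          ∎

    e-stable : ∀ {n} → M ℕ.≤ n → e n ≈ e M
    e-stable M≤n = sym (∏-extend h M≤n λ k M≤k → begin
      h k                          ≈⟨ *-identityˡ (h k) ⟨
      1# * h k                     ≈⟨ *-congʳ (trans (+-congˡ (trans (-‿cong (Q^-≈0 (ℕₚ.m≤n⇒m≤1+n M≤k))) -0#≈0#)) (+-identityʳ 1#)) ⟨
      (1# - Q^ (suc k)) * h k      ≈⟨ h-inverse k ⟩
      1#                           ∎)

    -- Durfee rectangles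

    t : ℕ → ℕ → Carrier
    t a k = Q^ (k ℕ.* (k ℕ.+ a)) * (e k * e (k ℕ.+ a))

    U : ℕ → Carrier
    U a = ∑ (suc M) (t a)

    private
      -- The defect in the recurrence `t-step`. Its factor 1 - Q^k removes the entry k = 0 and
      -- lowers `e k` to `e (k - 1)`, so that a shift of k turns the defect back into a multiple of
      -- `t (suc (suc a))`.
      w : ℕ → ℕ → Carrier
      w a k = Q^ (k ℕ.* (k ℕ.+ a)) * (e k * e (k ℕ.+ suc a)) * (1# - Q^ k)

      t-step : ∀ a k → t a k + Q^ (suc a) * t (suc a) k ≈ t (suc a) k + w a k
      t-step a k = begin
        t a k + Q^ (suc a) * t (suc a) k
          ≈⟨ +-cong (*-congˡ (*-congˡ e-split)) (*-congˡ (*-congʳ P-split)) ⟩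
        P * (e k * (e′ * (1# - Q^ k * Q^ (suc a)))) + Q^ (suc a) * (P * Q^ k * (e k * e′))
          ≈⟨ expand P (Q^ k) (Q^ (suc a)) (e k) e′ ⟩
        P * Q^ k * (e k * e′) + P * (e k * e′) * (1# - Q^ k)
          ≈⟨ +-congʳ (*-congʳ P-split) ⟨
        t (suc a) k + w a k ∎
        where
        P e′ : Carrier
        P = Q^ (k ℕ.* (k ℕ.+ a))
        e′ = e (k ℕ.+ suc a)
        P-split : Q^ (k ℕ.* (k ℕ.+ suc a)) ≈ P * Q^ k
        P-split = trans (reflexive (≡.cong Q^ (durfee-exponent k a))) (Q^-+ (k ℕ.* (k ℕ.+ a)) k)
        e-split : e (k ℕ.+ a) ≈ e′ * (1# - Q^ k * Q^ (suc a))
        e-split = begin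
          e (k ℕ.+ a)                                              ≈⟨ e-pred (k ℕ.+ a) ⟩
          e (suc (k ℕ.+ a)) * (1# - Q^ (suc (k ℕ.+ a)))            ≡⟨ ≡.cong (λ n → e n * (1# - Q^ n)) (ℕₚ.+-suc k a) ⟨
          e′ * (1# - Q^ (k ℕ.+ suc a))                             ≈⟨ *-congˡ (+-congˡ (-‿cong (Q^-+ k (suc a)))) ⟩
          e′ * (1# - Q^ k * Q^ (suc a))                            ∎
        expand : ∀ p b q x y → p * (x * (y * (1# - b * q))) + q * (p * b * (x * y)) ≈ p * b * (x * y) + p * (x * y) * (1# - b)
        expand = solve 5 (λ p b q x y → p :* (x :* (y :* (:1 :- b :* q))) :+ q :* (p :* b :* (x :* y))
                                   := p :* b :* (x :* y) :+ p :* (x :* y) :* (:1 :- b)) refl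

      w-zero : ∀ a → w a 0 ≈ 0#
      w-zero a = *0-≈0 _ (-‿inverseʳ 1#)

      w-suc : ∀ a k → w a (suc k) ≈ Q^ (suc a) * t (suc (suc a)) k
      w-suc a k = begin
        Q^ (suc k ℕ.* (suc k ℕ.+ a)) * (e (suc k) * e (suc k ℕ.+ suc a)) * (1# - Q^ (suc k))
          ≈⟨ *-congʳ (*-cong P-split (*-congˡ (reflexive (≡.cong e (≡.sym (ℕₚ.+-suc k (suc a))))))) ⟩
        Q^ (suc a) * P * (e (suc k) * e′) * (1# - Q^ (suc k))
          ≈⟨ expand (Q^ (suc a)) P (e (suc k)) e′ (1# - Q^ (suc k)) ⟩
        Q^ (suc a) * (P * ((e (suc k) * (1# - Q^ (suc k))) * e′))
          ≈⟨ *-congˡ (*-congˡ (*-congʳ (e-pred k))) ⟨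
        Q^ (suc a) * t (suc (suc a)) k ∎
        where
        P e′ : Carrier
        P = Q^ (k ℕ.* (k ℕ.+ suc (suc a)))
        e′ = e (k ℕ.+ suc (suc a))
        P-split : Q^ (suc k ℕ.* (suc k ℕ.+ a)) ≈ Q^ (suc a) * P
        P-split = trans (reflexive (≡.cong Q^ (durfee-exponent-suc k a))) (Q^-+ (suc a) (k ℕ.* (k ℕ.+ suc (suc a))))
        expand : ∀ q p x y z → q * p * (x * y) * z ≈ q * (p * ((x * z) * y))
        expand = solve 5 (λ q p x y z → q :* p :* (x :* y) :* z := q :* (p :* ((x :* z) :* y))) refl

      n≤n*[n+a] : ∀ n a → n ℕ.≤ n ℕ.* (n ℕ.+ a)
      n≤n*[n+a] zero a = z≤n
      n≤n*[n+a] (suc n) a = ℕₚ.m≤m*n (suc n) (suc n ℕ.+ a)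

      U-step : ∀ a → U a + Q^ (suc a) * U (suc a) ≈ U (suc a) + Q^ (suc a) * U (suc (suc a))
      U-step a = begin
        U a + Q^ (suc a) * U (suc a)
          ≈⟨ +-congˡ (∑-*ˡ (suc M) (Q^ (suc a)) (t (suc a))) ⟨
        U a + ∑ (suc M) (λ k → Q^ (suc a) * t (suc a) k)
          ≈⟨ ∑-+ (suc M) (t a) (λ k → Q^ (suc a) * t (suc a) k) ⟨
        ∑ (suc M) (λ k → t a k + Q^ (suc a) * t (suc a) k)
          ≈⟨ ∑-cong (suc M) (λ k _ → t-step a k) ⟩
        ∑ (suc M) (λ k → t (suc a) k + w a k)
          ≈⟨ ∑-+ (suc M) (t (suc a)) (w a) ⟩
        U (suc a) + ∑ (suc M) (w a)
          ≈⟨ +-congˡ (∑-extend (w a) (ℕₚ.n≤1+n (suc M)) λ k M<k →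
               0*-≈0 _ (0*-≈0 _ (Q^-≈0 (ℕₚ.≤-trans (ℕₚ.<⇒≤ M<k) (n≤n*[n+a] k a))))) ⟩
        U (suc a) + (w a 0 + ∑ (suc M) (w a ∘ suc))
          ≈⟨ +-congˡ (+-cong (w-zero a) (∑-cong (suc M) (λ k _ → w-suc a k))) ⟩
        U (suc a) + (0# + ∑ (suc M) (λ k → Q^ (suc a) * t (suc (suc a)) k))
          ≈⟨ +-congˡ (trans (+-identityˡ _) (∑-*ˡ (suc M) (Q^ (suc a)) (t (suc (suc a))))) ⟩
        U (suc a) + Q^ (suc a) * U (suc (suc a)) ∎

      -- By U-step, U a - U (1 + a) is divisible by Q^(1 + a), and then by
      -- ever higher powers of Q.
      U-suc : ∀ d a → M ℕ.≤ d ℕ.+ a → U a ≈ U (suc a)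
      U-suc zero a M≤a = begin
        U a                                       ≈⟨ +-identityʳ _ ⟨
        U a + 0#                                  ≈⟨ +-congˡ (0*-≈0 _ Q≈0) ⟨
        U a + Q^ (suc a) * U (suc a)              ≈⟨ U-step a ⟩
        U (suc a) + Q^ (suc a) * U (suc (suc a))  ≈⟨ +-congˡ (0*-≈0 _ Q≈0) ⟩
        U (suc a) + 0#                            ≈⟨ +-identityʳ _ ⟩
        U (suc a)                                 ∎
        where
        Q≈0 : Q^ (suc a) ≈ 0#
        Q≈0 = Q^-≈0 (ℕₚ.m≤n⇒m≤1+n M≤a)
      U-suc (suc d) a M≤ = cancel (U a) (U (suc a)) (Q^ (suc a) * U (suc a))
        (trans (U-step a) (+-congˡ (*-congˡ (sym (U-suc d (suc a) (≡.subst (M ℕ.≤_) (≡.sym (ℕₚ.+-suc d a)) M≤))))))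
        where
        cancel : ∀ u v z → u + z ≈ v + z → u ≈ v
        cancel u v z p = begin
          u             ≈⟨ solve 2 (λ u z → u := (u :+ z) :- z) refl u z ⟩
          (u + z) - z   ≈⟨ +-congʳ p ⟩
          (v + z) - z   ≈⟨ solve 2 (λ u z → u := (u :+ z) :- z) refl v z ⟨
          v             ∎

      -- For k > 0 the exponent k(k + a) is at least a ≥ M, so only the entry k = 0 survives.
      U-≥M : ∀ a → M ℕ.≤ a → U a ≈ e M
      U-≥M a M≤a = begin
        t a 0 + ∑ M (t a ∘ suc)   ≈⟨ +-cong (trans (*-identityˡ _) (*-identityˡ _))
                                       (∑-≈0 M λ k _ → 0*-≈0 _ (Q^-≈0 (ℕₚ.≤-trans M≤a
                                          (ℕₚ.≤-trans (ℕₚ.m≤n+m a (suc k)) (ℕₚ.m≤m+n (suc k ℕ.+ a) _))))) ⟩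
        e a + 0#                  ≈⟨ +-identityʳ _ ⟩
        e a                       ≈⟨ e-stable M≤a ⟩
        e M                       ∎

      U-+ : ∀ d a → M ℕ.≤ d ℕ.+ a → U a ≈ e M
      U-+ zero a M≤ = U-≥M a M≤
      U-+ (suc d) a M≤ = trans (U-suc (suc d) a M≤) (U-+ d (suc a) (≡.subst (M ℕ.≤_) (≡.sym (ℕₚ.+-suc d a)) M≤))

    -- Partitions sorted by their largest k × (k + a) rectangle, in generating-function form. The
    -- proof is analytic: `U a` does not depend on a, and it is known for large a.
    durfee : ∀ a → U a ≈ e M
    durfee a = U-+ M a (ℕₚ.m≤m+n M a)

    -- Euler's product expansion and the Jacobi triple product

    eulerTerm : Carrier → ℕ → Carrier
    eulerTerm x m = x ^ m * (Q^ (triangular m) * e m)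

    eulerSum : Carrier → Carrier
    eulerSum x = ∑ (suc M) (eulerTerm x)

    private
      -- The functional equation of (-x;Q)_∞. Write 1 = Q^m + (1 - Q^m) in the m-th term: the first
      -- part replaces x by xQ, and in the second 1 - Q^m lowers `e m`, which gives x times the
      -- preceding term at xQ.
      eulerSum-step : ∀ x → eulerSum x ≈ (1# + x) * eulerSum (x * Q)
      eulerSum-step x = begin
        ∑ (suc M) (eulerTerm x)                       ≈⟨ ∑-cong (suc M) (λ m _ → split m) ⟩
        ∑ (suc M) (λ m → eulerTerm (x * Q) m + v m)   ≈⟨ ∑-+ (suc M) (eulerTerm (x * Q)) v ⟩
        f + (v 0 + ∑ M (v ∘ suc))                     ≈⟨ +-congˡ (+-cong (*0-≈0 _ (-‿inverseʳ 1#)) (∑-cong M (λ m _ → v-suc m))) ⟩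
        f + (0# + ∑ M (λ m → x * eulerTerm (x * Q) m))
          ≈⟨ +-congˡ (trans (+-identityˡ _) (∑-*ˡ M x (eulerTerm (x * Q)))) ⟩
        f + x * ∑ M (eulerTerm (x * Q))
          ≈⟨ +-congˡ (*-congˡ (∑-extend (eulerTerm (x * Q)) (ℕₚ.n≤1+n M) λ m M≤m →
               0*-≈0 _ (trans (^-distrib-* x Q m) (*0-≈0 _ (Q^-≈0 M≤m))))) ⟩
        f + x * f                                     ≈⟨ collect f x ⟩
        (1# + x) * f                                  ∎
        where
        f : Carrier
        f = eulerSum (x * Q)
        v : ℕ → Carrier
        v m = eulerTerm x m * (1# - Q^ m)
        collect : ∀ f x → f + x * f ≈ (1# + x) * f
        collect = solve 2 (λ f x → f :+ x :* f := (:1 :+ x) :* f) refl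
        ring₁ : ∀ a b c → a * c ≈ (a * b) * c + (a * c) * (1# - b)
        ring₁ = solve 3 (λ a b c → a :* c := (a :* b) :* c :+ (a :* c) :* (:1 :- b)) refl
        ring₂ : ∀ x a b c d z → ((x * a) * ((b * c) * d)) * z ≈ x * ((a * c) * (b * (d * z)))
        ring₂ = solve 6 (λ x a b c d z → ((x :* a) :* ((b :* c) :* d)) :* z := x :* ((a :* c) :* (b :* (d :* z)))) refl
        split : ∀ m → eulerTerm x m ≈ eulerTerm (x * Q) m + v m
        split m = trans (ring₁ (x ^ m) (Q^ m) (Q^ (triangular m) * e m))
                        (+-congʳ (*-congʳ (sym (^-distrib-* x Q m))))
        v-suc : ∀ m → v (suc m) ≈ x * eulerTerm (x * Q) m
        v-suc m = begin
          x ^ suc m * (Q^ (triangular (suc m)) * e (suc m)) * (1# - Q^ (suc m))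
            ≈⟨ *-congʳ (*-congˡ (*-congʳ (Q^-+ (triangular m) m))) ⟩
          (x * x ^ m) * ((Q^ (triangular m) * Q^ m) * e (suc m)) * (1# - Q^ (suc m))
            ≈⟨ ring₂ x (x ^ m) (Q^ (triangular m)) (Q^ m) (e (suc m)) (1# - Q^ (suc m)) ⟩
          x * ((x ^ m * Q^ m) * (Q^ (triangular m) * (e (suc m) * (1# - Q^ (suc m)))))
            ≈⟨ *-congˡ (*-cong (sym (^-distrib-* x Q m)) (*-congˡ (sym (e-pred m)))) ⟩
          x * eulerTerm (x * Q) m ∎

      eulerSum-cong : ∀ {x y} → x ≈ y → eulerSum x ≈ eulerSum y
      eulerSum-cong x≈y = ∑-cong (suc M) λ m _ → *-congʳ {Q^ (triangular m) * e m} (^-congˡ m x≈y)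

      eulerSum-iterate : ∀ n x → eulerSum x ≈ ∏ n (λ i → 1# + x * Q^ i) * eulerSum (x * Q^ n)
      eulerSum-iterate zero x = trans (eulerSum-cong (sym (*-identityʳ x))) (sym (*-identityˡ _))
      eulerSum-iterate (suc n) x = begin
        eulerSum x
          ≈⟨ eulerSum-step x ⟩
        (1# + x) * eulerSum (x * Q)
          ≈⟨ *-cong (+-congˡ (sym (*-identityʳ x))) (eulerSum-iterate n (x * Q)) ⟩
        (1# + x * Q^ 0) * (∏ n (λ i → 1# + x * Q * Q^ i) * eulerSum (x * Q * Q^ n))
          ≈⟨ *-congˡ (*-cong (∏-cong n (λ i _ → +-congˡ (*-assoc x Q (Q^ i)))) (eulerSum-cong (*-assoc x Q (Q^ n)))) ⟩
        (1# + x * Q^ 0) * (∏ n (λ i → 1# + x * Q^ (suc i)) * eulerSum (x * Q^ (suc n)))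
          ≈⟨ *-assoc _ _ _ ⟨
        ∏ (suc n) (λ i → 1# + x * Q^ i) * eulerSum (x * Q^ (suc n)) ∎

    euler : ∀ x → ∏ M (λ i → 1# + x * Q^ i) ≈ eulerSum x
    euler x = begin
      ∏ M (λ i → 1# + x * Q^ i)                             ≈⟨ *-identityʳ _ ⟨
      ∏ M (λ i → 1# + x * Q^ i) * 1#                        ≈⟨ *-congˡ eulerSum-0 ⟨
      ∏ M (λ i → 1# + x * Q^ i) * eulerSum (x * Q^ M)       ≈⟨ eulerSum-iterate M x ⟨
      eulerSum x                                            ∎
      where
      eulerSum-0 : eulerSum (x * Q^ M) ≈ 1#
      eulerSum-0 = begin
        eulerTerm (x * Q^ M) 0 + ∑ M (eulerTerm (x * Q^ M) ∘ suc)
          ≈⟨ +-cong (trans (*-identityˡ _) (*-identityˡ _))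
                    (∑-≈0 M λ m _ → 0*-≈0 _ (0*-≈0 _ (*0-≈0 x Q^M≈0))) ⟩
        1# + 0#   ≈⟨ +-identityʳ 1# ⟩
        1#        ∎

    -- With y = Q/x this is the bilateral sum of x^a Q^{a(a-1)/2}; the second half collects the
    -- indices -1, -2, and so on.
    theta : Carrier → Carrier → Carrier
    theta x y = ∑ (suc M) (λ a → x ^ a * Q^ (triangular a))
              + ∑ (suc M) (λ a → y ^ suc a * Q^ (triangular (suc a)))

    private
      eulerTerm-≈0 : ∀ x {m} → suc M ℕ.≤ m → eulerTerm x m ≈ 0#
      eulerTerm-≈0 x {suc m} (s≤s M≤m) = *0-≈0 _ (0*-≈0 _ (Q^-≈0 (ℕₚ.≤-trans M≤m (n≤triangular[1+n] m))))

      eulerTerm-diagonal : ∀ x y → x * y ≈ Q → ∀ a l → eulerTerm x (l ℕ.+ a) * eulerTerm y l ≈ (x ^ a * Q^ (triangular a)) * t a l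
      eulerTerm-diagonal x y xy≈Q a l = begin
        x ^ (l ℕ.+ a) * (Q^ (triangular (l ℕ.+ a)) * e (l ℕ.+ a)) * (y ^ l * (Q^ (triangular l) * e l))
          ≈⟨ *-congʳ (*-congʳ (^-homo-* x l a)) ⟩
        (x ^ l * x ^ a) * (Q^ (triangular (l ℕ.+ a)) * e (l ℕ.+ a)) * (y ^ l * (Q^ (triangular l) * e l))
          ≈⟨ ring₁ (x ^ l) (x ^ a) (Q^ (triangular (l ℕ.+ a))) (e (l ℕ.+ a)) (y ^ l) (Q^ (triangular l)) (e l) ⟩
        x ^ a * ((Q^ (triangular (l ℕ.+ a)) * Q^ (triangular l)) * (x ^ l * y ^ l)) * (e l * e (l ℕ.+ a))
          ≈⟨ *-congʳ (*-congˡ powers) ⟩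
        x ^ a * (Q^ (l ℕ.* (l ℕ.+ a)) * Q^ (triangular a)) * (e l * e (l ℕ.+ a))
          ≈⟨ ring₂ (x ^ a) (Q^ (l ℕ.* (l ℕ.+ a))) (Q^ (triangular a)) (e l * e (l ℕ.+ a)) ⟩
        (x ^ a * Q^ (triangular a)) * t a l ∎
        where
        ring₁ : ∀ a b c d f g h → (a * b) * (c * d) * (f * (g * h)) ≈ b * ((c * g) * (a * f)) * (h * d)
        ring₁ = solve 7 (λ a b c d f g h → (a :* b) :* (c :* d) :* (f :* (g :* h)) := b :* ((c :* g) :* (a :* f)) :* (h :* d)) refl
        ring₂ : ∀ a b c d → a * (b * c) * d ≈ (a * c) * (b * d)
        ring₂ = solve 4 (λ a b c d → a :* (b :* c) :* d := (a :* c) :* (b :* d)) refl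
        T T′ : ℕ
        T = triangular (l ℕ.+ a)
        T′ = triangular l
        powers : (Q^ T * Q^ T′) * (x ^ l * y ^ l) ≈ Q^ (l ℕ.* (l ℕ.+ a)) * Q^ (triangular a)
        powers = begin
          (Q^ T * Q^ T′) * (x ^ l * y ^ l)              ≈⟨ *-cong (Q^-+ T T′) (^-distrib-* x y l) ⟨
          Q^ (T ℕ.+ T′) * (x * y) ^ l                   ≈⟨ *-congˡ (^-congˡ l xy≈Q) ⟩
          Q^ (T ℕ.+ T′) * Q^ l                          ≈⟨ Q^-+ (T ℕ.+ T′) l ⟨
          Q^ ((T ℕ.+ T′) ℕ.+ l)                         ≡⟨ ≡.cong Q^ (triangular-l+a l a) ⟩
          Q^ (l ℕ.* (l ℕ.+ a) ℕ.+ triangular a)         ≈⟨ Q^-+ (l ℕ.* (l ℕ.+ a)) (triangular a) ⟩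
          Q^ (l ℕ.* (l ℕ.+ a)) * Q^ (triangular a)      ∎

      diagonal-sum : ∀ x y → x * y ≈ Q → ∀ a →
        ∑ (suc M) (λ l → eulerTerm x (l ℕ.+ a) * eulerTerm y l) ≈ e M * (x ^ a * Q^ (triangular a))
      diagonal-sum x y xy≈Q a = begin
        ∑ (suc M) (λ l → eulerTerm x (l ℕ.+ a) * eulerTerm y l)   ≈⟨ ∑-cong (suc M) (λ l _ → eulerTerm-diagonal x y xy≈Q a l) ⟩
        ∑ (suc M) (λ l → (x ^ a * Q^ (triangular a)) * t a l)     ≈⟨ ∑-*ˡ (suc M) (x ^ a * Q^ (triangular a)) (t a) ⟩
        (x ^ a * Q^ (triangular a)) * U a                         ≈⟨ *-congˡ (durfee a) ⟩
        (x ^ a * Q^ (triangular a)) * e M                         ≈⟨ *-comm _ _ ⟩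
        e M * (x ^ a * Q^ (triangular a))                         ∎

    -- Multiply the two Euler sums and collect the pairs of indices with a fixed difference a.
    -- Because xy = Q, such a diagonal is its theta term times the Durfee sum `U a`, and the latter
    -- is the same for all a.
    jacobi-triple-product : ∀ x y → x * y ≈ Q →
      ∏ M (λ i → 1# + x * Q^ i) * ∏ M (λ i → 1# + y * Q^ i) ≈ e M * theta x y
    jacobi-triple-product x y xy≈Q = begin
      ∏ M (λ i → 1# + x * Q^ i) * ∏ M (λ i → 1# + y * Q^ i)
        ≈⟨ *-cong (euler x) (euler y) ⟩
      eulerSum x * eulerSum y
        ≈⟨ *-comm _ _ ⟩
      eulerSum y * eulerSum x
        ≈⟨ ∑-*ˡ (suc M) (eulerSum y) (eulerTerm x) ⟨
      ∑ (suc M) (λ m → eulerSum y * eulerTerm x m)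
        ≈⟨ ∑-cong (suc M) (λ m _ → trans (*-comm _ _) (sym (∑-*ˡ (suc M) (eulerTerm x m) (eulerTerm y)))) ⟩
      ∑ (suc M) (λ m → ∑ (suc M) (λ l → eulerTerm x m * eulerTerm y l))
        ≈⟨ square≈diagonals (λ m l → eulerTerm x m * eulerTerm y l) ℕₚ.≤-refl vanish ⟩
      ∑ (suc M) (λ a → ∑ (suc M) (λ l → eulerTerm x (l ℕ.+ a) * eulerTerm y l))
        + ∑ (suc M) (λ a → ∑ (suc M) (λ l → eulerTerm x l * eulerTerm y (l ℕ.+ suc a)))
        ≈⟨ +-cong (∑-cong (suc M) λ a _ → diagonal-sum x y xy≈Q a)
                  (∑-cong (suc M) λ a _ → trans
                    (∑-cong (suc M) λ l _ → *-comm (eulerTerm x l) (eulerTerm y (l ℕ.+ suc a)))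
                    (diagonal-sum y x (trans (*-comm y x) xy≈Q) (suc a))) ⟩
      ∑ (suc M) (λ a → e M * (x ^ a * Q^ (triangular a)))
        + ∑ (suc M) (λ a → e M * (y ^ suc a * Q^ (triangular (suc a))))
        ≈⟨ +-cong (∑-*ˡ (suc M) (e M) (λ a → x ^ a * Q^ (triangular a)))
                  (∑-*ˡ (suc M) (e M) (λ a → y ^ suc a * Q^ (triangular (suc a)))) ⟩
      e M * ∑ (suc M) (λ a → x ^ a * Q^ (triangular a))
        + e M * ∑ (suc M) (λ a → y ^ suc a * Q^ (triangular (suc a)))
        ≈⟨ distribˡ (e M) _ _ ⟨
      e M * theta x y ∎
      where
      vanish : ∀ m l → suc M ℕ.≤ m ⊎ suc M ℕ.≤ l → eulerTerm x m * eulerTerm y l ≈ 0#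
      vanish m l (inj₁ le) = 0*-≈0 _ (eulerTerm-≈0 x le)
      vanish m l (inj₂ le) = *0-≈0 _ (eulerTerm-≈0 y le)

    -- Partial fractions and their two consequences

    sign : ℕ → Carrier
    sign zero = 1#
    sign (suc r) = - sign r

    -- The part of the r-th partial-fraction coefficient that depends neither on n nor on x and y.
    α : ℕ → Carrier
    α r = sign r * (Q^ (triangular (suc r)) * (1# - Q^ (suc (r ℕ.+ r))))

    private
      telescope : ∀ n (F S : ℕ → ℕ → Carrier) →
        (∀ r k → r ℕ.+ suc k ≡ n → F r (suc k) + S r (suc k) ≈ S (suc r) k) →
        F n 0 + S n 0 ≈ 0# → ∑∑ n F + S 0 n ≈ 0#
      telescope zero F S step last = last
      telescope (suc n) F S step last = begin
        (F 0 (suc n) + ∑∑ n (F ∘ suc)) + S 0 (suc n)    ≈⟨ rotate _ _ _ ⟩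
        ∑∑ n (F ∘ suc) + (F 0 (suc n) + S 0 (suc n))    ≈⟨ +-congˡ (step 0 n ≡.refl) ⟩
        ∑∑ n (F ∘ suc) + S 1 n
          ≈⟨ telescope n (F ∘ suc) (S ∘ suc) (λ r k eq → step (suc r) k (≡.cong suc eq)) last ⟩
        0#                                              ∎
        where
        rotate : ∀ a b c → (a + b) + c ≈ b + (a + c)
        rotate = solve 3 (λ a b c → (a :+ b) :+ c := b :+ (a :+ c)) refl

      Q^-double : ∀ r → Q^ (suc (r ℕ.+ r)) ≈ Q * (Q^ r * Q^ r)
      Q^-double r = *-congˡ (Q^-+ r r)

      -- What is left of the term Q^k D_r in `D-split` once D_r has cancelled I_r; it no longer
      -- involves x and y.
      F : ℕ → ℕ → Carrier
      F r k = α r * (e k * e (k ℕ.+ suc (r ℕ.+ r))) * Q^ k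

      -- A telescoping certificate: on the antidiagonal r + k = n, `S r k` is the closed form of the
      -- sum of (1 - Q^n) F_{i,n-i} over i < r. It vanishes at r = 0 through the factor 1 - Q^r.
      S : ℕ → ℕ → Carrier
      S r k = - (sign r * (Q^ (triangular (suc r)) * Q^ k) * ((1# - Q^ r) * (e k * e (k ℕ.+ (r ℕ.+ r)))))

      Q^-k+1+2r : ∀ k r → Q^ (k ℕ.+ suc (r ℕ.+ r)) ≈ Q^ k * (Q * (Q^ r * Q^ r))
      Q^-k+1+2r k r = trans (Q^-+ k (suc (r ℕ.+ r))) (*-congˡ (Q^-double r))

      e-k+2r : ∀ k r → e (k ℕ.+ (r ℕ.+ r)) ≈ e (k ℕ.+ suc (r ℕ.+ r)) * (1# - Q^ k * (Q * (Q^ r * Q^ r)))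
      e-k+2r k r = begin
        e (k ℕ.+ (r ℕ.+ r))
          ≈⟨ e-pred (k ℕ.+ (r ℕ.+ r)) ⟩
        e (suc (k ℕ.+ (r ℕ.+ r))) * (1# - Q^ (suc (k ℕ.+ (r ℕ.+ r))))
          ≡⟨ ≡.cong (λ n → e n * (1# - Q^ n)) (ℕₚ.+-suc k (r ℕ.+ r)) ⟨
        e (k ℕ.+ suc (r ℕ.+ r)) * (1# - Q^ (k ℕ.+ suc (r ℕ.+ r)))
          ≈⟨ *-congˡ (+-congˡ (-‿cong (Q^-k+1+2r k r))) ⟩
        e (k ℕ.+ suc (r ℕ.+ r)) * (1# - Q^ k * (Q * (Q^ r * Q^ r))) ∎

      α-factored : ∀ r → α r ≈ sign r * (Q^ (triangular (suc r)) * (1# - Q * (Q^ r * Q^ r)))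
      α-factored r = *-congˡ (*-congˡ (+-congˡ (-‿cong (Q^-double r))))

      S-factored : ∀ r k → S r k ≈ - (sign r * (Q^ (triangular (suc r)) * Q^ k) *
        ((1# - Q^ r) * (e k * (e (k ℕ.+ suc (r ℕ.+ r)) * (1# - Q^ k * (Q * (Q^ r * Q^ r)))))))
      S-factored r k = -‿cong (*-congˡ (*-congˡ (*-congˡ (e-k+2r k r))))

      S-suc : ∀ r k → S (suc r) k ≈ sign r * ((Q^ (triangular (suc r)) * (Q * Q^ r)) * Q^ k) *
        ((1# - Q * Q^ r) * ((e (suc k) * (1# - Q * Q^ k)) * e (suc k ℕ.+ suc (r ℕ.+ r))))
      S-suc r k = begin
        - (- sign r * (Q^ (triangular (suc r) ℕ.+ suc r) * Q^ k) * ((1# - Q * Q^ r) * (e k * e (k ℕ.+ (suc r ℕ.+ suc r)))))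
          ≈⟨ neg (sign r) _ _ ⟩
        sign r * (Q^ (triangular (suc r) ℕ.+ suc r) * Q^ k) * ((1# - Q * Q^ r) * (e k * e (k ℕ.+ (suc r ℕ.+ suc r))))
          ≈⟨ *-cong (*-congˡ (*-congʳ (Q^-+ (triangular (suc r)) (suc r))))
                    (*-congˡ (*-cong (e-pred k) (reflexive (≡.cong e index)))) ⟩
        sign r * ((Q^ (triangular (suc r)) * (Q * Q^ r)) * Q^ k) *
          ((1# - Q * Q^ r) * ((e (suc k) * (1# - Q * Q^ k)) * e (suc k ℕ.+ suc (r ℕ.+ r)))) ∎
        where
        neg : ∀ s a b → - (- s * a * b) ≈ s * a * b
        neg = solve 3 (λ s a b → :- (:- s :* a :* b) := s :* a :* b) refl
        index : k ℕ.+ (suc r ℕ.+ suc r) ≡ suc k ℕ.+ suc (r ℕ.+ r)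
        index = ≡.trans (ℕₚ.+-suc k (r ℕ.+ suc r)) (≡.cong (λ m → suc (k ℕ.+ m)) (ℕₚ.+-suc r r))

      F-step : ∀ r k → (1# - Q^ (r ℕ.+ suc k)) * F r (suc k) + S r (suc k) ≈ S (suc r) k
      F-step r k = begin
        (1# - Q^ (r ℕ.+ suc k)) * F r (suc k) + S r (suc k)
          ≈⟨ +-cong (*-cong (+-congˡ (-‿cong (Q^-+ r (suc k)))) (*-congʳ (*-congʳ (α-factored r)))) (S-factored r (suc k)) ⟩
        (1# - a * (Q * b)) * ((s * (P * (1# - Q * (a * a)))) * (x * y) * (Q * b))
          - s * (P * (Q * b)) * ((1# - a) * (x * (y * (1# - Q * b * (Q * (a * a))))))
          ≈⟨ expand a Q b s P x y ⟩
        s * ((P * (Q * a)) * b) * ((1# - Q * a) * ((x * (1# - Q * b)) * y))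
          ≈⟨ S-suc r k ⟨
        S (suc r) k ∎
        where
        a b s P x y : Carrier
        a = Q^ r
        b = Q^ k
        s = sign r
        P = Q^ (triangular (suc r))
        x = e (suc k)
        y = e (suc k ℕ.+ suc (r ℕ.+ r))
        -- The only genuine identity in this step; `outer₁` and `outer₂` merely split off the common
        -- monomial.
        core : ∀ a q b → (1# - a * (q * b)) * (1# - q * (a * a)) - (1# - a) * (1# - q * b * (q * (a * a))) ≈ a * (1# - q * a) * (1# - q * b)
        core = solve 3 (λ a q b → (:1 :- a :* (q :* b)) :* (:1 :- q :* (a :* a)) :- (:1 :- a) :* (:1 :- q :* b :* (q :* (a :* a)))
                               := a :* (:1 :- q :* a) :* (:1 :- q :* b)) refl
        outer₁ : ∀ b q s P x y u v w z → u * ((s * (P * v)) * (x * y) * (q * b)) - s * (P * (q * b)) * (w * (x * (y * z)))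
          ≈ (s * P * q * b * x * y) * (u * v - w * z)
        outer₁ = solve 10 (λ b q s P x y u v w z →
          u :* ((s :* (P :* v)) :* (x :* y) :* (q :* b)) :- s :* (P :* (q :* b)) :* (w :* (x :* (y :* z)))
          := (s :* P :* q :* b :* x :* y) :* (u :* v :- w :* z)) refl
        outer₂ : ∀ a b q s P x y u v → s * ((P * (q * a)) * b) * (u * ((x * v) * y)) ≈ (s * P * q * b * x * y) * (a * u * v)
        outer₂ = solve 9 (λ a b q s P x y u v →
          s :* ((P :* (q :* a)) :* b) :* (u :* ((x :* v) :* y)) := (s :* P :* q :* b :* x :* y) :* (a :* u :* v)) refl
        expand : ∀ a q b s P x y →
          (1# - a * (q * b)) * ((s * (P * (1# - q * (a * a)))) * (x * y) * (q * b))
            - s * (P * (q * b)) * ((1# - a) * (x * (y * (1# - q * b * (q * (a * a))))))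
          ≈ s * ((P * (q * a)) * b) * ((1# - q * a) * ((x * (1# - q * b)) * y))
        expand a q b s P x y = trans
          (outer₁ b q s P x y (1# - a * (q * b)) (1# - q * (a * a)) (1# - a) (1# - q * b * (q * (a * a))))
          (trans (*-congˡ (core a q b)) (sym (outer₂ a b q s P x y (1# - q * a) (1# - q * b))))

      F-last : ∀ n → (1# - Q^ n) * F n 0 + S n 0 ≈ 0#
      F-last n = trans (+-cong (*-congˡ (*-congʳ (*-congʳ (α-factored n)))) (S-factored n 0))
        (cancel (Q^ n) (Q * (Q^ n * Q^ n)) (sign n) (Q^ (triangular (suc n))) (e (suc (n ℕ.+ n))))
        where
        cancel : ∀ a z s P y → (1# - a) * ((s * (P * (1# - z))) * (1# * y) * 1#)
          - s * (P * 1#) * ((1# - a) * (1# * (y * (1# - 1# * z)))) ≈ 0#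
        cancel = solve 5 (λ a z s P y → (:1 :- a) :* ((s :* (P :* (:1 :- z))) :* (:1 :* y) :* :1)
          :- s :* (P :* :1) :* ((:1 :- a) :* (:1 :* (y :* (:1 :- :1 :* z)))) := :0) refl

      -- The certificate `S` sums F only after multiplication by 1 - Q^{n+1}, which is a unit and is
      -- cancelled at the end. The index starts at 1 because on the antidiagonal 0 the value is 1.
      ∑∑F≈0 : ∀ n → ∑∑ (suc n) F ≈ 0#
      ∑∑F≈0 n = unit-cancel (h-inverse n) (begin
        (1# - Q^ (suc n)) * ∑∑ (suc n) F
          ≈⟨ ∑∑-*ˡ (suc n) (1# - Q^ (suc n)) F ⟨
        ∑∑ (suc n) (λ r k → (1# - Q^ (suc n)) * F r k)
          ≈⟨ +-identityʳ _ ⟨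
        ∑∑ (suc n) (λ r k → (1# - Q^ (suc n)) * F r k) + 0#
          ≈⟨ +-congˡ S-start ⟨
        ∑∑ (suc n) (λ r k → (1# - Q^ (suc n)) * F r k) + S 0 (suc n)
          ≈⟨ telescope (suc n) (λ r k → (1# - Q^ (suc n)) * F r k) S
               (λ r k eq → trans (+-congʳ (*-congʳ (reflexive (≡.cong (λ m → 1# - Q^ m) (≡.sym eq))))) (F-step r k)) (F-last (suc n)) ⟩
        0#
          ≈⟨ zeroʳ (1# - Q^ (suc n)) ⟨
        (1# - Q^ (suc n)) * 0# ∎)
        where
        S-start : S 0 (suc n) ≈ 0#
        S-start = trans (-‿cong (*0-≈0 _ (0*-≈0 _ (-‿inverseʳ 1#)))) -0#≈0#

    module PartialFractions (x y : Carrier) (xy≈Q : x * y ≈ Q) (I : ℕ → Carrier)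
      (I-inverse : ∀ r → ((1# - x * Q^ r) * (1# - y * Q^ r)) * I r ≈ 1#) where

      private
        D : ℕ → Carrier
        D r = (1# - x * Q^ r) * (1# - y * Q^ r)

        T : ℕ → ℕ → Carrier
        T r k = (α r * I r) * (e k * e (k ℕ.+ suc (r ℕ.+ r)))

        Z : ℕ → ℕ → Carrier
        Z r k = (α r * I r) * ((e k * (1# - Q^ k)) * (e (k ℕ.+ suc (r ℕ.+ r)) * (1# - Q^ (k ℕ.+ suc (r ℕ.+ r)))))

        -- Both sides are quadratic in Q^k and agree once the product xy Q^{2r} is read as Q^{2r+1};
        -- this is where xy = Q enters the partial fractions.
        D-split : ∀ r k → D (r ℕ.+ k) ≈ Q^ k * D r + (1# - Q^ k) * (1# - Q^ (k ℕ.+ suc (r ℕ.+ r)))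
        D-split r k = begin
          (1# - x * Q^ (r ℕ.+ k)) * (1# - y * Q^ (r ℕ.+ k))
            ≈⟨ *-cong (+-congˡ (-‿cong (*-congˡ (Q^-+ r k)))) (+-congˡ (-‿cong (*-congˡ (Q^-+ r k)))) ⟩
          (1# - x * (Q^ r * Q^ k)) * (1# - y * (Q^ r * Q^ k))
            ≈⟨ expand x y (Q^ r) (Q^ k) ⟩
          Q^ k * D r + (1# - Q^ k) * (1# - Q^ k * ((x * y) * (Q^ r * Q^ r)))
            ≈⟨ +-congˡ (*-congˡ (+-congˡ (-‿cong (trans (*-congˡ (*-congʳ xy≈Q)) (sym (Q^-k+1+2r k r)))))) ⟩
          Q^ k * D r + (1# - Q^ k) * (1# - Q^ (k ℕ.+ suc (r ℕ.+ r))) ∎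
          where
          expand : ∀ x y a b → (1# - x * (a * b)) * (1# - y * (a * b))
            ≈ b * ((1# - x * a) * (1# - y * a)) + (1# - b) * (1# - b * ((x * y) * (a * a)))
          expand = solve 4 (λ x y a b → (:1 :- x :* (a :* b)) :* (:1 :- y :* (a :* b))
            := b :* ((:1 :- x :* a) :* (:1 :- y :* a)) :+ (:1 :- b) :* (:1 :- b :* ((x :* y) :* (a :* a)))) refl

        D*T : ∀ r k → D (r ℕ.+ k) * T r k ≈ F r k + Z r k
        D*T r k = begin
          D (r ℕ.+ k) * T r k
            ≈⟨ *-congʳ (D-split r k) ⟩
          (Q^ k * D r + (1# - Q^ k) * (1# - Q^ (k ℕ.+ suc (r ℕ.+ r)))) * T r k
            ≈⟨ expand (Q^ k) (D r) (1# - Q^ k) (1# - Q^ (k ℕ.+ suc (r ℕ.+ r))) (α r) (I r) (e k) (e (k ℕ.+ suc (r ℕ.+ r))) ⟩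
          (D r * I r) * F r k + Z r k
            ≈⟨ +-congʳ (trans (*-congʳ (I-inverse r)) (*-identityˡ _)) ⟩
          F r k + Z r k ∎
          where
          expand : ∀ b d u v a i x y → (b * d + u * v) * ((a * i) * (x * y)) ≈ (d * i) * (a * (x * y) * b) + (a * i) * ((x * u) * (y * v))
          expand = solve 8 (λ b d u v a i x y → (b :* d :+ u :* v) :* ((a :* i) :* (x :* y))
            := (d :* i) :* (a :* (x :* y) :* b) :+ (a :* i) :* ((x :* u) :* (y :* v))) refl

        Z-suc : ∀ r k → Z r (suc k) ≈ T r k
        Z-suc r k = *-congˡ (*-cong (sym (e-pred k)) (sym (e-pred (k ℕ.+ suc (r ℕ.+ r)))))

        Z-zero : ∀ r → Z r 0 ≈ 0#
        Z-zero r = *0-≈0 _ (0*-≈0 _ (*0-≈0 _ (-‿inverseʳ 1#)))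

      -- Multiply level n + 1 by `D (suc n)`. By `D-split` every entry becomes an F, and these sum
      -- to 0, plus a Z, whose two extra factors shorten both denominators and so give the entry of
      -- level n. In the usual notation the denominators are (Q;Q)_{n-r} (Q;Q)_{n+r+1}.
      partial-fractions : ∀ n → ∏ (suc n) I ≈ ∑∑ n T
      partial-fractions zero = begin
        I 0 * 1#                                     ≈⟨ *-congˡ (trans (*-identityʳ _) (h-inverse 0)) ⟨
        I 0 * ((1# - Q^ 1) * h 0 * 1#)               ≈⟨ expand (I 0) (1# - Q^ 1) (h 0) ⟩
        ((1# * (1# * (1# - Q^ 1))) * I 0) * (1# * (h 0 * 1#)) ∎
        where
        expand : ∀ i d h → i * (d * h * 1#) ≈ ((1# * (1# * d)) * i) * (1# * (h * 1#))
        expand = solve 3 (λ i d h → i :* (d :* h :* :1) := ((:1 :* (:1 :* d)) :* i) :* (:1 :* (h :* :1))) refl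
      partial-fractions (suc n) = unit-cancel (I-inverse (suc n)) (begin
        D (suc n) * ∏ (suc (suc n)) I           ≈⟨ *-congˡ (∏-snoc (suc n) I) ⟩
        D (suc n) * (∏ (suc n) I * I (suc n))   ≈⟨ *-xyz≈xzy (D (suc n)) (∏ (suc n) I) (I (suc n)) ⟩
        (D (suc n) * I (suc n)) * ∏ (suc n) I   ≈⟨ trans (*-congʳ (I-inverse (suc n))) (*-identityˡ _) ⟩
        ∏ (suc n) I                             ≈⟨ partial-fractions n ⟩
        ∑∑ n T                                  ≈⟨ ∑∑-cong n (λ r k _ → sym (Z-suc r k)) ⟩
        ∑∑ n (λ r k → Z r (suc k))              ≈⟨ trans (+-congˡ (Z-zero (suc n))) (+-identityʳ _) ⟨
        ∑∑ n (λ r k → Z r (suc k)) + Z (suc n) 0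
                                                ≈⟨ ∑∑-snoc n Z ⟨
        ∑∑ (suc n) Z                            ≈⟨ trans (+-congʳ (∑∑F≈0 n)) (+-identityˡ _) ⟨
        ∑∑ (suc n) F + ∑∑ (suc n) Z             ≈⟨ ∑∑-+ (suc n) F Z ⟨
        ∑∑ (suc n) (λ r k → F r k + Z r k)      ≈⟨ ∑∑-cong (suc n) (λ r k eq →
                                                     trans (*-congʳ (reflexive (≡.cong D (≡.sym eq)))) (D*T r k)) ⟨
        ∑∑ (suc n) (λ r k → D (suc n) * T r k)  ≈⟨ ∑∑-*ˡ (suc n) (D (suc n)) T ⟩
        D (suc n) * ∑∑ (suc n) T                ∎)

      private
        α-≈0 : ∀ r → M ℕ.≤ r → α r ≈ 0#
        α-≈0 r M≤r = *0-≈0 _ (0*-≈0 _ (Q^-≈0 (ℕₚ.≤-trans M≤r (n≤triangular[1+n] r))))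

      -- The limit n → ∞. On the antidiagonal n ≥ 2M every entry has k ≥ M, where both denominators
      -- are stable, or r ≥ M, where `α r` is 0.
      product≈appell : ∀ n → M ℕ.+ M ℕ.≤ n → ∏ (suc n) I ≈ e M * e M * ∑ (suc M) (λ r → α r * I r)
      product≈appell n 2M≤n = begin
        ∏ (suc n) I                                          ≈⟨ partial-fractions n ⟩
        ∑∑ n T                                               ≈⟨ ∑∑-≈∑ n (λ r → e M * e M * (α r * I r)) limit ⟩
        ∑ (suc n) (λ r → e M * e M * (α r * I r))            ≈⟨ ∑-extend (λ r → e M * e M * (α r * I r))
                                                                  (s≤s (ℕₚ.≤-trans (ℕₚ.m≤m+n M M) 2M≤n))
                                                                  (λ r M<r → *0-≈0 _ (0*-≈0 _ (α-≈0 r (ℕₚ.<⇒≤ M<r)))) ⟨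
        ∑ (suc M) (λ r → e M * e M * (α r * I r))            ≈⟨ ∑-*ˡ (suc M) (e M * e M) (λ r → α r * I r) ⟩
        e M * e M * ∑ (suc M) (λ r → α r * I r)              ∎
        where
        limit : ∀ r k → r ℕ.+ k ≡ n → T r k ≈ e M * e M * (α r * I r)
        limit r k eq with ℕₚ.≤-total M k
        ... | inj₁ M≤k = trans
          (*-congˡ (*-cong (e-stable M≤k) (e-stable (ℕₚ.≤-trans M≤k (ℕₚ.m≤m+n k (suc (r ℕ.+ r)))))))
          (*-comm _ _)
        ... | inj₂ k≤M = trans (0*-≈0 _ (0*-≈0 _ (α-≈0 r M≤r))) (sym (*0-≈0 _ (0*-≈0 _ (α-≈0 r M≤r))))
          where
          M≤r : M ℕ.≤ r
          M≤r = ℕₚ.+-cancelʳ-≤ M M r (ℕₚ.≤-trans (≡.subst (M ℕ.+ M ℕ.≤_) (≡.sym eq) 2M≤n) (ℕₚ.+-monoʳ-≤ r k≤M))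

      -- Insert the partial fractions and exchange the sums. By `pronic-+` the sum over k is the
      -- Durfee sum with a = 2r + 1, which contributes the same 1/(Q;Q)_∞ for all r and uses up one
      -- of the two denominators.
      rogers-fine : ∑ (suc M) (λ n → Q^ (n ℕ.* suc n) * ∏ (suc n) I)
                  ≈ e M * ∑ (suc M) (λ r → Q^ (r ℕ.* suc r) * (α r * I r))
      rogers-fine = begin
        ∑ (suc M) (λ n → Q^ (n ℕ.* suc n) * ∏ (suc n) I)
          ≈⟨ ∑-cong (suc M) (λ n _ → trans (*-congˡ (partial-fractions n)) (expand-term n)) ⟩
        ∑ (suc M) (λ n → ∑∑ n G)
          ≈⟨ triangle≈rectangle G ℕₚ.≤-refl (λ r k M<r+k →
               0*-≈0 _ (Q^-≈0 (ℕₚ.≤-trans (ℕₚ.<⇒≤ M<r+k) (ℕₚ.m≤m*n (r ℕ.+ k) (suc (r ℕ.+ k)))))) ⟩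
        ∑ (suc M) (λ r → ∑ (suc M) (G r))
          ≈⟨ ∑-cong (suc M) (λ r _ → row r) ⟩
        ∑ (suc M) (λ r → e M * (Q^ (r ℕ.* suc r) * (α r * I r)))
          ≈⟨ ∑-*ˡ (suc M) (e M) (λ r → Q^ (r ℕ.* suc r) * (α r * I r)) ⟩
        e M * ∑ (suc M) (λ r → Q^ (r ℕ.* suc r) * (α r * I r)) ∎
        where
        G : ℕ → ℕ → Carrier
        G r k = Q^ ((r ℕ.+ k) ℕ.* suc (r ℕ.+ k)) * T r k
        expand-term : ∀ n → Q^ (n ℕ.* suc n) * ∑∑ n T ≈ ∑∑ n G
        expand-term n = trans (sym (∑∑-*ˡ n (Q^ (n ℕ.* suc n)) T))
          (∑∑-cong n (λ { r k ≡.refl → refl }))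
        G-split : ∀ r k → G r k ≈ (Q^ (r ℕ.* suc r) * (α r * I r)) * t (suc (r ℕ.+ r)) k
        G-split r k = trans
          (*-congʳ (trans (reflexive (≡.cong Q^ (pronic-+ r k))) (Q^-+ (r ℕ.* suc r) (k ℕ.* (k ℕ.+ suc (r ℕ.+ r))))))
          (*-interchange (Q^ (r ℕ.* suc r)) (Q^ (k ℕ.* (k ℕ.+ suc (r ℕ.+ r)))) (α r * I r) (e k * e (k ℕ.+ suc (r ℕ.+ r))))
        row : ∀ r → ∑ (suc M) (G r) ≈ e M * (Q^ (r ℕ.* suc r) * (α r * I r))
        row r = begin
          ∑ (suc M) (G r)
            ≈⟨ ∑-cong (suc M) (λ k _ → G-split r k) ⟩
          ∑ (suc M) (λ k → (Q^ (r ℕ.* suc r) * (α r * I r)) * t (suc (r ℕ.+ r)) k)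
            ≈⟨ ∑-*ˡ (suc M) (Q^ (r ℕ.* suc r) * (α r * I r)) (t (suc (r ℕ.+ r))) ⟩
          (Q^ (r ℕ.* suc r) * (α r * I r)) * U (suc (r ℕ.+ r))
            ≈⟨ trans (*-congˡ (durfee (suc (r ℕ.+ r)))) (*-comm _ _) ⟩
          e M * (Q^ (r ℕ.* suc r) * (α r * I r)) ∎

open import Data.Nat using (NonZero; _+_; _*_; _∸_; _%_; _/_; _≤_; _<_)

-- Power series, dilations and arithmetic progressions of coefficients

infix 4 _≐_
_≐_ : Series → Series → Set
f ≐ g = ∀ m → f m ≡ g m

infixl 6 _⊕_
_⊕_ : Series → Series → Series
(f ⊕ g) m = f m + g m

0ˢ : Series
0ˢ m = 0

module _ where
  open ≡-Reasoning

  sumBelow-cong : ∀ n {f g} → (∀ i → i < n → f i ≡ g i) → sumBelow n f ≡ sumBelow n g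
  sumBelow-cong zero p = ≡.refl
  sumBelow-cong (suc n) p = ≡.cong₂ _+_ (sumBelow-cong n λ i i<n → p i (ℕₚ.m<n⇒m<1+n i<n)) (p n ℕₚ.≤-refl)

  sumBelow-suc : ∀ n f → sumBelow (suc n) f ≡ f 0 + sumBelow n (f ∘ suc)
  sumBelow-suc zero f = ℕₚ.+-comm 0 (f 0)
  sumBelow-suc (suc n) f = ≡.trans (≡.cong (_+ f (suc n)) (sumBelow-suc n f)) (ℕₚ.+-assoc (f 0) _ _)

  sumBelow-+ : ∀ a b f → sumBelow (a + b) f ≡ sumBelow a f + sumBelow b (f ∘ (a +_))
  sumBelow-+ a zero f = ≡.trans (≡.cong (λ n → sumBelow n f) (ℕₚ.+-identityʳ a)) (≡.sym (ℕₚ.+-identityʳ _))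
  sumBelow-+ a (suc b) f = begin
    sumBelow (a + suc b) f                                      ≡⟨ ≡.cong (λ n → sumBelow n f) (ℕₚ.+-suc a b) ⟩
    sumBelow (a + b) f + f (a + b)                              ≡⟨ ≡.cong (_+ f (a + b)) (sumBelow-+ a b f) ⟩
    sumBelow a f + sumBelow b (f ∘ (a +_)) + f (a + b)          ≡⟨ ℕₚ.+-assoc (sumBelow a f) _ _ ⟩
    sumBelow a f + sumBelow (suc b) (f ∘ (a +_))                ∎

  sumBelow-0 : ∀ n {f} → (∀ i → i < n → f i ≡ 0) → sumBelow n f ≡ 0
  sumBelow-0 zero p = ≡.refl
  sumBelow-0 (suc n) p = ≡.cong₂ _+_ (sumBelow-0 n λ i i<n → p i (ℕₚ.m<n⇒m<1+n i<n)) (p n ℕₚ.≤-refl)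

  ⊛-cong : ∀ {f f′ g g′} → f ≐ f′ → g ≐ g′ → f ⊛ g ≐ f′ ⊛ g′
  ⊛-cong p q m = sumBelow-cong (suc m) λ i _ → ≡.cong₂ _*_ (p i) (q (m ∸ i))

  -- Splitting off the constant term of f gives a recursion on the degree. The laws of `⊛` follow
  -- from it by induction, without any exchange of double sums.
  ⊛-suc : ∀ f g m → (f ⊛ g) (suc m) ≡ f 0 * g (suc m) + ((f ∘ suc) ⊛ g) m
  ⊛-suc f g m = sumBelow-suc (suc m) (λ i → f i * g (suc m ∸ i))

  ⊛-suc′ : ∀ f g m → (f ⊛ g) (suc m) ≡ (f ⊛ (g ∘ suc)) m + f (suc m) * g 0
  ⊛-suc′ f g m = ≡.cong₂ _+_
    (sumBelow-cong (suc m) λ { i (s≤s i≤m) → ≡.cong (λ n → f i * g n) (ℕₚ.+-∸-assoc 1 i≤m) })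
    (≡.cong (λ n → f (suc m) * g n) (ℕₚ.n∸n≡0 m))

  ⊛-comm : ∀ f g → f ⊛ g ≐ g ⊛ f
  ⊛-comm f g zero = ℕₚ.*-comm (f 0) (g 0)
  ⊛-comm f g (suc m) = begin
    (f ⊛ g) (suc m)                             ≡⟨ ⊛-suc f g m ⟩
    f 0 * g (suc m) + ((f ∘ suc) ⊛ g) m         ≡⟨ ≡.cong₂ _+_ (ℕₚ.*-comm (f 0) _) (⊛-comm (f ∘ suc) g m) ⟩
    g (suc m) * f 0 + (g ⊛ (f ∘ suc)) m         ≡⟨ ℕₚ.+-comm (g (suc m) * f 0) _ ⟩
    (g ⊛ (f ∘ suc)) m + g (suc m) * f 0         ≡⟨ ⊛-suc′ g f m ⟨
    (g ⊛ f) (suc m)                             ∎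

  ⊛-zeroˡ : ∀ f → 0ˢ ⊛ f ≐ 0ˢ
  ⊛-zeroˡ f m = sumBelow-0 (suc m) λ i _ → ≡.refl

  ⊛-identityˡ : ∀ f → one ⊛ f ≐ f
  ⊛-identityˡ f zero = ℕₚ.+-identityʳ (f 0)
  ⊛-identityˡ f (suc m) = begin
    (one ⊛ f) (suc m)                ≡⟨ ⊛-suc one f m ⟩
    1 * f (suc m) + (0ˢ ⊛ f) m       ≡⟨ ≡.cong₂ _+_ (ℕₚ.*-identityˡ (f (suc m))) (⊛-zeroˡ f m) ⟩
    f (suc m) + 0                    ≡⟨ ℕₚ.+-identityʳ _ ⟩
    f (suc m)                        ∎

  ⊛-distribʳ : ∀ h f g → (f ⊕ g) ⊛ h ≐ f ⊛ h ⊕ g ⊛ h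
  ⊛-distribʳ h f g zero = ℕₚ.*-distribʳ-+ (h 0) (f 0) (g 0)
  ⊛-distribʳ h f g (suc m) = begin
    ((f ⊕ g) ⊛ h) (suc m)                                              ≡⟨ ⊛-suc (f ⊕ g) h m ⟩
    (f 0 + g 0) * h (suc m) + (((f ∘ suc) ⊕ (g ∘ suc)) ⊛ h) m          ≡⟨ ≡.cong₂ _+_ (ℕₚ.*-distribʳ-+ (h (suc m)) (f 0) (g 0)) (⊛-distribʳ h (f ∘ suc) (g ∘ suc) m) ⟩
    (f 0 * h (suc m) + g 0 * h (suc m)) + (((f ∘ suc) ⊛ h) m + ((g ∘ suc) ⊛ h) m)
      ≡⟨ interchange (f 0 * h (suc m)) (g 0 * h (suc m)) _ _ ⟩
    (f 0 * h (suc m) + ((f ∘ suc) ⊛ h) m) + (g 0 * h (suc m) + ((g ∘ suc) ⊛ h) m)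
      ≡⟨ ≡.cong₂ _+_ (⊛-suc f h m) (⊛-suc g h m) ⟨
    (f ⊛ h) (suc m) + (g ⊛ h) (suc m)                                  ∎
    where open import Algebra.Properties.CommutativeSemigroup ℕₚ.+-commutativeSemigroup using (interchange)

  ⊛-scale : ∀ c f g → (λ m → c * f m) ⊛ g ≐ λ m → c * (f ⊛ g) m
  ⊛-scale c f g zero = ℕₚ.*-assoc c (f 0) (g 0)
  ⊛-scale c f g (suc m) = begin
    ((λ m → c * f m) ⊛ g) (suc m)                                ≡⟨ ⊛-suc (λ m → c * f m) g m ⟩
    c * f 0 * g (suc m) + ((λ m → c * f (suc m)) ⊛ g) m          ≡⟨ ≡.cong₂ _+_ (ℕₚ.*-assoc c (f 0) _) (⊛-scale c (f ∘ suc) g m) ⟩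
    c * (f 0 * g (suc m)) + c * ((f ∘ suc) ⊛ g) m                ≡⟨ ℕₚ.*-distribˡ-+ c _ _ ⟨
    c * (f 0 * g (suc m) + ((f ∘ suc) ⊛ g) m)                    ≡⟨ ≡.cong (c *_) (⊛-suc f g m) ⟨
    c * (f ⊛ g) (suc m)                                          ∎

  ⊛-assoc : ∀ f g h → (f ⊛ g) ⊛ h ≐ f ⊛ (g ⊛ h)
  ⊛-assoc f g h zero = ℕₚ.*-assoc (f 0) (g 0) (h 0)
  ⊛-assoc f g h (suc m) = begin
    ((f ⊛ g) ⊛ h) (suc m)
      ≡⟨ ⊛-suc (f ⊛ g) h m ⟩
    f 0 * g 0 * h (suc m) + (((f ⊛ g) ∘ suc) ⊛ h) m
      ≡⟨ ≡.cong (f 0 * g 0 * h (suc m) +_) (≡.trans (⊛-cong {g = h} (⊛-suc f g) (λ _ → ≡.refl) m)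
           (⊛-distribʳ h (λ m → f 0 * g (suc m)) ((f ∘ suc) ⊛ g) m)) ⟩
    f 0 * g 0 * h (suc m) + (((λ m → f 0 * g (suc m)) ⊛ h) m + (((f ∘ suc) ⊛ g) ⊛ h) m)
      ≡⟨ ≡.cong₂ _+_ (ℕₚ.*-assoc (f 0) (g 0) (h (suc m)))
           (≡.cong₂ _+_ (⊛-scale (f 0) (g ∘ suc) h m) (⊛-assoc (f ∘ suc) g h m)) ⟩
    f 0 * (g 0 * h (suc m)) + (f 0 * ((g ∘ suc) ⊛ h) m + ((f ∘ suc) ⊛ (g ⊛ h)) m)
      ≡⟨ ℕₚ.+-assoc (f 0 * (g 0 * h (suc m))) _ _ ⟨
    (f 0 * (g 0 * h (suc m)) + f 0 * ((g ∘ suc) ⊛ h) m) + ((f ∘ suc) ⊛ (g ⊛ h)) m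
      ≡⟨ ≡.cong (_+ ((f ∘ suc) ⊛ (g ⊛ h)) m) (≡.trans (≡.sym (ℕₚ.*-distribˡ-+ (f 0) _ _)) (≡.cong (f 0 *_) (≡.sym (⊛-suc g h m)))) ⟩
    f 0 * (g ⊛ h) (suc m) + ((f ∘ suc) ⊛ (g ⊛ h)) m
      ≡⟨ ⊛-suc f (g ⊛ h) m ⟨
    (f ⊛ (g ⊛ h)) (suc m) ∎

  mono-≢ : ∀ {e m} → m ≢ e → mono e m ≡ 0
  mono-≢ {zero} {zero} p = ⊥-elim (p ≡.refl)
  mono-≢ {zero} {suc m} p = ≡.refl
  mono-≢ {suc e} {zero} p = ≡.refl
  mono-≢ {suc e} {suc m} p = mono-≢ {e} {m} (p ∘ ≡.cong suc)

  mono-diag : ∀ e → mono e e ≡ 1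
  mono-diag zero = ≡.refl
  mono-diag (suc e) = mono-diag e

  mono-⊛-+ : ∀ a f m → (mono a ⊛ f) (a + m) ≡ f m
  mono-⊛-+ zero f m = ⊛-identityˡ f m
  mono-⊛-+ (suc a) f m = ≡.trans (⊛-suc (mono (suc a)) f (a + m)) (mono-⊛-+ a f m)

  mono-⊛-< : ∀ {a m} f → m < a → (mono a ⊛ f) m ≡ 0
  mono-⊛-< {suc a} {zero} f m<a = ≡.refl
  mono-⊛-< {suc a} {suc m} f (s≤s m<a) = ≡.trans (⊛-suc (mono (suc a)) f m) (mono-⊛-< f m<a)

  mono-+ : ∀ a b → mono (a + b) ≐ mono a ⊛ mono b
  mono-+ zero b m = ≡.sym (⊛-identityˡ (mono b) m)
  mono-+ (suc a) b zero = ≡.refl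
  mono-+ (suc a) b (suc m) = ≡.trans (mono-+ a b m) (≡.sym (⊛-suc (mono (suc a)) (mono b) m))

  geom-∣ : ∀ {k m} → suc k ∣ m → geom k m ≡ 1
  geom-∣ {k} {m} p rewrite n∣m⇒m%n≡0 m (suc k) p = ≡.refl

  geom-∤ : ∀ {k m} → ¬ suc k ∣ m → geom k m ≡ 0
  geom-∤ {k} {m} p with m % suc k in eq
  ... | zero = ⊥-elim (p (m%n≡0⇒n∣m m (suc k) eq))
  ... | suc _ = ≡.refl

  geom-cong : ∀ {k m j n} → (suc k ∣ m → suc j ∣ n) → (suc j ∣ n → suc k ∣ m) → geom k m ≡ geom j n
  geom-cong {k} {m} {j} {n} to from with suc k ∣? m
  ... | yes p = ≡.trans (geom-∣ p) (≡.sym (geom-∣ (to p)))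
  ... | no p = ≡.trans (geom-∤ p) (≡.sym (geom-∤ (p ∘ from)))

  geom-step : ∀ k → geom k ≐ one ⊕ mono (suc k) ⊛ geom k
  geom-step k m with m ℕ.<? suc k
  ... | yes m<1+k = ≡.trans (small m m<1+k) (≡.sym (≡.trans (≡.cong (one m +_) (mono-⊛-< (geom k) m<1+k)) (ℕₚ.+-identityʳ _)))
    where
    small : ∀ m → m < suc k → geom k m ≡ one m
    small m m<1+k rewrite m<n⇒m%n≡m m<1+k = ≡.refl
  ... | no m≮1+k = begin
    geom k m                                   ≡⟨ ≡.cong (geom k) m≡ ⟨
    geom k (suc k + m′)                        ≡⟨ ≡.cong (λ r → one r) (≡.trans (≡.cong (_% suc k) (ℕₚ.+-comm (suc k) m′)) ([m+n]%n≡m%n m′ (suc k))) ⟩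
    geom k m′                                  ≡⟨ mono-⊛-+ (suc k) (geom k) m′ ⟨
    (mono (suc k) ⊛ geom k) (suc k + m′)       ≡⟨ ≡.cong (one ⊕ mono (suc k) ⊛ geom k) m≡ ⟩
    (one ⊕ mono (suc k) ⊛ geom k) m            ∎
    where
    m′ = m ∸ suc k
    m≡ : suc k + m′ ≡ m
    m≡ = ℕₚ.m+[n∸m]≡n (ℕₚ.≮⇒≥ m≮1+k)

section : ℕ → ℕ → Series → Series
section d r f m = f (d * m + r)

module _ (d : ℕ) .{{_ : NonZero d}} where
  open ≡-Reasoning

  -- f(q^d)
  dilate : Series → Series
  dilate f m = one (m % d) * f (m / d)

  dilate-+ : ∀ f m {r} → r < d → dilate f (d * m + r) ≡ one r * f m
  dilate-+ f m {r} r<d = ≡.cong₂ (λ a b → one a * f b) remainder quotient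
    where
    remainder : (d * m + r) % d ≡ r
    remainder = begin
      (d * m + r) % d    ≡⟨ ≡.cong (_% d) (≡.trans (ℕₚ.+-comm (d * m) r) (≡.cong (r +_) (ℕₚ.*-comm d m))) ⟩
      (r + m * d) % d    ≡⟨ [m+kn]%n≡m%n r m d ⟩
      r % d              ≡⟨ m<n⇒m%n≡m r<d ⟩
      r                  ∎
    quotient : (d * m + r) / d ≡ m
    quotient = begin
      (d * m + r) / d       ≡⟨ +-distrib-/-∣ˡ r (divides m (ℕₚ.*-comm d m)) ⟩
      d * m / d + r / d     ≡⟨ ≡.cong₂ _+_ (≡.trans (≡.cong (_/ d) (ℕₚ.*-comm d m)) (m*n/n≡m m d)) (m<n⇒m/n≡0 r<d) ⟩
      m + 0                 ≡⟨ ℕₚ.+-identityʳ m ⟩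
      m                     ∎

  ≐-sections : ∀ {f g} → (∀ m r → r < d → f (d * m + r) ≡ g (d * m + r)) → f ≐ g
  ≐-sections {f} {g} p n = ≡.subst (λ n → f n ≡ g n) n≡ (p (n / d) (n % d) (m%n<n n d))
    where
    n≡ : d * (n / d) + n % d ≡ n
    n≡ = ≡.trans (ℕₚ.+-comm (d * (n / d)) (n % d))
      (≡.trans (≡.cong (n % d +_) (ℕₚ.*-comm d (n / d))) (≡.sym (m≡m%n+[m/n]*n n d)))

  section-dilate : ∀ f → section d 0 (dilate f) ≐ f
  section-dilate f m = ≡.trans (dilate-+ f m (ℕₚ.n≢0⇒n>0 (ℕ.≢-nonZero⁻¹ d))) (ℕₚ.*-identityˡ (f m))

  private
    block : ∀ (f g : Series) m r → r < d → sumBelow (suc r) (λ i → dilate f (d * m + i) * g (d * m + i)) ≡ f m * g (d * m)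
    block f g m r r<d = begin
      sumBelow (suc r) (λ i → dilate f (d * m + i) * g (d * m + i))
        ≡⟨ sumBelow-suc r _ ⟩
      section d 0 (dilate f) m * g (d * m + 0) + sumBelow r (λ i → dilate f (d * m + suc i) * g (d * m + suc i))
        ≡⟨ ≡.cong₂ _+_ (≡.cong₂ (λ a b → a * g b) (section-dilate f m) (ℕₚ.+-identityʳ (d * m)))
             (sumBelow-0 r λ i i<r → ≡.cong (_* g (d * m + suc i)) (dilate-+ f m (ℕₚ.≤-<-trans i<r r<d))) ⟩
      f m * g (d * m) + 0
        ≡⟨ ℕₚ.+-identityʳ _ ⟩
      f m * g (d * m) ∎

    blocks : ∀ (f g : Series) m → sumBelow (d * m) (λ i → dilate f i * g i) ≡ sumBelow m (λ j → f j * g (d * j))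
    blocks f g zero = ≡.cong (λ n → sumBelow n (λ i → dilate f i * g i)) (ℕₚ.*-zeroʳ d)
    blocks f g (suc m) = begin
      sumBelow (d * suc m) s                                     ≡⟨ ≡.cong (λ n → sumBelow n s) (≡.trans (ℕₚ.*-suc d m) (ℕₚ.+-comm d (d * m))) ⟩
      sumBelow (d * m + d) s                                     ≡⟨ sumBelow-+ (d * m) d s ⟩
      sumBelow (d * m) s + sumBelow d (s ∘ (d * m +_))           ≡⟨ ≡.cong₂ _+_ (blocks f g m)
                                                                     (≡.trans (≡.cong (λ n → sumBelow n (s ∘ (d * m +_))) (≡.sym (ℕₚ.suc-pred d)))
                                                                       (block f g m (ℕ.pred d) (ℕₚ.≤-reflexive (ℕₚ.suc-pred d)))) ⟩
      sumBelow (suc m) (λ j → f j * g (d * j))                   ∎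
      where
      s : ℕ → ℕ
      s i = dilate f i * g i

  -- Series in q^d are scalars for the extraction of a residue class: in the convolution only the
  -- indices i divisible by d contribute, one for each block of length d.
  section-dilate-⊛ : ∀ {r} f g → r < d → section d r (dilate f ⊛ g) ≐ f ⊛ section d r g
  section-dilate-⊛ {r} f g r<d m = begin
    sumBelow (suc (d * m + r)) (λ i → dilate f i * g′ i)
      ≡⟨ ≡.cong (λ n → sumBelow n (λ i → dilate f i * g′ i)) (ℕₚ.+-suc (d * m) r) ⟨
    sumBelow (d * m + suc r) (λ i → dilate f i * g′ i)
      ≡⟨ sumBelow-+ (d * m) (suc r) (λ i → dilate f i * g′ i) ⟩
    sumBelow (d * m) (λ i → dilate f i * g′ i) + sumBelow (suc r) (λ i → dilate f (d * m + i) * g′ (d * m + i))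
      ≡⟨ ≡.cong₂ _+_ (blocks f g′ m) (block f g′ m r r<d) ⟩
    sumBelow (suc m) (λ j → f j * g′ (d * j))
      ≡⟨ sumBelow-cong (suc m) (λ { j (s≤s j≤m) → ≡.cong (λ n → f j * g n) (index j j≤m) }) ⟩
    (f ⊛ section d r g) m ∎
    where
    g′ : Series
    g′ i = g (d * m + r ∸ i)
    index : ∀ j → j ≤ m → d * m + r ∸ d * j ≡ d * (m ∸ j) + r
    index j j≤m = begin
      d * m + r ∸ d * j      ≡⟨ ℕₚ.+-∸-comm r (ℕₚ.*-monoʳ-≤ d j≤m) ⟩
      d * m ∸ d * j + r      ≡⟨ ≡.cong (_+ r) (ℕₚ.*-distribˡ-∸ d m j) ⟨
      d * (m ∸ j) + r        ∎

  -- Compared on each residue class modulo d: there both sides are f ⊛ g for residue 0, and 0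
  -- otherwise.
  dilate-⊛ : ∀ f g → dilate (f ⊛ g) ≐ dilate f ⊛ dilate g
  dilate-⊛ f g = ≐-sections λ m r r<d → begin
    dilate (f ⊛ g) (d * m + r)               ≡⟨ dilate-+ (f ⊛ g) m r<d ⟩
    one r * (f ⊛ g) m                        ≡⟨ ⊛-scale-right (one r) m ⟨
    (f ⊛ (λ n → one r * g n)) m              ≡⟨ ⊛-cong {f} (λ _ → ≡.refl) (λ n → dilate-+ g n r<d) m ⟨
    (f ⊛ section d r (dilate g)) m           ≡⟨ section-dilate-⊛ f (dilate g) r<d m ⟨
    (dilate f ⊛ dilate g) (d * m + r)        ∎
    where
    ⊛-scale-right : ∀ c m → (f ⊛ (λ n → c * g n)) m ≡ c * (f ⊛ g) m
    ⊛-scale-right c m = ≡.trans (⊛-comm f (λ n → c * g n) m)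
      (≡.trans (⊛-scale c g f m) (≡.cong (c *_) (⊛-comm g f m)))

  dilate-mono : ∀ e → dilate (mono e) ≐ mono (d * e)
  dilate-mono e = ≐-sections λ m r r<d → ≡.trans (dilate-+ (mono e) m r<d) (cases m r r<d)
    where
    cases : ∀ m r → r < d → one r * mono e m ≡ mono (d * e) (d * m + r)
    cases m zero _ with m ℕ.≟ e
    ... | yes ≡.refl = begin
      1 * mono m m                ≡⟨ ≡.cong (1 *_) (mono-diag m) ⟩
      1                           ≡⟨ mono-diag (d * m) ⟨
      mono (d * m) (d * m)        ≡⟨ ≡.cong (mono (d * m)) (ℕₚ.+-identityʳ (d * m)) ⟨
      mono (d * m) (d * m + 0)    ∎
    ... | no m≢e = ≡.trans (≡.cong (1 *_) (mono-≢ m≢e))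
      (≡.sym (mono-≢ λ eq → m≢e (ℕₚ.*-cancelˡ-≡ m e d (≡.trans (≡.sym (ℕₚ.+-identityʳ (d * m))) eq))))
    cases m (suc r) r<d = ≡.sym (mono-≢ λ eq → contradiction (begin
      suc r                        ≡⟨ m<n⇒m%n≡m r<d ⟨
      suc r % d                    ≡⟨ [m+kn]%n≡m%n (suc r) m d ⟨
      (suc r + m * d) % d          ≡⟨ ≡.cong (_% d) (≡.trans (ℕₚ.+-comm (suc r) (m * d)) (≡.cong (_+ suc r) (ℕₚ.*-comm m d))) ⟩
      (d * m + suc r) % d          ≡⟨ ≡.cong (_% d) (≡.trans eq (ℕₚ.*-comm d e)) ⟩
      e * d % d                    ≡⟨ m*n%n≡0 e d ⟩
      0                            ∎) )
      where
      contradiction : suc r ≢ 0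
      contradiction ()

  section-geom : ∀ {k} → Coprime (suc k) d → section d 0 (geom k) ≐ geom k
  section-geom {k} coprime m = geom-cong
    (λ p → coprime-divisor coprime (≡.subst (suc k ∣_) (ℕₚ.+-identityʳ (d * m)) p))
    (λ p → ≡.subst (suc k ∣_) (≡.sym (ℕₚ.+-identityʳ (d * m))) (∣n⇒∣m*n d p))

-- The ring of truncated series modulo 4

infix 4 _≈[_]_
-- A record keeps f, N and g visible to unification; a relation that unfolded to a statement about
-- coefficients would lose them.
record _≈[_]_ (f : Series) (N : ℕ) (g : Series) : Set where
  constructor below
  field
    at : ∀ m → m < N → f m % 4 ≡ g m % 4

open _≈[_]_

≐⇒≈ : ∀ {N f g} → f ≐ g → f ≈[ N ] g
≐⇒≈ p = below λ m _ → ≡.cong (_% 4) (p m)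

≈-weaken : ∀ {N N′ f g} → N ≤ N′ → f ≈[ N′ ] g → f ≈[ N ] g
≈-weaken N≤N′ p = below λ m m<N → at p m (ℕₚ.<-≤-trans m<N N≤N′)

%-+-cong : ∀ n .{{_ : NonZero n}} a b c d → a % n ≡ b % n → c % n ≡ d % n → (a + c) % n ≡ (b + d) % n
%-+-cong n a b c d p q = ≡.trans (%-distribˡ-+ a c n)
  (≡.trans (≡.cong₂ (λ x y → (x + y) % n) p q) (≡.sym (%-distribˡ-+ b d n)))

%-*-cong : ∀ n .{{_ : NonZero n}} a b c d → a % n ≡ b % n → c % n ≡ d % n → (a * c) % n ≡ (b * d) % n
%-*-cong n a b c d p q = ≡.trans (%-distribˡ-* a c n)
  (≡.trans (≡.cong₂ (λ x y → (x * y) % n) p q) (≡.sym (%-distribˡ-* b d n)))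

sumBelow-%-cong : ∀ n f g → (∀ i → i < n → f i % 4 ≡ g i % 4) → sumBelow n f % 4 ≡ sumBelow n g % 4
sumBelow-%-cong zero f g p = ≡.refl
sumBelow-%-cong (suc n) f g p = %-+-cong 4 (sumBelow n f) (sumBelow n g) (f n) (g n) (sumBelow-%-cong n f g λ i i<n → p i (ℕₚ.m<n⇒m<1+n i<n)) (p n ℕₚ.≤-refl)

-- (ℤ/4)[q]/(q^N): coefficients are represented by naturals, and -1 by 3.
negate : Series → Series
negate f m = 3 * f m

-- The operations are opaque so that Agda can infer their arguments instead of
-- comparing coefficients.
infixl 6 _⊞_
infixl 7 _⊠_
infix 8 ⊟_
opaque
  _⊞_ _⊠_ : Series → Series → Series
  _⊞_ = _⊕_
  _⊠_ = _⊛_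

  ⊟_ : Series → Series
  ⊟_ = negate

opaque
  unfolding _⊞_

  seriesRing-isCommutativeRing : ∀ N → IsCommutativeRing _≈[ N ]_ _⊞_ _⊠_ ⊟_ 0ˢ one
  seriesRing-isCommutativeRing N = record
    { isRing = record
      { +-isAbelianGroup = record
        { isGroup = record
          { isMonoid = record
            { isSemigroup = record
              { isMagma = record
                { isEquivalence = record
                  { refl = below λ _ _ → ≡.refl
                  ; sym = λ p → below λ m m<N → ≡.sym (at p m m<N)
                  ; trans = λ p q → below λ m m<N → ≡.trans (at p m m<N) (at q m m<N)
                  }
                ; ∙-cong = λ {f} {g} {h} {k} p q → below λ m m<N → %-+-cong 4 (f m) (g m) (h m) (k m) (at p m m<N) (at q m m<N)
                }
              ; assoc = λ f g h → ≐⇒≈ λ m → ℕₚ.+-assoc (f m) (g m) (h m)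
              }
            ; identity = (λ f → ≐⇒≈ λ m → ≡.refl) , (λ f → ≐⇒≈ λ m → ℕₚ.+-identityʳ (f m))
            }
          ; inverse = (λ f → below λ m _ → ≡.trans (≡.cong (_% 4) (ℕₚ.+-comm (3 * f m) (f m))) (4∣ (f m)))
                    , (λ f → below λ m _ → 4∣ (f m))
          ; ⁻¹-cong = λ {f} {g} p → below λ m m<N → %-*-cong 4 3 3 (f m) (g m) ≡.refl (at p m m<N)
          }
        ; comm = λ f g → ≐⇒≈ λ m → ℕₚ.+-comm (f m) (g m)
        }
      ; *-cong = λ {f} {g} {h} {k} p q → below λ m m<N →
          sumBelow-%-cong (suc m) (λ i → f i * h (m ∸ i)) (λ i → g i * k (m ∸ i)) λ { i (s≤s i≤m) →
            %-*-cong 4 (f i) (g i) (h (m ∸ i)) (k (m ∸ i))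
              (at p i (ℕₚ.≤-<-trans i≤m m<N)) (at q (m ∸ i) (ℕₚ.≤-<-trans (ℕₚ.m∸n≤m m i) m<N)) }
      ; *-assoc = λ f g h → ≐⇒≈ (⊛-assoc f g h)
      ; *-identity = (λ f → ≐⇒≈ (⊛-identityˡ f))
                   , (λ f → ≐⇒≈ λ m → ≡.trans (⊛-comm f one m) (⊛-identityˡ f m))
      ; distrib = (λ h f g → ≐⇒≈ λ m → ≡.trans (⊛-comm h (f ⊕ g) m)
                    (≡.trans (⊛-distribʳ h f g m) (≡.cong₂ _+_ (⊛-comm f h m) (⊛-comm g h m))))
                , (λ h f g → ≐⇒≈ (⊛-distribʳ h f g))
      }
    ; *-comm = λ f g → ≐⇒≈ (⊛-comm f g)
    }
    where
    4∣ : ∀ n → 4 * n % 4 ≡ 0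
    4∣ n = ≡.trans (≡.cong (_% 4) (ℕₚ.*-comm 4 n)) (m*n%n≡0 n 4)

seriesRing : ℕ → CommutativeRing _ _
seriesRing N = record { isCommutativeRing = seriesRing-isCommutativeRing N }

-- Algebraic identities, in general and where 4 = 0

module RingIdentities {c ℓ} (R : CommutativeRing c ℓ) where
  open CommutativeRing R hiding (zero) renaming (_+_ to _+′_; _*_ to _*′_)
  open RingKit R
  open import Relation.Binary.Reasoning.Setoid setoid

  step⇒inverse : ∀ {m g} → g ≈ 1# +′ m *′ g → (1# - m) *′ g ≈ 1#
  step⇒inverse {m} {g} p = begin
    (1# - m) *′ g               ≈⟨ expand m g ⟩
    g - m *′ g                  ≈⟨ +-congʳ p ⟩
    (1# +′ m *′ g) - m *′ g     ≈⟨ cancel (m *′ g) ⟩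
    1#                          ∎
    where
    expand : ∀ m g → (1# - m) *′ g ≈ g - m *′ g
    expand = solve 2 (λ m g → (:1 :- m) :* g := g :- m :* g) refl
    cancel : ∀ z → (1# +′ z) - z ≈ 1#
    cancel = solve 1 (λ z → (:1 :+ z) :- z := :1) refl

  inverse-unique : ∀ {u g g′} → u *′ g ≈ 1# → u *′ g′ ≈ 1# → g ≈ g′
  inverse-unique p q = unit-cancel p (trans p (sym q))

  -- 1 - ab = (1 - a) + a(1 - b), and a g = g - 1 since g inverts 1 - a.
  two-poles : ∀ {a b z g g′} → z ≈ a *′ b → (1# - a) *′ g ≈ 1# → (1# - b) *′ g′ ≈ 1# →
    (1# - z) *′ (g *′ g′) ≈ (g +′ g′) - 1#
  two-poles {a} {b} {z} {g} {g′} z≈ab p q = begin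
    (1# - z) *′ (g *′ g′)                                    ≈⟨ *-congʳ (+-congˡ (-‿cong z≈ab)) ⟩
    (1# - a *′ b) *′ (g *′ g′)                               ≈⟨ expand a b g g′ ⟩
    ((1# - a) *′ g) *′ g′ +′ (g - (1# - a) *′ g) *′ ((1# - b) *′ g′)
      ≈⟨ +-cong (*-congʳ p) (*-cong (+-congˡ (-‿cong p)) q) ⟩
    1# *′ g′ +′ (g - 1#) *′ 1#                               ≈⟨ collect g g′ ⟩
    (g +′ g′) - 1#                                           ∎
    where
    expand : ∀ a b g g′ → (1# - a *′ b) *′ (g *′ g′)
      ≈ ((1# - a) *′ g) *′ g′ +′ (g - (1# - a) *′ g) *′ ((1# - b) *′ g′)
    expand = solve 4 (λ a b g g′ → (:1 :- a :* b) :* (g :* g′)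
      := ((:1 :- a) :* g) :* g′ :+ (g :- (:1 :- a) :* g) :* ((:1 :- b) :* g′)) refl
    collect : ∀ g g′ → 1# *′ g′ +′ (g - 1#) *′ 1# ≈ (g +′ g′) - 1#
    collect = solve 2 (λ g g′ → :1 :* g′ :+ (g :- :1) :* :1 := (g :+ g′) :- :1) refl

  appell-term : ∀ s t z p g g′ → p *′ ((s *′ (t *′ (1# - z))) *′ (g *′ g′)) ≈ (s *′ (p *′ t)) *′ ((1# - z) *′ (g *′ g′))
  appell-term = solve 6 (λ s t z p g g′ → p :* ((s :* (t :* (:1 :- z))) :* (g :* g′))
    := (s :* (p :* t)) :* ((:1 :- z) :* (g :* g′))) refl

  square-split : ∀ {a g g′} → (1# - a) *′ g ≈ 1# → (1# - a *′ a) *′ g′ ≈ 1# → g ≈ (1# +′ a) *′ g′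
  square-split {a} {g} {g′} p q = inverse-unique p (trans (expand a g′) q)
    where
    expand : ∀ a g → (1# - a) *′ ((1# +′ a) *′ g) ≈ (1# - a *′ a) *′ g
    expand = solve 2 (λ a g → (:1 :- a) :* ((:1 :+ a) :* g) := (:1 :- a :* a) :* g) refl

  unit-product : ∀ {a b x y} → a *′ x ≈ 1# → b *′ y ≈ 1# → (a *′ b) *′ (x *′ y) ≈ 1#
  unit-product p q = trans (*-interchange _ _ _ _) (trans (*-cong p q) (*-identityʳ 1#))

  ≈1-product : ∀ {a b} → a ≈ 1# → b ≈ 1# → a *′ b ≈ 1#
  ≈1-product p q = trans (*-cong p q) (*-identityʳ 1#)

  regroup-doubles : ∀ a b c d b′ c′ →
    (((a +′ b) +′ (a +′ b)) +′ ((c +′ d) +′ (c +′ d))) +′ ((b′ +′ c′) +′ (b′ +′ c′))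
    ≈ (((a +′ b′) +′ (a +′ b′)) +′ ((c′ +′ d) +′ (c′ +′ d))) +′ ((b +′ c) +′ (b +′ c))
  regroup-doubles = solve 6 (λ a b c d b′ c′ →
    (((a :+ b) :+ (a :+ b)) :+ ((c :+ d) :+ (c :+ d))) :+ ((b′ :+ c′) :+ (b′ :+ c′))
    := (((a :+ b′) :+ (a :+ b′)) :+ ((c′ :+ d) :+ (c′ :+ d))) :+ ((b :+ c) :+ (b :+ c))) refl

  *-outer-inner : ∀ a b c d → (a *′ b) *′ (c *′ d) ≈ (a *′ d) *′ (b *′ c)
  *-outer-inner = solve 4 (λ a b c d → (a :* b) :* (c :* d) := (a :* d) :* (b :* c)) refl

  *-rotate : ∀ a b c → (a *′ b) *′ c ≈ b *′ (a *′ c)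
  *-rotate = solve 3 (λ a b c → (a :* b) :* c := b :* (a :* c)) refl

  module Mod4 (4x≈0 : ∀ x → (x +′ x) +′ (x +′ x) ≈ 0#) where

    -- (1 + a)/(1 - a) = 2g - 1. Taking two factors at once turns the constants -1 into +1, and -2(g
    -- + g′) equals 2(g + g′) modulo 4.
    overline-pair : ∀ {a b g g′} → (1# - a) *′ g ≈ 1# → (1# - b) *′ g′ ≈ 1# →
      (g *′ g′) *′ ((1# +′ a) *′ (1# +′ b)) ≈ 1# +′ ((g +′ g′) +′ (g +′ g′))
    overline-pair {a} {b} {g} {g′} p q = begin
      (g *′ g′) *′ ((1# +′ a) *′ (1# +′ b))
        ≈⟨ expand₁ a b g g′ ⟩
      ((g +′ g) - (1# - a) *′ g) *′ ((g′ +′ g′) - (1# - b) *′ g′)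
        ≈⟨ *-cong (+-congˡ (-‿cong p)) (+-congˡ (-‿cong q)) ⟩
      ((g +′ g) - 1#) *′ ((g′ +′ g′) - 1#)
        ≈⟨ expand₂ g g′ ⟩
      (1# +′ ((g +′ g′) +′ (g +′ g′))) +′ ((y +′ y) +′ (y +′ y))
        ≈⟨ trans (+-congˡ (4x≈0 y)) (+-identityʳ _) ⟩
      1# +′ ((g +′ g′) +′ (g +′ g′)) ∎
      where
      y = g *′ g′ - (g +′ g′)
      expand₁ : ∀ a b g g′ → (g *′ g′) *′ ((1# +′ a) *′ (1# +′ b))
        ≈ ((g +′ g) - (1# - a) *′ g) *′ ((g′ +′ g′) - (1# - b) *′ g′)
      expand₁ = solve 4 (λ a b g g′ → (g :* g′) :* ((:1 :+ a) :* (:1 :+ b))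
        := ((g :+ g) :- (:1 :- a) :* g) :* ((g′ :+ g′) :- (:1 :- b) :* g′)) refl
      expand₂ : ∀ g g′ → ((g +′ g) - 1#) *′ ((g′ +′ g′) - 1#)
        ≈ (1# +′ ((g +′ g′) +′ (g +′ g′))) +′ (((g *′ g′ - (g +′ g′)) +′ (g *′ g′ - (g +′ g′))) +′ ((g *′ g′ - (g +′ g′)) +′ (g *′ g′ - (g +′ g′))))
      expand₂ = solve 2 (λ g g′ → ((g :+ g) :- :1) :* ((g′ :+ g′) :- :1)
        := (:1 :+ ((g :+ g′) :+ (g :+ g′))) :+ (((g :* g′ :- (g :+ g′)) :+ (g :* g′ :- (g :+ g′))) :+ ((g :* g′ :- (g :+ g′)) :+ (g :* g′ :- (g :+ g′))))) refl

    -- Products of two doubled terms are multiples of 4, so only the linear part survives.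
    ∏-1+2w : ∀ n (w : ℕ → Carrier) → ∏ n (λ i → 1# +′ (w i +′ w i)) ≈ 1# +′ ∑ n (λ i → w i +′ w i)
    ∏-1+2w zero w = sym (+-identityʳ 1#)
    ∏-1+2w (suc n) w = begin
      (1# +′ (w 0 +′ w 0)) *′ ∏ n (λ i → 1# +′ (w (suc i) +′ w (suc i)))
        ≈⟨ *-congˡ (trans (∏-1+2w n (w ∘ suc)) (+-congˡ (∑-+ n (w ∘ suc) (w ∘ suc)))) ⟩
      (1# +′ (w 0 +′ w 0)) *′ (1# +′ (s +′ s))
        ≈⟨ expand (w 0) s ⟩
      (1# +′ ((w 0 +′ w 0) +′ (s +′ s))) +′ ((w 0 *′ s +′ w 0 *′ s) +′ (w 0 *′ s +′ w 0 *′ s))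
        ≈⟨ trans (+-congˡ (4x≈0 (w 0 *′ s))) (+-identityʳ _) ⟩
      1# +′ ((w 0 +′ w 0) +′ (s +′ s))
        ≈⟨ +-congˡ (+-congˡ (∑-+ n (w ∘ suc) (w ∘ suc))) ⟨
      1# +′ ∑ (suc n) (λ i → w i +′ w i) ∎
      where
      s = ∑ n (w ∘ suc)
      expand : ∀ w s → (1# +′ (w +′ w)) *′ (1# +′ (s +′ s)) ≈ (1# +′ ((w +′ w) +′ (s +′ s))) +′ ((w *′ s +′ w *′ s) +′ (w *′ s +′ w *′ s))
      expand = solve 2 (λ w s → (:1 :+ (w :+ w)) :* (:1 :+ (s :+ s))
        := (:1 :+ ((w :+ w) :+ (s :+ s))) :+ ((w :* s :+ w :* s) :+ (w :* s :+ w :* s))) refl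

    2∑≈0 : ∀ n (w : ℕ → Carrier) → ∑ n (λ i → w i +′ w i) +′ ∑ n (λ i → w i +′ w i) ≈ 0#
    2∑≈0 n w = trans (sym (∑-+ n (λ i → w i +′ w i) (λ i → w i +′ w i))) (∑-≈0 n λ i _ → 4x≈0 (w i))

    balance : ∀ {x y s s′} → x +′ y ≈ s +′ s′ → s ≈ s′ → s +′ s ≈ 0# → y +′ y ≈ 0# → x ≈ y
    balance {x} {y} {s} {s′} p q s0 y0 = begin
      x                  ≈⟨ +-identityʳ x ⟨
      x +′ 0#            ≈⟨ +-congˡ y0 ⟨
      x +′ (y +′ y)      ≈⟨ +-assoc x y y ⟨
      (x +′ y) +′ y      ≈⟨ +-congʳ (trans p (trans (+-congˡ (sym q)) s0)) ⟩
      0# +′ y            ≈⟨ +-identityˡ y ⟩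
      y                  ∎

  ∏-triples : ∀ n (f : ℕ → Carrier) → ∏ (n * 3) f ≈ ∏ n (λ k → f (k * 3) *′ (f (1 + k * 3) *′ f (2 + k * 3)))
  ∏-triples zero f = refl
  ∏-triples (suc n) f = trans
    (*-congˡ (*-congˡ (*-congˡ (∏-triples n (f ∘ (3 +_))))))
    (trans (*-congˡ (sym (*-assoc _ _ _))) (sym (*-assoc _ _ _)))

  ∏-pairs : ∀ n (f : ℕ → Carrier) → ∏ (n * 2) f ≈ ∏ n (λ k → f (k * 2) *′ f (1 + k * 2))
  ∏-pairs zero f = refl
  ∏-pairs (suc n) f = trans (*-congˡ (*-congˡ (∏-pairs n (f ∘ (2 +_))))) (sym (*-assoc _ _ _))

  ∑-pairs : ∀ n (f : ℕ → Carrier) → ∑ (n * 2) f ≈ ∑ n (λ k → f (k * 2) +′ f (1 + k * 2))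
  ∑-pairs zero f = refl
  ∑-pairs (suc n) f = trans (+-congˡ (+-congˡ (∑-pairs n (f ∘ (2 +_))))) (sym (+-assoc _ _ _))

-- The `∑` and `∏` of every `seriesRing N` unfold to these, because `accumulate` sees the operations
-- only and not N. Thus one and the same series can be treated at several precisions.
∑ˢ ∏ˢ : ℕ → (ℕ → Series) → Series
∑ˢ = accumulate _⊞_ 0ˢ
∏ˢ = accumulate _⊠_ one

module _ where
  private
    coprime-by : ∀ {a b} → (∀ d → d ∣ a → d ∣ b → d ∣ 1) → Coprime a b
    coprime-by p {d} (d∣a , d∣b) = ∣1⇒≡1 (p d d∣a d∣b)

    drop-multiple : ∀ {d a b} c → d ∣ b → d ∣ c * b + a → d ∣ a
    drop-multiple c d∣b d∣ = ∣m+n∣m⇒∣n d∣ (∣n⇒∣m*n c d∣b)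

    open Data.Nat.Solver.+-*-Solver

  coprime-1+6r-3 : ∀ r → Coprime (1 + r * 6) 3
  coprime-1+6r-3 r = coprime-by λ d p q → drop-multiple (r * 2) q
    (≡.subst (d ∣_) (solve 1 (λ r → con 1 :+ r :* con 6 := (r :* con 2) :* con 3 :+ con 1) ≡.refl r) p)

  coprime-5+6r-3 : ∀ r → Coprime (5 + r * 6) 3
  coprime-5+6r-3 r = coprime-by λ d p q →
    let d∣2 = drop-multiple (1 + r * 2) q
                (≡.subst (d ∣_) (solve 1 (λ r → con 5 :+ r :* con 6 := (con 1 :+ r :* con 2) :* con 3 :+ con 2) ≡.refl r) p)
    -- Here `q` is read as d ∣ 2 + 1.
    in ∣m+n∣m⇒∣n q d∣2

  coprime-1+6r-2 : ∀ r → Coprime (1 + r * 6) 2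
  coprime-1+6r-2 r = coprime-by λ d p q → drop-multiple (r * 3) q
    (≡.subst (d ∣_) (solve 1 (λ r → con 1 :+ r :* con 6 := (r :* con 3) :* con 2 :+ con 1) ≡.refl r) p)

  coprime-5+6r-2 : ∀ r → Coprime (5 + r * 6) 2
  coprime-5+6r-2 r = coprime-by λ d p q → drop-multiple (2 + r * 3) q
    (≡.subst (d ∣_) (solve 1 (λ r → con 5 :+ r :* con 6 := (con 2 :+ r :* con 3) :* con 2 :+ con 1) ≡.refl r) p)

mono-cong : ∀ {e m e′ m′} → (m ≡ e → m′ ≡ e′) → (m′ ≡ e′ → m ≡ e) → mono e m ≡ mono e′ m′
mono-cong {e} {m} {e′} {m′} to from with m ℕ.≟ e
... | yes ≡.refl = ≡.trans (mono-diag m) (≡.trans (≡.sym (mono-diag e′)) (≡.cong (mono e′) (≡.sym (to ≡.refl))))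
... | no m≢e = ≡.trans (mono-≢ m≢e) (≡.sym (mono-≢ (m≢e ∘ from)))

section-mono-odd : ∀ e → section 2 1 (mono (2 * e + 1)) ≐ mono e
section-mono-odd e m = mono-cong
  (λ eq → ℕₚ.*-cancelˡ-≡ m e 2 (ℕₚ.+-cancelʳ-≡ 1 (2 * m) (2 * e) eq))
  (≡.cong (λ n → 2 * n + 1))

section-mono-even : ∀ e → section 2 1 (mono (2 * e)) ≐ 0ˢ
section-mono-even e m = mono-≢ {2 * e} {2 * m + 1} λ eq → 1≢0 (begin
  1                    ≡⟨ [m+kn]%n≡m%n 1 m 2 ⟨
  (1 + m * 2) % 2      ≡⟨ ≡.cong (_% 2) (≡.trans (ℕₚ.+-comm 1 (m * 2)) (≡.cong (_+ 1) (ℕₚ.*-comm m 2))) ⟩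
  (2 * m + 1) % 2      ≡⟨ ≡.cong (_% 2) (≡.trans eq (ℕₚ.*-comm 2 e)) ⟩
  e * 2 % 2            ≡⟨ m*n%n≡0 e 2 ⟩
  0                    ∎)
  where
  open ≡-Reasoning
  1≢0 : 1 ≢ 0
  1≢0 ()

opaque
  dil : (d : ℕ) .{{_ : NonZero d}} → Series → Series
  dil d = dilate d

  sec : ℕ → ℕ → Series → Series
  sec = section

-- Sections and dilations in the truncated rings

module Truncated (N : ℕ) where
  open CommutativeRing (seriesRing N) public
    using (setoid; refl; sym; trans; reflexive; +-cong; +-congˡ; +-congʳ; *-cong; *-congˡ; *-congʳ; -‿cong;
           +-identityʳ; +-identityˡ; +-comm; *-identityʳ; *-assoc; *-comm)
  open RingKit (seriesRing N) public hiding (∑; ∏; solve; _:+_; _:*_; _:-_; :-_; _:=_; con)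
  open RingIdentities (seriesRing N) public
  open import Algebra.Properties.CommutativeSemiring.Exp (CommutativeRing.commutativeSemiring (seriesRing N)) public using (_^_)
  open import Relation.Binary.Reasoning.Setoid setoid

  mono-≈0 : ∀ {e} → N ≤ e → mono e ≈[ N ] 0ˢ
  mono-≈0 {e} N≤e = below λ m m<N → ≡.cong (_% 4) (mono-≢ {e} {m} λ { ≡.refl → ℕₚ.<⇒≱ m<N N≤e })

  opaque
    unfolding _⊞_ dil

    4x≈0 : ∀ f → (f ⊞ f) ⊞ (f ⊞ f) ≈[ N ] 0ˢ
    4x≈0 f = below λ m _ → ≡.trans (≡.cong (_% 4) (solve 1 (λ x → (x :+ x) :+ (x :+ x) := x :* con 4) ≡.refl (f m))) (m*n%n≡0 (f m) 4)
      where open Data.Nat.Solver.+-*-Solver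

    mono-⊠ : ∀ a b → mono (a + b) ≈[ N ] mono a ⊠ mono b
    mono-⊠ a b = ≐⇒≈ (mono-+ a b)

    geom-unfold : ∀ k → geom k ≈[ N ] one ⊞ mono (suc k) ⊠ geom k
    geom-unfold k = ≐⇒≈ (geom-step k)

    -- Coefficients of a section below N are coefficients of the series below dN, so every
    -- extraction divides the available precision by d.
    sec-cong : ∀ d {f g r} → r < d → f ≈[ d * N ] g → sec d r f ≈[ N ] sec d r g
    sec-cong d {f} {g} {r} r<d p = below λ m m<N → at p (d * m + r) (ℕₚ.<-≤-trans (ℕₚ.+-monoʳ-< (d * m) r<d)
      (ℕₚ.≤-trans (ℕₚ.≤-reflexive (≡.trans (ℕₚ.+-comm (d * m) d) (≡.sym (ℕₚ.*-suc d m)))) (ℕₚ.*-monoʳ-≤ d m<N)))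

    sec-⊞ : ∀ d r f g → sec d r (f ⊞ g) ≈[ N ] sec d r f ⊞ sec d r g
    sec-⊞ d r f g = below λ _ _ → ≡.refl

    sec-⊟ : ∀ d r f → sec d r (⊟ f) ≈[ N ] ⊟ sec d r f
    sec-⊟ d r f = below λ _ _ → ≡.refl

    sec-0 : ∀ d r → sec d r 0ˢ ≈[ N ] 0ˢ
    sec-0 d r = below λ _ _ → ≡.refl

    sec-mono-odd : ∀ e → sec 2 1 (mono (2 * e + 1)) ≈[ N ] mono e
    sec-mono-odd e = ≐⇒≈ (section-mono-odd e)

    sec-mono-even : ∀ e → sec 2 1 (mono (2 * e)) ≈[ N ] 0ˢ
    sec-mono-even e = ≐⇒≈ (section-mono-even e)

  module _ (d : ℕ) .{{_ : NonZero d}} where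

    opaque
      unfolding _⊞_ dil

      dil-cong : ∀ {f g} → f ≈[ N ] g → dil d f ≈[ N ] dil d g
      dil-cong {f} {g} p = below λ m m<N → %-*-cong 4 (one (m % d)) (one (m % d)) (f (m / d)) (g (m / d))
        ≡.refl (at p (m / d) (ℕₚ.≤-<-trans (m/n≤m m d) m<N))

      dil-⊞ : ∀ f g → dil d (f ⊞ g) ≈[ N ] dil d f ⊞ dil d g
      dil-⊞ f g = ≐⇒≈ λ m → ℕₚ.*-distribˡ-+ (one (m % d)) (f (m / d)) (g (m / d))

      dil-⊠ : ∀ f g → dil d (f ⊠ g) ≈[ N ] dil d f ⊠ dil d g
      dil-⊠ f g = ≐⇒≈ (dilate-⊛ d f g)

      dil-⊟ : ∀ f → dil d (⊟ f) ≈[ N ] ⊟ dil d f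
      dil-⊟ f = ≐⇒≈ λ m → solve 2 (λ a b → a :* (con 3 :* b) := con 3 :* (a :* b)) ≡.refl (one (m % d)) (f (m / d))
        where open Data.Nat.Solver.+-*-Solver

      dil-0 : dil d 0ˢ ≈[ N ] 0ˢ
      dil-0 = ≐⇒≈ λ m → ℕₚ.*-zeroʳ (one (m % d))

      dil-mono : ∀ e → dil d (mono e) ≈[ N ] mono (d * e)
      dil-mono e = ≐⇒≈ (dilate-mono d e)

      dil-one : dil d one ≈[ N ] one
      dil-one = ≐⇒≈ λ m → ≡.trans (dilate-mono d 0 m) (≡.cong (λ e → mono e m) (ℕₚ.*-zeroʳ d))

      sec-dil : ∀ f → sec d 0 (dil d f) ≈[ N ] f
      sec-dil f = ≐⇒≈ (section-dilate d f)

      sec-dil-⊠ : ∀ {r} f g → r < d → sec d r (dil d f ⊠ g) ≈[ N ] f ⊠ sec d r g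
      sec-dil-⊠ f g r<d = ≐⇒≈ (section-dilate-⊛ d f g r<d)

      sec-geom : ∀ {k} → Coprime (suc k) d → sec d 0 (geom k) ≈[ N ] geom k
      sec-geom coprime = ≐⇒≈ (section-geom d coprime)

      sec-one : sec d 0 one ≈[ N ] one
      sec-one = ≐⇒≈ λ m → ≡.trans (≡.sym (dilated (d * m + 0))) (section-dilate d one m)
        where
        dilated : ∀ m → dilate d one m ≡ one m
        dilated m = ≡.trans (dilate-mono d 0 m) (≡.cong (λ e → mono e m) (ℕₚ.*-zeroʳ d))

  open Mod4 4x≈0 public

  mono-^ : ∀ a n → mono a ^ n ≈[ N ] mono (n * a)
  mono-^ a zero = refl
  mono-^ a (suc n) = trans (*-congˡ (mono-^ a n)) (sym (mono-⊠ a (n * a)))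

  geom-inverse : ∀ k → (one ⊞ ⊟ mono (suc k)) ⊠ geom k ≈[ N ] one
  geom-inverse k = step⇒inverse (geom-unfold k)

  geom-≈one : ∀ {k} → N ≤ suc k → geom k ≈[ N ] one
  geom-≈one {k} N≤1+k = trans (geom-unfold k)
    (trans (+-congˡ (0*-≈0 (geom k) (mono-≈0 N≤1+k))) (+-identityʳ one))

  sec-∑ : ∀ d r n (f : ℕ → Series) → sec d r (∑ˢ n f) ≈[ N ] ∑ˢ n (λ i → sec d r (f i))
  sec-∑ d r zero f = sec-0 d r
  sec-∑ d r (suc n) f = trans (sec-⊞ d r (f 0) (∑ˢ n (f ∘ suc))) (+-congˡ (sec-∑ d r n (f ∘ suc)))

  module _ (d : ℕ) .{{_ : NonZero d}} where

    dil-∏ : ∀ n (f : ℕ → Series) → dil d (∏ˢ n f) ≈[ N ] ∏ˢ n (λ i → dil d (f i))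
    dil-∏ zero f = dil-one d
    dil-∏ (suc n) f = trans (dil-⊠ d (f 0) (∏ˢ n (f ∘ suc))) (*-congˡ (dil-∏ n (f ∘ suc)))

    dil-∑ : ∀ n (f : ℕ → Series) → dil d (∑ˢ n f) ≈[ N ] ∑ˢ n (λ i → dil d (f i))
    dil-∑ zero f = dil-0 d
    dil-∑ (suc n) f = trans (dil-⊞ d (f 0) (∑ˢ n (f ∘ suc))) (+-congˡ (dil-∑ n (f ∘ suc)))

    dil-inverse : ∀ {f g} → f ⊠ g ≈[ N ] one → dil d f ⊠ dil d g ≈[ N ] one
    dil-inverse {f} {g} p = trans (sym (dil-⊠ d f g)) (trans (dil-cong d p) (dil-one d))

  -- Both sides are inverse to 1 - q^{(d+1)(k+1)}, and inverses are unique.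
  dil-geom : ∀ d k → dil (suc d) (geom k) ≈[ N ] geom (k + d * suc k)
  dil-geom d k = inverse-unique dilated (geom-inverse (k + d * suc k))
    where
    dilated : (one ⊞ ⊟ mono (suc d * suc k)) ⊠ dil (suc d) (geom k) ≈[ N ] one
    dilated = trans (*-congʳ (sym (trans (dil-⊞ (suc d) one (⊟ mono (suc k)))
        (+-cong (dil-one (suc d)) (trans (dil-⊟ (suc d) (mono (suc k))) (-‿cong (dil-mono (suc d) (suc k))))))))
      (dil-inverse (suc d) (geom-inverse k))

  geom-square-split : ∀ k → geom k ≈[ N ] (one ⊞ mono (suc k)) ⊠ dil 2 (geom k)
  geom-square-split k = square-split (geom-inverse k) (begin
    (one ⊞ ⊟ (mono (suc k) ⊠ mono (suc k))) ⊠ dil 2 (geom k)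
      ≈⟨ *-cong (+-congˡ (-‿cong square)) (dil-geom 1 k) ⟩
    (one ⊞ ⊟ mono (suc (k + 1 * suc k))) ⊠ geom (k + 1 * suc k)
      ≈⟨ geom-inverse (k + 1 * suc k) ⟩
    one ∎)
    where
    square : mono (suc k) ⊠ mono (suc k) ≈[ N ] mono (suc (k + 1 * suc k))
    square = sym (trans (reflexive (≡.cong (λ n → mono (suc (k + n))) (ℕₚ.*-identityˡ (suc k)))) (mono-⊠ (suc k) (suc k)))

-- Dissections of ξ

factor : ℕ → Series
factor r = geom (r * 6) ⊠ geom (4 + r * 6)

-- With i, k, r unbounded these are F = 1/((q;q^6)(q^5;q^6)), E₂ = 1/(q^2;q^2),
-- E₆ = 1/(q^6;q^6), Z = Π_{3∤n} 1/(1 - q^n) and Y = Π_{3∤n} (1 + q^n).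
F E₂ E₆ Z Y : ℕ → Series
F n = ∏ˢ n factor
E₂ n = ∏ˢ n (λ k → geom (1 + k * 2))
E₆ n = ∏ˢ n (λ k → geom (5 + k * 6))
Z n = ∏ˢ n (λ i → geom (i * 3) ⊠ geom (1 + i * 3))
Y n = ∏ˢ n (λ i → (one ⊞ mono (1 + i * 3)) ⊠ (one ⊞ mono (2 + i * 3)))

sgn : ℕ → Series
sgn zero = one
sgn (suc r) = ⊟ sgn r

-- `c r` is (-1)^r q^{3r(r+1)}. `pole r` is (1 - q^{12r+6}) I_r in the additive form to which the
-- extraction of coefficients applies term by term.
c pole : ℕ → Series
c r = sgn r ⊠ mono (triangular (suc r) * 6)
pole r = (geom (r * 6) ⊞ geom (4 + r * 6)) ⊞ ⊟ one

L X : ℕ → Series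
L M = ∑ˢ (suc M) (λ r → c r ⊠ pole r)
X M = ∑ˢ (suc M) (λ n → mono (n * suc n * 6) ⊠ F (suc n))

-- The exponents are b(3b + 2) at b = a and at b = -(a + 1), written as the triple product with x =
-- q^5, y = q and Q = q^6 delivers them.
j₊ j₋ J : ℕ → Series
j₊ a = mono (a * 5 + triangular a * 6)
j₋ a = mono (suc a + triangular (suc a) * 6)
J n = ∑ˢ n j₊ ⊞ ∑ˢ n j₋

-- 1/(1 - q^n) stands here for q^n/(1 - q^n): over the two values n = 3i + 1 and n = 3i + 2 the
-- doubled constant terms add up to 4.
w W : ℕ → Series
w i = geom (i * 3) ⊞ geom (1 + i * 3)
W n = ∑ˢ n (λ i → w i ⊞ w i)

-- The doubled contributions of n = 6k + 1, 6k + 2, 6k + 4 and 6k + 5, with those of even n shown as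
-- dilations so that the even part can be read off.
W-pair : ℕ → Series
W-pair k = ((a ⊞ dil 2 b) ⊞ (a ⊞ dil 2 b)) ⊞ ((dil 2 b′ ⊞ a′) ⊞ (dil 2 b′ ⊞ a′))
  where
  a a′ b b′ : Series
  a = geom (k * 6)
  a′ = geom (4 + k * 6)
  b = geom (k * 3)
  b′ = geom (1 + k * 3)

module _ where
  open Data.Nat.Solver.+-*-Solver

  triangular-double : ∀ n → n * suc n ≡ triangular (suc n) * 2
  triangular-double zero = ≡.refl
  triangular-double (suc n) = ≡.trans
    (solve 1 (λ n → (con 1 :+ n) :* (con 2 :+ n) := n :* (con 1 :+ n) :+ (con 1 :+ n) :* con 2) ≡.refl n)
    (≡.trans (≡.cong (_+ suc n * 2) (triangular-double n)) (≡.sym (ℕₚ.*-distribʳ-+ 2 (triangular (suc n)) (suc n))))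

  triangular-even : ∀ n → triangular (n * 2) ≡ 4 * triangular n + n
  triangular-even zero = ≡.refl
  triangular-even (suc n) = ≡.trans
    (≡.cong (λ t → t + n * 2 + suc (n * 2)) (triangular-even n))
    (solve 2 (λ t n → con 4 :* t :+ n :+ n :* con 2 :+ (con 1 :+ n :* con 2) := con 4 :* (t :+ n) :+ (con 1 :+ n)) ≡.refl (triangular n) n)

  rogers-exponent : ∀ r → r * suc r * 6 + triangular (suc r) * 6 ≡ 3 * (triangular (suc r) * 6)
  rogers-exponent r = ≡.trans (≡.cong (λ t → t * 6 + triangular (suc r) * 6) (triangular-double r))
    (solve 1 (λ t → t :* con 2 :* con 6 :+ t :* con 6 := con 3 :* (t :* con 6)) ≡.refl (triangular (suc r)))

  pole-exponent : ∀ r → suc (r + r) * 6 ≡ (1 + r * 6) + (5 + r * 6)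
  pole-exponent = solve 1 (λ r → (con 1 :+ (r :+ r)) :* con 6 := (con 1 :+ r :* con 6) :+ (con 5 :+ r :* con 6)) ≡.refl

  geom-index : ∀ k → k + 1 * suc k ≡ 1 + k * 2
  geom-index = solve 1 (λ k → k :+ con 1 :* (con 1 :+ k) := con 1 :+ k :* con 2) ≡.refl

  j₊-even : ∀ k → k * 2 * 5 + triangular (k * 2) * 6 ≡ 2 * (k * 5 + triangular (k * 2) * 3)
  j₊-even k = solve 2 (λ k t → k :* con 2 :* con 5 :+ t :* con 6 := con 2 :* (k :* con 5 :+ t :* con 3)) ≡.refl k (triangular (k * 2))

  j₊-odd : ∀ k → (1 + k * 2) * 5 + triangular (1 + k * 2) * 6 ≡ 2 * (2 * (suc k + triangular (suc k) * 6)) + 1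
  j₊-odd k = ≡.trans (≡.cong (λ t → (1 + k * 2) * 5 + (t + k * 2) * 6) (triangular-even k))
    (solve 2 (λ k t → (con 1 :+ k :* con 2) :* con 5 :+ (con 4 :* t :+ k :+ k :* con 2) :* con 6
                   := con 2 :* (con 2 :* (con 1 :+ k :+ (t :+ k) :* con 6)) :+ con 1) ≡.refl k (triangular k))

  j₋-even : ∀ k → suc (k * 2) + triangular (suc (k * 2)) * 6 ≡ 2 * (2 * (k * 5 + triangular k * 6)) + 1
  j₋-even k = ≡.trans (≡.cong (λ t → suc (k * 2) + (t + k * 2) * 6) (triangular-even k))
    (solve 2 (λ k t → con 1 :+ k :* con 2 :+ (con 4 :* t :+ k :+ k :* con 2) :* con 6
                   := con 2 :* (con 2 :* (k :* con 5 :+ t :* con 6)) :+ con 1) ≡.refl k (triangular k))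

  j₋-odd : ∀ k → suc (1 + k * 2) + triangular (suc (1 + k * 2)) * 6 ≡ 2 * (suc k + triangular (suc (1 + k * 2)) * 3)
  j₋-odd k = solve 2 (λ k t → con 2 :+ k :* con 2 :+ t :* con 6 := con 2 :* (con 1 :+ k :+ t :* con 3)) ≡.refl k (triangular (suc (1 + k * 2)))

-- Appell sums, theta function and products at a fixed precision

module AtLevel (N M : ℕ) (N≤M : N ≤ M) where
  open Truncated N
  open QSeries (seriesRing N) (mono 6) M
  open import Relation.Binary.Reasoning.Setoid setoid

  private
    h-inverse : ∀ k → (one ⊞ ⊟ (mono 6 ^ suc k)) ⊠ geom (5 + k * 6) ≈[ N ] one
    h-inverse k = trans (*-congʳ (+-congˡ (-‿cong (mono-^ 6 (suc k))))) (geom-inverse (5 + k * 6))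

    module Id = Identities
      (trans (mono-^ 6 M) (mono-≈0 (ℕₚ.≤-trans N≤M (ℕₚ.m≤m*n M 6))))
      (λ k → geom (5 + k * 6)) h-inverse

    mono-⊠-Q^ : ∀ a r → mono a ⊠ (mono 6 ^ r) ≈[ N ] mono (a + r * 6)
    mono-⊠-Q^ a r = trans (*-congˡ (mono-^ 6 r)) (sym (mono-⊠ a (r * 6)))

    factor-inverse : ∀ r → ((one ⊞ ⊟ (mono 1 ⊠ (mono 6 ^ r))) ⊠ (one ⊞ ⊟ (mono 5 ⊠ (mono 6 ^ r)))) ⊠ factor r ≈[ N ] one
    factor-inverse r = unit-product
      (trans (*-congʳ (+-congˡ (-‿cong (mono-⊠-Q^ 1 r)))) (geom-inverse (r * 6)))
      (trans (*-congʳ (+-congˡ (-‿cong (mono-⊠-Q^ 5 r)))) (geom-inverse (4 + r * 6)))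

    module PF = Id.PartialFractions (mono 1) (mono 5)
      (sym (mono-⊠ 1 5)) factor factor-inverse

    sign≈sgn : ∀ r → Id.sign r ≈[ N ] sgn r
    sign≈sgn zero = refl
    sign≈sgn (suc r) = -‿cong (sign≈sgn r)

    numerator-factor : ∀ r → (one ⊞ ⊟ (mono 6 ^ suc (r + r))) ⊠ factor r ≈[ N ] pole r
    numerator-factor r = two-poles
      (trans (mono-^ 6 (suc (r + r))) (trans (reflexive (≡.cong mono (pole-exponent r))) (mono-⊠ (1 + r * 6) (5 + r * 6))))
      (geom-inverse (r * 6)) (geom-inverse (4 + r * 6))

  E₆-inverse : E₆ M ⊠ ∏ˢ M (λ k → one ⊞ ⊟ (mono 6 ^ suc k)) ≈[ N ] one
  E₆-inverse = Id.e-inverse M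

  -- The weight Q^{r(r+1)} of the sum meets Q^{r(r+1)/2} from `α r`, and together they are the cube
  -- of the latter. Hence the weight is that of `F-appell` with q replaced by q^3.
  X-appell : X M ≈[ N ] E₆ M ⊠ ∑ˢ (suc M) (λ r → dil 3 (c r) ⊠ pole r)
  X-appell = begin
    X M
      ≈⟨ ∑-cong (suc M) (λ n _ → *-congʳ {F (suc n)} (mono-^ 6 (n * suc n))) ⟨
    ∑ˢ (suc M) (λ n → (mono 6 ^ (n * suc n)) ⊠ F (suc n))
      ≈⟨ PF.rogers-fine ⟩
    E₆ M ⊠ ∑ˢ (suc M) (λ r → (mono 6 ^ (r * suc r)) ⊠ (Id.α r ⊠ factor r))
      ≈⟨ *-congˡ (∑-cong (suc M) (λ r _ → summand r)) ⟩
    E₆ M ⊠ ∑ˢ (suc M) (λ r → dil 3 (c r) ⊠ pole r) ∎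
    where
    dil-sgn : ∀ r → dil 3 (sgn r) ≈[ N ] sgn r
    dil-sgn zero = dil-one 3
    dil-sgn (suc r) = trans (dil-⊟ 3 (sgn r)) (-‿cong (dil-sgn r))
    powers : ∀ r → (mono 6 ^ (r * suc r)) ⊠ (mono 6 ^ triangular (suc r)) ≈[ N ] dil 3 (mono (triangular (suc r) * 6))
    powers r = begin
      (mono 6 ^ (r * suc r)) ⊠ (mono 6 ^ triangular (suc r))      ≈⟨ *-cong (mono-^ 6 (r * suc r)) (mono-^ 6 (triangular (suc r))) ⟩
      mono (r * suc r * 6) ⊠ mono (triangular (suc r) * 6)        ≈⟨ mono-⊠ (r * suc r * 6) (triangular (suc r) * 6) ⟨
      mono (r * suc r * 6 + triangular (suc r) * 6)               ≡⟨ ≡.cong mono (rogers-exponent r) ⟩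
      mono (3 * (triangular (suc r) * 6))                         ≈⟨ dil-mono 3 (triangular (suc r) * 6) ⟨
      dil 3 (mono (triangular (suc r) * 6))                       ∎
    summand : ∀ r → (mono 6 ^ (r * suc r)) ⊠ (Id.α r ⊠ factor r) ≈[ N ] dil 3 (c r) ⊠ pole r
    summand r = begin
      (mono 6 ^ (r * suc r)) ⊠ (Id.α r ⊠ factor r)
        ≈⟨ appell-term (Id.sign r) (mono 6 ^ triangular (suc r)) (mono 6 ^ suc (r + r)) (mono 6 ^ (r * suc r)) (geom (r * 6)) (geom (4 + r * 6)) ⟩
      (Id.sign r ⊠ ((mono 6 ^ (r * suc r)) ⊠ (mono 6 ^ triangular (suc r)))) ⊠ ((one ⊞ ⊟ (mono 6 ^ suc (r + r))) ⊠ factor r)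
        ≈⟨ *-cong (*-cong (trans (sign≈sgn r) (sym (dil-sgn r))) (powers r)) (numerator-factor r) ⟩
      (dil 3 (sgn r) ⊠ dil 3 (mono (triangular (suc r) * 6))) ⊠ pole r
        ≈⟨ *-congʳ (dil-⊠ 3 (sgn r) (mono (triangular (suc r) * 6))) ⟨
      dil 3 (c r) ⊠ pole r ∎

  F-appell : F (suc (M + M)) ≈[ N ] (E₆ M ⊠ E₆ M) ⊠ L M
  F-appell = trans (PF.product≈appell (M + M) ℕₚ.≤-refl) (*-congˡ (∑-cong (suc M) (λ r _ → summand r)))
    where
    summand : ∀ r → Id.α r ⊠ factor r ≈[ N ] c r ⊠ pole r
    summand r = begin
      Id.α r ⊠ factor r
        ≈⟨ trans (*-congʳ (sym (*-assoc (Id.sign r) (mono 6 ^ triangular (suc r)) (one ⊞ ⊟ (mono 6 ^ suc (r + r))))))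
                 (*-assoc (Id.sign r ⊠ (mono 6 ^ triangular (suc r))) (one ⊞ ⊟ (mono 6 ^ suc (r + r))) (factor r)) ⟩
      (Id.sign r ⊠ (mono 6 ^ triangular (suc r))) ⊠ ((one ⊞ ⊟ (mono 6 ^ suc (r + r))) ⊠ factor r)
        ≈⟨ *-cong (*-cong (sign≈sgn r) (mono-^ 6 (triangular (suc r)))) (numerator-factor r) ⟩
      c r ⊠ pole r ∎

  private
    P : Series
    P = ∏ˢ M (λ i → (one ⊞ mono (5 + i * 6)) ⊠ (one ⊞ mono (1 + i * 6)))

  theta-product : P ≈[ N ] E₆ M ⊠ J (suc M)
  theta-product = begin
    P
      ≈⟨ ∏-cong M (λ i _ → *-cong (+-congˡ (mono-⊠-Q^ 5 i)) (+-congˡ (mono-⊠-Q^ 1 i))) ⟨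
    ∏ˢ M (λ i → (one ⊞ mono 5 ⊠ (mono 6 ^ i)) ⊠ (one ⊞ mono 1 ⊠ (mono 6 ^ i)))
      ≈⟨ ∏-* M (λ i → one ⊞ mono 5 ⊠ (mono 6 ^ i)) (λ i → one ⊞ mono 1 ⊠ (mono 6 ^ i)) ⟩
    ∏ˢ M (λ i → one ⊞ mono 5 ⊠ (mono 6 ^ i)) ⊠ ∏ˢ M (λ i → one ⊞ mono 1 ⊠ (mono 6 ^ i))
      ≈⟨ Id.jacobi-triple-product (mono 5) (mono 1) (sym (mono-⊠ 5 1)) ⟩
    E₆ M ⊠ Id.theta (mono 5) (mono 1)
      ≈⟨ *-congˡ (+-cong (∑-cong (suc M) (λ a _ → power 5 a))
                         (∑-cong (suc M) (λ a _ → trans (power 1 (suc a)) (reflexive (≡.cong (λ n → mono (n + triangular (suc a) * 6)) (ℕₚ.*-identityʳ (suc a))))))) ⟩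
    E₆ M ⊠ J (suc M) ∎
    where
    power : ∀ b a → (mono b ^ a) ⊠ (mono 6 ^ triangular a) ≈[ N ] mono (a * b + triangular a * 6)
    power b a = trans (*-cong (mono-^ b a) (mono-^ 6 (triangular a))) (sym (mono-⊠ (a * b) (triangular a * 6)))

  factor-split : ∀ r → factor r ≈[ N ] ((one ⊞ mono (5 + r * 6)) ⊠ (one ⊞ mono (1 + r * 6))) ⊠ dil 2 (factor r)
  factor-split r = begin
    geom (r * 6) ⊠ geom (4 + r * 6)
      ≈⟨ *-cong (geom-square-split (r * 6)) (geom-square-split (4 + r * 6)) ⟩
    (a ⊠ dil 2 (geom (r * 6))) ⊠ (b ⊠ dil 2 (geom (4 + r * 6)))
      ≈⟨ *-interchange a (dil 2 (geom (r * 6))) b (dil 2 (geom (4 + r * 6))) ⟩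
    (a ⊠ b) ⊠ (dil 2 (geom (r * 6)) ⊠ dil 2 (geom (4 + r * 6)))
      ≈⟨ *-cong (*-comm a b) (sym (dil-⊠ 2 (geom (r * 6)) (geom (4 + r * 6)))) ⟩
    (b ⊠ a) ⊠ dil 2 (factor r) ∎
    where
    a b : Series
    a = one ⊞ mono (1 + r * 6)
    b = one ⊞ mono (5 + r * 6)

  -- With 1/(1 - a) = (1 + a)/(1 - a^2) in every factor, F is F(q^2) times the product of all (1 +
  -- q^{6i+5})(1 + q^{6i+1}), to which the triple product applies.
  F-theta : F M ≈[ N ] (E₆ M ⊠ J (suc M)) ⊠ dil 2 (F M)
  F-theta = begin
    F M
      ≈⟨ ∏-cong M (λ r _ → factor-split r) ⟩
    ∏ˢ M (λ r → ((one ⊞ mono (5 + r * 6)) ⊠ (one ⊞ mono (1 + r * 6))) ⊠ dil 2 (factor r))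
      ≈⟨ ∏-* M (λ r → (one ⊞ mono (5 + r * 6)) ⊠ (one ⊞ mono (1 + r * 6))) (λ r → dil 2 (factor r)) ⟩
    P ⊠ ∏ˢ M (λ r → dil 2 (factor r))
      ≈⟨ *-cong theta-product (sym (dil-∏ 2 M factor)) ⟩
    (E₆ M ⊠ J (suc M)) ⊠ dil 2 (F M) ∎

  F-stable : ∀ {n} → M ≤ n → F M ≈[ N ] F n
  F-stable M≤n = ∏-extend factor M≤n λ i M≤i → ≈1-product
    (geom-≈one (≤suc i (i * 6) M≤i (ℕₚ.m≤m*n i 6))) (geom-≈one (≤suc i (4 + i * 6) M≤i (ℕₚ.≤-trans (ℕₚ.m≤m*n i 6) (ℕₚ.m≤n+m (i * 6) 4))))
    where
    ≤suc : ∀ i k → M ≤ i → i ≤ k → N ≤ suc k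
    ≤suc i k M≤i i≤k = ℕₚ.≤-trans N≤M (ℕₚ.≤-trans M≤i (ℕₚ.m≤n⇒m≤1+n i≤k))

  -- F is evaluated twice, as an Appell sum with two factors `E₆` and as a theta function with one;
  -- a single `E₆` is cancelled.
  E₆L≈J : E₆ M ⊠ L M ≈[ N ] J (suc M) ⊠ dil 2 (F M)
  E₆L≈J = unit-cancel E₆-inverse (begin
    E₆ M ⊠ (E₆ M ⊠ L M)                   ≈⟨ *-assoc (E₆ M) (E₆ M) (L M) ⟨
    (E₆ M ⊠ E₆ M) ⊠ L M                   ≈⟨ F-appell ⟨
    F (suc (M + M))                       ≈⟨ F-stable (ℕₚ.m≤n⇒m≤1+n (ℕₚ.m≤m+n M M)) ⟨
    F M                                   ≈⟨ F-theta ⟩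
    (E₆ M ⊠ J (suc M)) ⊠ dil 2 (F M)      ≈⟨ *-assoc (E₆ M) (J (suc M)) (dil 2 (F M)) ⟩
    E₆ M ⊠ (J (suc M) ⊠ dil 2 (F M))      ∎)

  dil-2-geom : ∀ k → dil 2 (geom k) ≈[ N ] geom (1 + k * 2)
  dil-2-geom k = trans (dil-geom 1 k) (reflexive (≡.cong geom (geom-index k)))

  private
    M≤⇒N≤ : ∀ {i k} → M ≤ i → i ≤ k → N ≤ k
    M≤⇒N≤ M≤i i≤k = ℕₚ.≤-trans N≤M (ℕₚ.≤-trans M≤i i≤k)

    z : ℕ → Series
    z i = geom (i * 3) ⊠ geom (1 + i * 3)

    i≤1+i*3 : ∀ i → i ≤ 1 + i * 3
    i≤1+i*3 i = ℕₚ.m≤n⇒m≤1+n (ℕₚ.m≤m*n i 3)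

    geom-≈one₁ : ∀ {i} → M ≤ i → geom (i * 3) ≈[ N ] one
    geom-≈one₁ {i} M≤i = geom-≈one (M≤⇒N≤ M≤i (i≤1+i*3 i))

    geom-≈one₂ : ∀ {i} → M ≤ i → geom (1 + i * 3) ≈[ N ] one
    geom-≈one₂ {i} M≤i = geom-≈one (M≤⇒N≤ M≤i (ℕₚ.m≤n⇒m≤1+n (i≤1+i*3 i)))

    z-dil : ∀ k → dil 2 (z k) ≈[ N ] geom (1 + k * 3 * 2) ⊠ geom (1 + (1 + k * 3) * 2)
    z-dil k = trans (dil-⊠ 2 (geom (k * 3)) (geom (1 + k * 3))) (*-cong (dil-2-geom (k * 3)) (dil-2-geom (1 + k * 3)))

  -- Among the exponents 2n, those with n divisible by 3 make up `E₆`.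
  E₂-split : E₂ M ≈[ N ] E₆ M ⊠ dil 2 (Z M)
  E₂-split = begin
    E₂ M
      ≈⟨ ∏-extend f (ℕₚ.m≤m*n M 3) (λ i M≤i → geom-≈one (M≤⇒N≤ M≤i (ℕₚ.m≤n⇒m≤1+n (ℕₚ.m≤n⇒m≤1+n (ℕₚ.m≤m*n i 2))))) ⟩
    E₂ (M * 3)
      ≈⟨ ∏-triples M f ⟩
    ∏ˢ M (λ k → f (k * 3) ⊠ (f (1 + k * 3) ⊠ f (2 + k * 3)))
      ≈⟨ ∏-cong M (λ k _ → triple k) ⟩
    ∏ˢ M (λ k → geom (5 + k * 6) ⊠ dil 2 (z k))
      ≈⟨ ∏-* M (λ k → geom (5 + k * 6)) (λ k → dil 2 (z k)) ⟩
    E₆ M ⊠ ∏ˢ M (λ k → dil 2 (z k))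
      ≈⟨ *-congˡ (dil-∏ 2 M z) ⟨
    E₆ M ⊠ dil 2 (Z M) ∎
    where
    f : ℕ → Series
    f k = geom (1 + k * 2)
    triple : ∀ k → f (k * 3) ⊠ (f (1 + k * 3) ⊠ f (2 + k * 3)) ≈[ N ] geom (5 + k * 6) ⊠ dil 2 (z k)
    triple k = begin
      f (k * 3) ⊠ (f (1 + k * 3) ⊠ f (2 + k * 3))      ≈⟨ *-assoc (f (k * 3)) (f (1 + k * 3)) (f (2 + k * 3)) ⟨
      (f (k * 3) ⊠ f (1 + k * 3)) ⊠ f (2 + k * 3)      ≈⟨ *-comm (f (k * 3) ⊠ f (1 + k * 3)) (f (2 + k * 3)) ⟩
      f (2 + k * 3) ⊠ (f (k * 3) ⊠ f (1 + k * 3))      ≈⟨ *-cong (reflexive (≡.cong geom (≡.cong (5 +_) (ℕₚ.*-assoc k 3 2)))) (sym (z-dil k)) ⟩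
      geom (5 + k * 6) ⊠ dil 2 (z k)                   ∎

  private
    Z-stable : Z M ≈[ N ] Z (M * 2)
    Z-stable = ∏-extend z (ℕₚ.m≤m*n M 2) λ i M≤i → ≈1-product (geom-≈one₁ M≤i) (geom-≈one₂ M≤i)

    Z-double : Z (M * 2) ≈[ N ] F M ⊠ dil 2 (Z M)
    Z-double = begin
      Z (M * 2)                                     ≈⟨ ∏-pairs M z ⟩
      ∏ˢ M (λ k → z (k * 2) ⊠ z (1 + k * 2))        ≈⟨ ∏-cong M (λ k _ → pair k) ⟩
      ∏ˢ M (λ k → factor k ⊠ dil 2 (z k))           ≈⟨ ∏-* M factor (λ k → dil 2 (z k)) ⟩
      F M ⊠ ∏ˢ M (λ k → dil 2 (z k))                ≈⟨ *-congˡ (dil-∏ 2 M z) ⟨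
      F M ⊠ dil 2 (Z M)                             ∎
      where
      pair : ∀ k → z (k * 2) ⊠ z (1 + k * 2) ≈[ N ] factor k ⊠ dil 2 (z k)
      pair k = begin
        z (k * 2) ⊠ z (1 + k * 2)
          ≈⟨ *-outer-inner (geom (k * 2 * 3)) (geom (1 + k * 2 * 3)) (geom ((1 + k * 2) * 3)) (geom (1 + (1 + k * 2) * 3)) ⟩
        (geom (k * 2 * 3) ⊠ geom (4 + k * 2 * 3)) ⊠ (geom (1 + k * 2 * 3) ⊠ geom (3 + k * 2 * 3))
          ≡⟨ ≡.cong₂ (λ a b → (geom a ⊠ geom (4 + a)) ⊠ (geom (1 + b) ⊠ geom (3 + b))) (ℕₚ.*-assoc k 2 3) k*2*3≡k*3*2 ⟩
        factor k ⊠ (geom (1 + k * 3 * 2) ⊠ geom (1 + (1 + k * 3) * 2))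
          ≈⟨ *-congˡ (z-dil k) ⟨
        factor k ⊠ dil 2 (z k) ∎
        where
        k*2*3≡k*3*2 : k * 2 * 3 ≡ k * 3 * 2
        k*2*3≡k*3*2 = ≡.trans (ℕₚ.*-assoc k 2 3) (≡.sym (ℕₚ.*-assoc k 3 2))

    Z-overline : Z M ≈[ N ] Y M ⊠ dil 2 (Z M)
    Z-overline = begin
      Z M                                             ≈⟨ ∏-cong M (λ i _ → split i) ⟩
      ∏ˢ M (λ i → y i ⊠ dil 2 (z i))                  ≈⟨ ∏-* M y (λ i → dil 2 (z i)) ⟩
      Y M ⊠ ∏ˢ M (λ i → dil 2 (z i))                  ≈⟨ *-congˡ (dil-∏ 2 M z) ⟨
      Y M ⊠ dil 2 (Z M)                               ∎
      where
      y : ℕ → Series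
      y i = (one ⊞ mono (1 + i * 3)) ⊠ (one ⊞ mono (2 + i * 3))
      split : ∀ i → z i ≈[ N ] y i ⊠ dil 2 (z i)
      split i = begin
        z i
          ≈⟨ *-cong (geom-square-split (i * 3)) (geom-square-split (1 + i * 3)) ⟩
        ((one ⊞ mono (1 + i * 3)) ⊠ dil 2 (geom (i * 3))) ⊠ ((one ⊞ mono (2 + i * 3)) ⊠ dil 2 (geom (1 + i * 3)))
          ≈⟨ *-interchange (one ⊞ mono (1 + i * 3)) (dil 2 (geom (i * 3))) (one ⊞ mono (2 + i * 3)) (dil 2 (geom (1 + i * 3))) ⟩
        y i ⊠ (dil 2 (geom (i * 3)) ⊠ dil 2 (geom (1 + i * 3)))
          ≈⟨ *-congˡ (dil-⊠ 2 (geom (i * 3)) (geom (1 + i * 3))) ⟨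
        y i ⊠ dil 2 (z i) ∎

    Z⁻¹ : Series
    Z⁻¹ = ∏ˢ M (λ i → (one ⊞ ⊟ mono (1 + i * 3)) ⊠ (one ⊞ ⊟ mono (2 + i * 3)))

    Z-inverse : Z M ⊠ Z⁻¹ ≈[ N ] one
    Z-inverse = begin
      Z M ⊠ Z⁻¹
        ≈⟨ *-comm (Z M) Z⁻¹ ⟩
      Z⁻¹ ⊠ Z M
        ≈⟨ ∏-* M (λ i → (one ⊞ ⊟ mono (1 + i * 3)) ⊠ (one ⊞ ⊟ mono (2 + i * 3))) z ⟨
      ∏ˢ M (λ i → ((one ⊞ ⊟ mono (1 + i * 3)) ⊠ (one ⊞ ⊟ mono (2 + i * 3))) ⊠ z i)
        ≈⟨ ∏-≈1 M (λ i → unit-product (geom-inverse (i * 3)) (geom-inverse (1 + i * 3))) ⟩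
      one ∎

  -- Euler's theorem on odd and distinct parts, for parts prime to 3. The quotient Z/Z(q^2) is F if
  -- the even n are separated from the odd ones, and Y if each 1/(1 - q^n) is written as (1 +
  -- q^n)/(1 - q^{2n}).
  F≈Y : F M ≈[ N ] Y M
  F≈Y = unit-cancel (dil-inverse 2 Z-inverse) (begin
    dil 2 (Z M) ⊠ F M      ≈⟨ *-comm (dil 2 (Z M)) (F M) ⟩
    F M ⊠ dil 2 (Z M)      ≈⟨ Z-double ⟨
    Z (M * 2)              ≈⟨ Z-stable ⟨
    Z M                    ≈⟨ Z-overline ⟩
    Y M ⊠ dil 2 (Z M)      ≈⟨ *-comm (Y M) (dil 2 (Z M)) ⟩
    dil 2 (Z M) ⊠ Y M      ∎)

  Z⊠F≈1+W : Z M ⊠ F M ≈[ N ] one ⊞ W M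
  Z⊠F≈1+W = begin
    Z M ⊠ F M
      ≈⟨ *-congˡ F≈Y ⟩
    Z M ⊠ Y M
      ≈⟨ ∏-* M z (λ i → (one ⊞ mono (1 + i * 3)) ⊠ (one ⊞ mono (2 + i * 3))) ⟨
    ∏ˢ M (λ i → z i ⊠ ((one ⊞ mono (1 + i * 3)) ⊠ (one ⊞ mono (2 + i * 3))))
      ≈⟨ ∏-cong M (λ i _ → overline-pair (geom-inverse (i * 3)) (geom-inverse (1 + i * 3))) ⟩
    ∏ˢ M (λ i → one ⊞ (w i ⊞ w i))
      ≈⟨ ∏-1+2w M w ⟩
    one ⊞ W M ∎

  -- The terms beyond the bound are not 0 as integer series: each is 2(1 + 1) up to the truncation
  -- and vanishes only modulo 4.
  W-stable : W M ≈[ N ] W (M * 2)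
  W-stable = ∑-extend (λ i → w i ⊞ w i) (ℕₚ.m≤m*n M 2) λ i M≤i →
    trans (+-cong (+-cong (geom-≈one₁ M≤i) (geom-≈one₂ M≤i)) (+-cong (geom-≈one₁ M≤i) (geom-≈one₂ M≤i))) (4x≈0 one)

  J-stable : J (suc M) ≈[ N ] J (suc M * 2)
  J-stable = +-cong
    (∑-extend j₊ M≤ λ a M≤a → mono-≈0 (M≤⇒N≤ (ℕₚ.<⇒≤ M≤a) (ℕₚ.≤-trans (ℕₚ.m≤m*n a 5) (ℕₚ.m≤m+n (a * 5) (triangular a * 6)))))
    (∑-extend j₋ M≤ λ a M≤a → mono-≈0 (M≤⇒N≤ (ℕₚ.<⇒≤ M≤a) (ℕₚ.≤-trans (ℕₚ.n≤1+n a) (ℕₚ.m≤m+n (suc a) (triangular (suc a) * 6)))))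
    where
    M≤ : suc M ≤ suc M * 2
    M≤ = ℕₚ.m≤m*n (suc M) 2

  W-pairs : W (M * 2) ≈[ N ] ∑ˢ M W-pair
  W-pairs = trans (∑-pairs M (λ i → w i ⊞ w i)) (∑-cong M λ k _ →
    +-cong (+-cong (w-even k) (w-even k)) (+-cong (w-odd k) (w-odd k)))
    where
    k*3*2≡k*2*3 : ∀ k → k * 3 * 2 ≡ k * 2 * 3
    k*3*2≡k*2*3 k = ≡.trans (ℕₚ.*-assoc k 3 2) (≡.sym (ℕₚ.*-assoc k 2 3))
    w-even : ∀ k → w (k * 2) ≈[ N ] geom (k * 6) ⊞ dil 2 (geom (k * 3))
    w-even k = +-cong (reflexive (≡.cong geom (ℕₚ.*-assoc k 2 3)))
      (sym (trans (dil-2-geom (k * 3)) (reflexive (≡.cong (λ m → geom (1 + m)) (k*3*2≡k*2*3 k)))))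
    w-odd : ∀ k → w (1 + k * 2) ≈[ N ] dil 2 (geom (1 + k * 3)) ⊞ geom (4 + k * 6)
    w-odd k = +-cong
      (sym (trans (dil-2-geom (1 + k * 3)) (reflexive (≡.cong (λ m → geom (3 + m)) (k*3*2≡k*2*3 k)))))
      (reflexive (≡.cong (λ m → geom (4 + m)) (ℕₚ.*-assoc k 2 3)))

-- The odd part of J and the even part of W

module Sections (N M : ℕ) (2N≤M : 2 * N ≤ M) where
  private
    N≤M : N ≤ M
    N≤M = ℕₚ.≤-trans (ℕₚ.m≤m+n N (1 * N)) 2N≤M
  open Truncated N
  open AtLevel N M N≤M using (dil-2-geom)
  private
    module Coarse = AtLevel N M N≤M
    module Fine = AtLevel (2 * N) M 2N≤M
  open import Relation.Binary.Reasoning.Setoid setoid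

  -- If e = a(3a + 2) then 3e + 1 = (3a + 1)^2. An odd e has an odd a = -(2k + 1), where 3a + 1 =
  -- -2(3k + 1), so e = 4k(3k + 2) + 1. The change of sign of the index is why `j₊` and `j₋` are
  -- exchanged.
  sec-J : sec 2 1 (J (suc M)) ≈[ N ] dil 2 (J (suc M))
  sec-J = begin
    sec 2 1 (J n)                                      ≈⟨ sec-cong 2 (s≤s (s≤s z≤n)) Fine.J-stable ⟩
    sec 2 1 (J (n * 2))                                ≈⟨ sec-⊞ 2 1 (∑ˢ (n * 2) j₊) (∑ˢ (n * 2) j₋) ⟩
    sec 2 1 (∑ˢ (n * 2) j₊) ⊞ sec 2 1 (∑ˢ (n * 2) j₋)  ≈⟨ +-cong (halve j₊ j₋ 0-even₊ odd₊) (trans (pairs j₋) (∑-cong n λ k _ → even-odd₋ k)) ⟩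
    ∑ˢ n (λ k → dil 2 (j₋ k)) ⊞ ∑ˢ n (λ k → dil 2 (j₊ k))
                                                       ≈⟨ +-cong (dil-∑ 2 n j₋) (dil-∑ 2 n j₊) ⟨
    dil 2 (∑ˢ n j₋) ⊞ dil 2 (∑ˢ n j₊)                  ≈⟨ +-comm (dil 2 (∑ˢ n j₋)) (dil 2 (∑ˢ n j₊)) ⟩
    dil 2 (∑ˢ n j₊) ⊞ dil 2 (∑ˢ n j₋)                  ≈⟨ dil-⊞ 2 (∑ˢ n j₊) (∑ˢ n j₋) ⟨
    dil 2 (J n)                                        ∎
    where
    n = suc M
    pairs : ∀ (j : ℕ → Series) → sec 2 1 (∑ˢ (n * 2) j) ≈[ N ] ∑ˢ n (λ k → sec 2 1 (j (k * 2)) ⊞ sec 2 1 (j (1 + k * 2)))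
    pairs j = trans (sec-∑ 2 1 (n * 2) j) (∑-pairs n (λ i → sec 2 1 (j i)))
    0-even₊ : ∀ k → sec 2 1 (j₊ (k * 2)) ≈[ N ] 0ˢ
    0-even₊ k = trans (reflexive (≡.cong (λ e → sec 2 1 (mono e)) (j₊-even k))) (sec-mono-even (k * 5 + triangular (k * 2) * 3))
    odd : ∀ {e} e′ → e ≡ 2 * (2 * e′) + 1 → sec 2 1 (mono e) ≈[ N ] dil 2 (mono e′)
    odd e′ eq = trans (reflexive (≡.cong (λ e → sec 2 1 (mono e)) eq)) (trans (sec-mono-odd (2 * e′)) (sym (dil-mono 2 e′)))
    odd₊ : ∀ k → sec 2 1 (j₊ (1 + k * 2)) ≈[ N ] dil 2 (j₋ k)
    odd₊ k = odd (suc k + triangular (suc k) * 6) (j₊-odd k)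
    halve : ∀ (j j′ : ℕ → Series) → (∀ k → sec 2 1 (j (k * 2)) ≈[ N ] 0ˢ) → (∀ k → sec 2 1 (j (1 + k * 2)) ≈[ N ] dil 2 (j′ k)) →
      sec 2 1 (∑ˢ (n * 2) j) ≈[ N ] ∑ˢ n (λ k → dil 2 (j′ k))
    halve j j′ p q = trans (pairs j) (∑-cong n λ k _ → trans (+-cong (p k) (q k)) (+-identityˡ (dil 2 (j′ k))))
    even-odd₋ : ∀ k → sec 2 1 (j₋ (k * 2)) ⊞ sec 2 1 (j₋ (1 + k * 2)) ≈[ N ] dil 2 (j₊ k)
    even-odd₋ k = trans
      (+-cong (odd (k * 5 + triangular k * 6) (j₋-even k))
              (trans (reflexive (≡.cong (λ e → sec 2 1 (mono e)) (j₋-odd k))) (sec-mono-even (suc k + triangular (suc (1 + k * 2)) * 3))))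
      (+-identityʳ (dil 2 (j₊ k)))

  -- Let S be the sum of 1/(1 - q^n) over n prime to 3. Extracting the even coefficients fixes the
  -- terms with odd n and replaces n = 2m by m, so the even part of S plus S(q^2) is 2S. For W = 2S
  -- the right side is 4S = 0, and W(q^2) is its own negative. In terms of coefficients: 2m and m/2
  -- have equally many divisors prime to 3 modulo 2.
  sec-W : sec 2 0 (W M) ≈[ N ] dil 2 (W M)
  sec-W = trans (sec-cong 2 (s≤s z≤n) Fine.W-stable)
    (balance sum (sym Coarse.W-stable) (2∑≈0 (M * 2) w)
      (trans (sym (dil-⊞ 2 (W M) (W M))) (trans (dil-cong 2 (2∑≈0 M w)) (dil-0 2))))
    where
    a a′ b b′ : ℕ → Series
    a k = geom (k * 6)
    a′ k = geom (4 + k * 6)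
    b k = geom (k * 3)
    b′ k = geom (1 + k * 3)
    sec-W-pair : ∀ k → sec 2 0 (W-pair k) ≈[ N ] ((a k ⊞ b k) ⊞ (a k ⊞ b k)) ⊞ ((b′ k ⊞ a′ k) ⊞ (b′ k ⊞ a′ k))
    sec-W-pair k = trans (sec-⊞ 2 0 (x ⊞ x) (x′ ⊞ x′))
      (+-cong (trans (sec-⊞ 2 0 x x) (+-cong sec-x sec-x)) (trans (sec-⊞ 2 0 x′ x′) (+-cong sec-x′ sec-x′)))
      where
      x x′ : Series
      x = a k ⊞ dil 2 (b k)
      x′ = dil 2 (b′ k) ⊞ a′ k
      sec-x : sec 2 0 x ≈[ N ] a k ⊞ b k
      sec-x = trans (sec-⊞ 2 0 (a k) (dil 2 (b k))) (+-cong (sec-geom 2 (coprime-1+6r-2 k)) (sec-dil 2 (b k)))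
      sec-x′ : sec 2 0 x′ ≈[ N ] b′ k ⊞ a′ k
      sec-x′ = trans (sec-⊞ 2 0 (dil 2 (b′ k)) (a′ k)) (+-cong (sec-dil 2 (b′ k)) (sec-geom 2 (coprime-5+6r-2 k)))
    dil-w+w : ∀ k → dil 2 (w k ⊞ w k) ≈[ N ] (dil 2 (b k) ⊞ dil 2 (b′ k)) ⊞ (dil 2 (b k) ⊞ dil 2 (b′ k))
    dil-w+w k = trans (dil-⊞ 2 (w k) (w k)) (+-cong (dil-⊞ 2 (b k) (b′ k)) (dil-⊞ 2 (b k) (b′ k)))
    sum : sec 2 0 (W (M * 2)) ⊞ dil 2 (W M) ≈[ N ] W (M * 2) ⊞ W M
    sum = begin
      sec 2 0 (W (M * 2)) ⊞ dil 2 (W M)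
        ≈⟨ +-cong (trans (sec-cong 2 (s≤s z≤n) Fine.W-pairs) (sec-∑ 2 0 M W-pair)) (dil-∑ 2 M (λ k → w k ⊞ w k)) ⟩
      ∑ˢ M (λ k → sec 2 0 (W-pair k)) ⊞ ∑ˢ M (λ k → dil 2 (w k ⊞ w k))
        ≈⟨ ∑-+ M (λ k → sec 2 0 (W-pair k)) (λ k → dil 2 (w k ⊞ w k)) ⟨
      ∑ˢ M (λ k → sec 2 0 (W-pair k) ⊞ dil 2 (w k ⊞ w k))
        ≈⟨ ∑-cong M (λ k _ → trans (+-cong (sec-W-pair k) (dil-w+w k))
             (regroup-doubles (a k) (b k) (b′ k) (a′ k) (dil 2 (b k)) (dil 2 (b′ k)))) ⟩
      ∑ˢ M (λ k → W-pair k ⊞ (w k ⊞ w k))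
        ≈⟨ ∑-+ M W-pair (λ k → w k ⊞ w k) ⟩
      ∑ˢ M W-pair ⊞ W M
        ≈⟨ +-congʳ Coarse.W-pairs ⟨
      W (M * 2) ⊞ W M ∎

-- Every third coefficient of X

module Thirds (N M : ℕ) (3N≤M : 3 * N ≤ M) where
  private
    N≤M : N ≤ M
    N≤M = ℕₚ.≤-trans (ℕₚ.m≤m+n N (2 * N)) 3N≤M
  open Truncated N
  open AtLevel N M N≤M
  private module Fine = AtLevel (3 * N) M 3N≤M
  open import Relation.Binary.Reasoning.Setoid setoid

  sec-X : sec 3 0 (X M) ≈[ N ] E₂ M ⊠ L M
  sec-X = begin
    sec 3 0 (X M)
      ≈⟨ sec-cong 3 (s≤s z≤n) (T.trans Fine.X-appell (T.*-congʳ E₆-dil)) ⟩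
    sec 3 0 (dil 3 (E₂ M) ⊠ ∑ˢ (suc M) (λ r → dil 3 (c r) ⊠ pole r))
      ≈⟨ sec-dil-⊠ 3 (E₂ M) (∑ˢ (suc M) (λ r → dil 3 (c r) ⊠ pole r)) (s≤s z≤n) ⟩
    E₂ M ⊠ sec 3 0 (∑ˢ (suc M) (λ r → dil 3 (c r) ⊠ pole r))
      ≈⟨ *-congˡ (trans (sec-∑ 3 0 (suc M) (λ r → dil 3 (c r) ⊠ pole r)) (∑-cong (suc M) λ r _ →
           trans (sec-dil-⊠ 3 (c r) (pole r) (s≤s z≤n)) (*-congˡ (sec-pole r)))) ⟩
    E₂ M ⊠ L M ∎
    where
    module T = Truncated (3 * N)
    -- 1/(q^6;q^6) is a series in q^3, so the extraction turns it into 1/(q^2;q^2).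
    E₆-dil : E₆ M ≈[ 3 * N ] dil 3 (E₂ M)
    E₆-dil = T.trans (T.∏-cong M λ k _ → T.sym (T.trans (T.dil-geom 2 (1 + k * 2)) (T.reflexive (≡.cong geom (index k)))))
      (T.sym (T.dil-∏ 3 M (λ k → geom (1 + k * 2))))
      where
      open Data.Nat.Solver.+-*-Solver
      index : ∀ k → (1 + k * 2) + 2 * suc (1 + k * 2) ≡ 5 + k * 6
      index = solve 1 (λ k → (con 1 :+ k :* con 2) :+ con 2 :* (con 2 :+ k :* con 2) := con 5 :+ k :* con 6) ≡.refl
    sec-pole : ∀ r → sec 3 0 (pole r) ≈[ N ] pole r
    sec-pole r = trans (sec-⊞ 3 0 (geom (r * 6) ⊞ geom (4 + r * 6)) (⊟ one))
      (+-cong (trans (sec-⊞ 3 0 (geom (r * 6)) (geom (4 + r * 6)))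
                (+-cong (sec-geom 3 (coprime-1+6r-3 r)) (sec-geom 3 (coprime-5+6r-3 r))))
              (trans (sec-⊟ 3 0 one) (-‿cong (sec-one 3))))

  sec-X-theta : sec 3 0 (X M) ≈[ N ] J (suc M) ⊠ dil 2 (one ⊞ W M)
  sec-X-theta = begin
    sec 3 0 (X M)                                 ≈⟨ sec-X ⟩
    E₂ M ⊠ L M                                    ≈⟨ *-congʳ E₂-split ⟩
    (E₆ M ⊠ dil 2 (Z M)) ⊠ L M                    ≈⟨ *-rotate (E₆ M) (dil 2 (Z M)) (L M) ⟩
    dil 2 (Z M) ⊠ (E₆ M ⊠ L M)                    ≈⟨ *-congˡ E₆L≈J ⟩
    dil 2 (Z M) ⊠ (J (suc M) ⊠ dil 2 (F M))       ≈⟨ *-rotate (J (suc M)) (dil 2 (Z M)) (dil 2 (F M)) ⟨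
    (J (suc M) ⊠ dil 2 (Z M)) ⊠ dil 2 (F M)       ≈⟨ *-assoc (J (suc M)) (dil 2 (Z M)) (dil 2 (F M)) ⟩
    J (suc M) ⊠ (dil 2 (Z M) ⊠ dil 2 (F M))       ≈⟨ *-congˡ (dil-⊠ 2 (Z M) (F M)) ⟨
    J (suc M) ⊠ dil 2 (Z M ⊠ F M)                 ≈⟨ *-congˡ (dil-cong 2 Z⊠F≈1+W) ⟩
    J (suc M) ⊠ dil 2 (one ⊞ W M)                 ∎

-- Self-similarity of A

module Dissection (N M : ℕ) (12N≤M : 3 * (2 * (2 * N)) ≤ M) where
  private
    ≤3* : ∀ n → n ≤ 3 * n
    ≤3* n = ℕₚ.m≤m+n n (2 * n)
    4N≤M : 2 * (2 * N) ≤ M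
    4N≤M = ℕₚ.≤-trans (≤3* (2 * (2 * N))) 12N≤M
    2N≤M : 2 * N ≤ M
    2N≤M = ℕₚ.≤-trans (ℕₚ.m≤m+n (2 * N) (1 * (2 * N))) 4N≤M
    N≤4N : N ≤ 2 * (2 * N)
    N≤4N = ℕₚ.≤-trans (ℕₚ.m≤m+n N (1 * N)) (ℕₚ.m≤m+n (2 * N) (1 * (2 * N)))
    A G : Series
    A = sec 3 0 (X M)
    G = one ⊞ W M
    -- Precision is spent along the extractions: `X M` is controlled up to 12N, `A` up to 4N, its
    -- odd part up to 2N, and the even part of that up to N.
    A-theta : A ≈[ 2 * (2 * N) ] J (suc M) ⊠ dil 2 G
    A-theta = Thirds.sec-X-theta (2 * (2 * N)) M 12N≤M

    odd-part : sec 2 1 A ≈[ 2 * N ] dil 2 (J (suc M)) ⊠ G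
    odd-part = begin
      sec 2 1 A                               ≈⟨ sec-cong 2 (s≤s (s≤s z≤n)) (Truncated.trans (2 * (2 * N)) A-theta
                                                   (Truncated.*-comm (2 * (2 * N)) (J (suc M)) (dil 2 G))) ⟩
      sec 2 1 (dil 2 G ⊠ J (suc M))           ≈⟨ sec-dil-⊠ 2 G (J (suc M)) (s≤s (s≤s z≤n)) ⟩
      G ⊠ sec 2 1 (J (suc M))                 ≈⟨ *-congˡ (Sections.sec-J (2 * N) M 4N≤M) ⟩
      G ⊠ dil 2 (J (suc M))                   ≈⟨ *-comm G (dil 2 (J (suc M))) ⟩
      dil 2 (J (suc M)) ⊠ G                   ∎
      where
      open Truncated (2 * N)
      open import Relation.Binary.Reasoning.Setoid setoid

  A-self-similar : sec 2 0 (sec 2 1 (sec 3 0 (X M))) ≈[ N ] sec 3 0 (X M)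
  A-self-similar = begin
    sec 2 0 (sec 2 1 A)                       ≈⟨ sec-cong 2 (s≤s z≤n) odd-part ⟩
    sec 2 0 (dil 2 (J (suc M)) ⊠ G)           ≈⟨ sec-dil-⊠ 2 (J (suc M)) G (s≤s z≤n) ⟩
    J (suc M) ⊠ sec 2 0 G                     ≈⟨ *-congˡ (trans (sec-⊞ 2 0 one (W M)) (+-cong (sec-one 2) (Sections.sec-W N M 2N≤M))) ⟩
    J (suc M) ⊠ (one ⊞ dil 2 (W M))           ≈⟨ *-congˡ (trans (dil-⊞ 2 one (W M)) (+-congʳ (dil-one 2))) ⟨
    J (suc M) ⊠ dil 2 G                       ≈⟨ ≈-weaken N≤4N A-theta ⟨
    A                                         ∎
    where
    open Truncated N
    open import Relation.Binary.Reasoning.Setoid setoid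

-- Return to the coefficients of ξ

opaque
  unfolding _⊞_ sec

  ∑ˢ-at : ∀ n (f : ℕ → Series) m → ∑ˢ n f m ≡ sumBelow n (λ k → f k m)
  ∑ˢ-at zero f m = ≡.refl
  ∑ˢ-at (suc n) f m = ≡.trans (≡.cong (f 0 m +_) (∑ˢ-at n (f ∘ suc) m)) (≡.sym (sumBelow-suc n (λ k → f k m)))

  sec-at : ∀ d r f m → sec d r f m ≡ f (d * m + r)
  sec-at d r f m = ≡.refl

  invPoch≈F : ∀ N n → invPoch n ≈[ N ] F n
  invPoch≈F N zero = refl
    where open Truncated N
  invPoch≈F N (suc n) = trans (*-cong (invPoch≈F N n) (reflexive (≡.cong₂ (λ a b → geom a ⊠ geom b) (ℕₚ.*-comm 6 n)
      (≡.trans (ℕₚ.+-comm (6 * n) 4) (≡.cong (4 +_) (ℕₚ.*-comm 6 n))))))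
    (sym (∏-snoc n factor))
    where open Truncated N

  term-at : ∀ k j → term (suc k) (suc j) % 4 ≡ (mono (k * suc k * 6) ⊠ F (suc k)) j % 4
  term-at k j = begin
    term (suc k) (suc j) % 4
      ≡⟨ ≡.cong (λ e → (mono e ⊛ invPoch (suc k)) (suc j) % 4) exponent ⟩
    (mono (suc (k * suc k * 6)) ⊛ invPoch (suc k)) (suc j) % 4
      -- `mono (suc _)` has constant term 0, so that summand computes away; this is the removal of
      -- the factor q in ξ = 1 + 2qX.
      ≡⟨ ≡.cong (_% 4) (⊛-suc (mono (suc (k * suc k * 6))) (invPoch (suc k)) j) ⟩
    (mono (k * suc k * 6) ⊛ invPoch (suc k)) j % 4
      ≡⟨ at (*-congˡ {mono (k * suc k * 6)} {invPoch (suc k)} {F (suc k)} (invPoch≈F (suc j) (suc k))) j ℕₚ.≤-refl ⟩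
    (mono (k * suc k * 6) ⊠ F (suc k)) j % 4 ∎
    where
    open ≡-Reasoning
    open Truncated (suc j) using (*-congˡ)
    open Data.Nat.Solver.+-*-Solver
    exponent : 6 * suc k * suc k ∸ 6 * suc k + 1 ≡ suc (k * suc k * 6)
    exponent = ≡.trans
      (≡.cong (λ n → n ∸ 6 * suc k + 1)
        (solve 1 (λ k → con 6 :* (con 1 :+ k) :* (con 1 :+ k) := con 6 :* (con 1 :+ k) :+ k :* (con 1 :+ k) :* con 6) ≡.refl k))
      (≡.trans (≡.cong (_+ 1) (ℕₚ.m+n∸m≡n (6 * suc k) (k * suc k * 6))) (ℕₚ.+-comm (k * suc k * 6) 1))

2*n%8 : ∀ n → 2 * n % 8 ≡ n % 4 * 2
2*n%8 n = ≡.trans (≡.cong (_% 8) (ℕₚ.*-comm 2 n)) (≡.sym (m%n*o≡m*o%[n*o] n 4 2))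

pξ-X : ∀ M j → j ≤ M → pξ (suc j) % 8 ≡ 2 * X M j % 8
pξ-X M j j≤M = begin
  -- At the exponent j + 1 the constant term `one` of ξ computes to 0.
  2 * s % 8                ≡⟨ 2*n%8 s ⟩
  s % 4 * 2                ≡⟨ ≡.cong (_* 2) s≡X ⟩
  X M j % 4 * 2            ≡⟨ 2*n%8 (X M j) ⟨
  2 * X M j % 8            ∎
  where
  open ≡-Reasoning
  s = sumBelow (suc j) (λ k → term (suc k) (suc j))
  summand : ℕ → Series
  summand k = mono (k * suc k * 6) ⊠ F (suc k)
  -- Summands with k > j start at q^{6k(k+1)}, beyond q^j, so the bound that depends on j can be
  -- raised to the common M.
  extend : ∑ˢ (suc j) summand ≈[ suc j ] X M
  extend = ∑-extend summand (s≤s j≤M) λ k j<k → 0*-≈0 (F (suc k)) (mono-≈0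
    (ℕₚ.≤-trans j<k (ℕₚ.≤-trans (ℕₚ.m≤m*n k (suc k)) (ℕₚ.m≤m*n (k * suc k) 6))))
    where open Truncated (suc j)
  s≡X : s % 4 ≡ X M j % 4
  s≡X = begin
    s % 4                                              ≡⟨ sumBelow-%-cong (suc j) (λ k → term (suc k) (suc j)) (λ k → summand k j) (λ k _ → term-at k j) ⟩
    sumBelow (suc j) (λ k → summand k j) % 4           ≡⟨ ≡.cong (_% 4) (∑ˢ-at (suc j) summand j) ⟨
    ∑ˢ (suc j) summand j % 4                           ≡⟨ at extend j ℕₚ.≤-refl ⟩
    X M j % 4                                          ∎

theorem4p9 : (n : ℕ) → pξ (12 * n + 4) % 8 ≡ pξ (3 * n + 1) % 8
theorem4p9 n = begin
  -- The index is written as the nested application of `sec-at` produces it, with its zero residues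
  -- kept.
  pξ (12 * n + 4) % 8                  ≡⟨ ≡.cong (λ m → pξ m % 8) (solve 1 (λ n → con 12 :* n :+ con 4 := con 1 :+ (con 3 :* (con 2 :* (con 2 :* n :+ con 0) :+ con 1) :+ con 0)) ≡.refl n) ⟩
  pξ (suc (3 * (2 * (2 * n + 0) + 1) + 0)) % 8
                                       ≡⟨ pξ-X M (3 * (2 * (2 * n + 0) + 1) + 0) 12n+3≤M ⟩
  2 * X M (3 * (2 * (2 * n + 0) + 1) + 0) % 8
                                       ≡⟨ ≡.cong (λ x → 2 * x % 8) sections ⟨
  2 * sec 2 0 (sec 2 1 (sec 3 0 (X M))) n % 8
                                       ≡⟨ %-double {sec 2 0 (sec 2 1 (sec 3 0 (X M))) n} {sec 3 0 (X M) n}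
                                            (at (Dissection.A-self-similar (suc n) M ℕₚ.≤-refl) n ℕₚ.≤-refl) ⟩
  2 * sec 3 0 (X M) n % 8              ≡⟨ ≡.cong (λ x → 2 * x % 8) (sec-at 3 0 (X M) n) ⟩
  2 * X M (3 * n + 0) % 8              ≡⟨ pξ-X M (3 * n + 0) 3n≤M ⟨
  pξ (suc (3 * n + 0)) % 8             ≡⟨ ≡.cong (λ m → pξ m % 8) (≡.trans (≡.cong suc (ℕₚ.+-identityʳ (3 * n))) (ℕₚ.+-comm 1 (3 * n))) ⟩
  pξ (3 * n + 1) % 8                   ∎
  where
  open ≡-Reasoning
  open Data.Nat.Solver.+-*-Solver
  -- The bound of `Dissection` for precision n + 1, the least that reaches the coefficient of q^n.
  M = 3 * (2 * (2 * suc n))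
  %-double : ∀ {a b} → a % 4 ≡ b % 4 → 2 * a % 8 ≡ 2 * b % 8
  %-double {a} {b} eq = ≡.trans (2*n%8 a) (≡.trans (≡.cong (_* 2) eq) (≡.sym (2*n%8 b)))
  sections : sec 2 0 (sec 2 1 (sec 3 0 (X M))) n ≡ X M (3 * (2 * (2 * n + 0) + 1) + 0)
  sections = ≡.trans (sec-at 2 0 (sec 2 1 (sec 3 0 (X M))) n)
    (≡.trans (sec-at 2 1 (sec 3 0 (X M)) (2 * n + 0)) (sec-at 3 0 (X M) (2 * (2 * n + 0) + 1)))
  12n+3≤M : 3 * (2 * (2 * n + 0) + 1) + 0 ≤ M
  12n+3≤M = ℕₚ.≤-trans (ℕₚ.m≤m+n _ 9) (ℕₚ.≤-reflexive
    (solve 1 (λ n → con 3 :* (con 2 :* (con 2 :* n :+ con 0) :+ con 1) :+ con 0 :+ con 9 := con 3 :* (con 2 :* (con 2 :* (con 1 :+ n)))) ≡.refl n))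
  3n≤M : 3 * n + 0 ≤ M
  3n≤M = ℕₚ.≤-trans (ℕₚ.m≤m+n _ (12 + 9 * n)) (ℕₚ.≤-reflexive
    (solve 1 (λ n → con 3 :* n :+ con 0 :+ (con 12 :+ con 9 :* n) := con 3 :* (con 2 :* (con 2 :* (con 1 :+ n)))) ≡.refl n))
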